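{- For every integer $0\le k\le7$ the following hold. (a) $\dim_{\mathbb{Q}}\operatorname{gr}^W_k(\mathcal{Z}_q)$ equals the coefficient of $x^k$ in the power series expansion of $\dfrac{1}{1-x-x^2-x^3+x^6+x^7+x^8+x^9}$. (b) Every bi-bracket of weight $k$ is a $\mathbb{Q}$-linear combination of positive bi-brackets. (c) Every bi-bracket of weight $k$ is a $\mathbb{Q}$-linear combination of brackets. (d) Every bracket of weight $k$ is a $\mathbb{Q}$-linear combination of $123$-brackets.
   Context: For $s_1,\dots,s_l\ge1$, $r_1,\dots,r_l\ge0$ the bi-bracket is $$\begin{bmatrix} s_1,\dots,s_l\\ r_1,\dots,r_l\end{bmatrix}=\sum_{\substack{u_1>\cdots>u_l>0\\ v_1,\dots,v_l>0}}\frac{u_1^{r_1}\cdots u_l^{r_l}}{r_1!\cdots r_l!}\cdot\frac{v_1^{s_1-1}\cdots v_l^{s_l-1}}{(s_1-1)!\cdots(s_l-1)!}\,q^{u_1v_1+\cdots+u_lv_l}\in\mathbb{Q}[[q]]$$ (equal to $1$ for $l=0$); it has depth $l$ and weight $s_1+\cdots+s_l+r_1+\cdots+r_l$. A bracket is $[s_1,\dots,s_l]=\begin{bmatrix} s_1,\dots,s_l\\ 0,\dots,0\end{bmatrix}$. A bi-bracket is positive if $s_j>r_j$ for all $j$. A $123$-bracket is a bracket $[s_1,\dots,s_l]$ with $l\ge0$ and all $s_j\in\{1,2,3\}$. $\mathcal{Z}_q$ is the $\mathbb{Q}$-span of all bi-brackets; $\operatorname{Fil}^W_k(\mathcal{Z}_q)$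 is the $\mathbb{Q}$-span of the bi-brackets of depth $\le k$ and weight $\le k$ (and $\operatorname{Fil}^W_{ -1}=0$), and $\operatorname{gr}^W_k(\mathcal{Z}_q)=\operatorname{Fil}^W_k(\mathcal{Z}_q)/\operatorname{Fil}^W_{k-1}(\mathcal{Z}_q)$. -}

module Defs where

open import Data.Nat as ℕ using (ℕ; zero; suc; _∸_; _^_; _≤_; _<_; _!)
open import Data.Nat.Properties using (_!≢0)
open import Data.Integer as ℤ using (ℤ; +_)
open import Data.Rational as ℚ using (ℚ; 0ℚ; 1ℚ; _+_; _*_; _-_; _/_)
open import Data.Fin using (Fin)
open import Data.List using (List; []; _∷_; upTo; map; foldr; zipWith; length)
open import Data.List.Relation.Unary.All using (All)
open import Data.Product using (_×_; _,_; proj₁; proj₂; Σ; ∃; ∃-syntax)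
open import Data.Sum using (_⊎_)
open import Data.Bool using (if_then_else_)
open import Relation.Nullary.Decidable using (⌊_⌋)
open import Relation.Binary.PropositionalEquality using (_≡_)

-- q-series in ℚ[[q]], represented by their coefficient sequences
Series : Set
Series = ℕ → ℚ

sumFrom1 : ℕ → (ℕ → ℚ) → ℚ
sumFrom1 m f = foldr (λ i acc → f (suc i) + acc) 0ℚ (upTo m)

sumFin : ∀ {d} → (Fin d → ℚ) → ℚ
sumFin {zero} f = 0ℚ
sumFin {suc d} f = f Fin.zero + sumFin {d} (λ i → f (Fin.suc i))
  where import Data.Fin as Fin

-- a bi-index: list of pairs (s_j , r_j), j = 1..l
BiIndex : Set
BiIndex = List (ℕ × ℕ)

ValidBi : BiIndex → Set
ValidBi = All (λ p → 1 ≤ proj₁ p)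

depth : BiIndex → ℕ
depth = length

weight : BiIndex → ℕ
weight = foldr (λ p acc → proj₁ p ℕ.+ proj₂ p ℕ.+ acc) 0

term : ℕ → ℕ → ℕ → ℕ → ℚ
term s r u v = ((+ (u ^ r)) / (r !)) {{r !≢0}} * ((+ (v ^ (s ∸ 1))) / ((s ∸ 1) !)) {{(s ∸ 1) !≢0}}

-- coefSum ι N m = Σ over m > u_1 > ⋯ > u_l > 0, v_j > 0 with Σ u_j v_j = N
-- of Π u_j^{r_j}/r_j! · v_j^{s_j-1}/(s_j-1)!
coefSum : BiIndex → ℕ → ℕ → ℚ
coefSum [] N m = if ⌊ N ℕ.≟ 0 ⌋ then 1ℚ else 0ℚ
coefSum ((s , r) ∷ ι) N m =
  sumFrom1 (m ∸ 1) (λ u → sumFrom1 N (λ v →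
    if ⌊ u ℕ.* v ℕ.≤? N ⌋ then term s r u v * coefSum ι (N ∸ u ℕ.* v) u else 0ℚ))

-- the bi-bracket [s_1..s_l ; r_1..r_l] as a q-series (coefficient of q^N);
-- u_1 ≤ N is automatic since v_1 ≥ 1
biBracket : BiIndex → Series
biBracket ι N = coefSum ι N (suc N)

evalLC : List (ℚ × BiIndex) → Series
evalLC L N = foldr (λ p acc → proj₁ p * biBracket (proj₂ p) N + acc) 0ℚ L

InSpan : (BiIndex → Set) → Series → Set
InSpan P f = Σ (List (ℚ × BiIndex)) λ L → All (λ p → P (proj₂ p)) L × (∀ N → f N ≡ evalLC L N)

GenFil : ℕ → BiIndex → Set
GenFil k ι = ValidBi ι × depth ι ≤ k × weight ι ≤ k

-- generators of Fil^W_{k-1} : depth < k and weight < k (none when k = 0, so Fil^W_{-1} = 0)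
GenFilBelow : ℕ → BiIndex → Set
GenFilBelow k ι = ValidBi ι × depth ι < k × weight ι < k

Fil : ℕ → Series → Set
Fil k = InSpan (GenFil k)

FilBelow : ℕ → Series → Set
FilBelow k = InSpan (GenFilBelow k)

combo : ∀ {d} → (Fin d → ℚ) → (Fin d → Series) → Series
combo c b N = sumFin (λ i → c i * b i N)

-- dim_ℚ gr^W_k(Z_q) = d : there are b_1..b_d in Fil_k whose classes form a basis of Fil_k / Fil_{k-1}
GrDim : ℕ → ℕ → Set
GrDim k d = Σ (Fin d → Series) λ b →
    (∀ i → Fil k (b i))
  × (∀ (c : Fin d → ℚ) → FilBelow k (combo c b) → ∀ i → c i ≡ 0ℚ)
  × (∀ ι → GenFil k ι → Σ (Fin d → ℚ) λ c → FilBelow k (λ N → biBracket ι N - combo c b N))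

Positive : BiIndex → Set
Positive = All (λ p → proj₂ p < proj₁ p)

IsBracket : BiIndex → Set
IsBracket = All (λ p → 1 ≤ proj₁ p × proj₂ p ≡ 0)

Is123 : BiIndex → Set
Is123 = All (λ p → (proj₁ p ≡ 1 ⊎ proj₁ p ≡ 2 ⊎ proj₁ p ≡ 3) × proj₂ p ≡ 0)

-- power series inverse of a polynomial with constant term 1, given by coefficient list d_0 = 1, d_1, d_2, …
-- revInv ds n = (c_n , c_{n-1} , … , c_0) with c_0 = 1, c_n = - Σ_{i=1}^n d_i c_{n-i}
revInv : List ℤ → ℕ → List ℤ
revInv ds zero = + 1 ∷ []
revInv ds (suc n) = ℤ.- (foldr ℤ._+_ (+ 0) (zipWith ℤ._*_ (tail ds) (revInv ds n))) ∷ revInv ds n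
  where
  tail : List ℤ → List ℤ
  tail [] = []
  tail (_ ∷ xs) = xs

invCoeff : List ℤ → ℕ → ℤ
invCoeff ds n with revInv ds n
... | [] = + 0
... | c ∷ _ = c

denomPoly : List ℤ
denomPoly = + 1 ∷ ℤ.- (+ 1) ∷ ℤ.- (+ 1) ∷ ℤ.- (+ 1) ∷ + 0 ∷ + 0 ∷ + 1 ∷ + 1 ∷ + 1 ∷ + 1 ∷ []

dimSeq : ℕ → ℤ
dimSeq = invCoeff denomPoly

{-# OPTIONS --safe #-}
-- Writing u_j = d_j + ⋯ + d_l, a bi-bracket becomes a sum over positive d and v of polynomials times
-- q^(Σ_{j ≤ i} d_i v_j); this form is symmetric under reversing and exchanging d and v, which gives linear
-- relations between bi-brackets of the same weight (duality). Products of bi-brackets are given by the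
-- quasi-shuffle product, up to bi-brackets of lower weight, so products of duality relations with bi-brackets
-- are relations modulo lower weight. In every weight k ≤ 7 Gaussian elimination with these relations expresses
-- all bi-brackets by 1, 1, 2, 4, 7, 13, 23, 41 brackets with entries in {1,2,3}. The resulting 92 brackets are
-- linearly independent already on the coefficients of q^0, …, q^91, which is again checked by elimination.
module Submission where

open import Defs
open import Data.Bool using (Bool; true; false; if_then_else_; _∧_; T)
open import Data.Empty using (⊥; ⊥-elim)
open import Data.Fin using (Fin; zero; suc)
open import Data.Integer as ℤ using (ℤ; +_; -[1+_])
import Data.Integer.Properties as ℤ
open import Data.List using (List; []; _∷_; _++_; map; foldr; concatMap; upTo; applyUpTo; length; filterᵇ; zipWith; take; replicate; lookup; tabulate)
open import Data.List.Membership.Propositional using (_∈_)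
open import Data.List.Membership.Propositional.Properties using (∈-map⁺; ∈-concat⁺′; ∈-upTo⁺; ∈-++⁺ˡ; ∈-++⁺ʳ; ∈-lookup)
import Data.List.Properties as List
open import Data.List.Relation.Unary.All as All using (All; []; _∷_)
import Data.List.Relation.Unary.All.Properties as All
open import Data.List.Relation.Unary.Any using (here; there)
open import Data.Maybe using (Maybe; just; nothing)
open import Data.Nat as ℕ using (ℕ; zero; suc; _∸_; _≤_; _<_; z≤n; s≤s; _!; _^_; _≡ᵇ_; _<ᵇ_; _≤ᵇ_)
open import Data.Nat.DivMod using (_%_) renaming (_/_ to _div_)
import Data.Nat.Properties as ℕ
open import Data.Nat.Tactic.RingSolver using (solve-∀)
open import Data.Product using (_×_; _,_; proj₁; proj₂; Σ; ∃-syntax)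
import Data.Product.Properties as Product
open import Data.Rational as ℚ using (ℚ; 0ℚ; 1ℚ; _+_; _*_; _-_; -_; _/_; toℚᵘ; 1/_)
import Data.Rational.Properties as ℚ
open import Data.Rational.Solver using (module +-*-Solver)
open +-*-Solver using (solve; _:+_; _:*_; _:-_; :-_; _:=_; con)
import Data.Rational.Unnormalised as ℚᵘ
import Data.Rational.Unnormalised.Properties as ℚᵘ
open import Data.Sum using (_⊎_; inj₁; inj₂)
open import Data.Unit using (⊤; tt)
open import Data.Vec using (Vec; []; _∷_; toList; fromList)
import Data.Vec.Properties as Vec
open import Function using (_∘_)
open import Relation.Binary.Definitions using (DecidableEquality)
open import Relation.Binary.PropositionalEquality
open import Relation.Nullary using (yes; no)
open import Relation.Nullary.Decidable using (⌊_⌋; does)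

-- Integers inside ℚ

-- The exact product of two bi-brackets has lower-weight terms with Bernoulli-type coefficients,
-- because convolving powers of v is simple only up to lower degree. Modulo lower weight the
-- coefficients are integers; the remainder is proved to exist, is never computed, and is absorbed
-- by induction on the weight. The elimination is not verified as an algorithm. What is proved is
-- that each row it produces is still a relation, for relations valued in an arbitrary linear
-- subspace; that it succeeds is a closed boolean evaluating to `true`. The subspace is spanned by
-- the chosen brackets and lower weight in the spanning part, and is zero in the independence part.
-- One joint independence check serves all weights: the filtration step below k is spanned by the
-- chosen brackets of weight less than k, so a combination of weight k brackets lying there is an
-- ordinary linear dependence. Parts (b), (c) and (d) share one reduction, since 123-brackets are
-- brackets and are positive.

fromℤ : ℤ → ℚ
fromℤ i = i / 1

fromℕ : ℕ → ℚ
fromℕ n = fromℤ (+ n)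

private
  toℚᵘ-fromℤ : ∀ i → toℚᵘ (fromℤ i) ℚᵘ.≃ ℚᵘ.mkℚᵘ i 0
  toℚᵘ-fromℤ i = ℚ.toℚᵘ-fromℚᵘ (ℚᵘ.mkℚᵘ i 0)

fromℤ-* : ∀ i j → fromℤ (i ℤ.* j) ≡ fromℤ i * fromℤ j
fromℤ-* i j = ℚ.toℚᵘ-injective (ℚᵘ.≃-trans (toℚᵘ-fromℤ (i ℤ.* j))
  (ℚᵘ.≃-sym (ℚᵘ.≃-trans (ℚ.toℚᵘ-homo-* (fromℤ i) (fromℤ j)) (ℚᵘ.*-cong (toℚᵘ-fromℤ i) (toℚᵘ-fromℤ j)))))

fromℤ-+ : ∀ i j → fromℤ (i ℤ.+ j) ≡ fromℤ i + fromℤ j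
fromℤ-+ i j = ℚ.toℚᵘ-injective (ℚᵘ.≃-trans (toℚᵘ-fromℤ (i ℤ.+ j))
  (ℚᵘ.≃-trans (ℚᵘ.*≡* (cong (ℤ._* (+ 1)) (cong₂ ℤ._+_ (sym (ℤ.*-identityʳ i)) (sym (ℤ.*-identityʳ j)))))
  (ℚᵘ.≃-sym (ℚᵘ.≃-trans (ℚ.toℚᵘ-homo-+ (fromℤ i) (fromℤ j)) (ℚᵘ.+-cong (toℚᵘ-fromℤ i) (toℚᵘ-fromℤ j))))))

fromℤ-neg : ∀ i → fromℤ (ℤ.- i) ≡ - fromℤ i
fromℤ-neg i = ℚ.toℚᵘ-injective (ℚᵘ.≃-trans (toℚᵘ-fromℤ (ℤ.- i))
  (ℚᵘ.≃-sym (ℚᵘ.≃-trans (ℚ.toℚᵘ-homo‿- (fromℤ i)) (ℚᵘ.-‿cong (toℚᵘ-fromℤ i)))))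

fromℤ-injective : ∀ {i j} → fromℤ i ≡ fromℤ j → i ≡ j
fromℤ-injective {i} {j} e with ℚᵘ.≃-trans (ℚᵘ.≃-sym (toℚᵘ-fromℤ i)) (ℚᵘ.≃-trans (ℚ.toℚᵘ-cong e) (toℚᵘ-fromℤ j))
... | ℚᵘ.*≡* p = trans (sym (ℤ.*-identityʳ i)) (trans p (ℤ.*-identityʳ j))

fromℕ-+ : ∀ m n → fromℕ (m ℕ.+ n) ≡ fromℕ m + fromℕ n
fromℕ-+ m n = fromℤ-+ (+ m) (+ n)

fromℕ-* : ∀ m n → fromℕ (m ℕ.* n) ≡ fromℕ m * fromℕ n
fromℕ-* m n = trans (cong fromℤ (ℤ.pos-* m n)) (fromℤ-* (+ m) (+ n))

fromℕ-suc : ∀ n → fromℕ (suc n) ≡ 1ℚ + fromℕ n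
fromℕ-suc n = fromℕ-+ 1 n

fromℤ≢0 : ∀ {i} → i ≢ + 0 → fromℤ i ≢ 0ℚ
fromℤ≢0 i≢0 e = i≢0 (fromℤ-injective e)

inverse : ∀ {x} → x ≢ 0ℚ → Σ ℚ λ y → y * x ≡ 1ℚ
inverse {x} x≢0 = 1/_ x {{ℚ.≢-nonZero x≢0}} , ℚ.*-inverseˡ x {{ℚ.≢-nonZero x≢0}}

*-cancelˡ : ∀ {x a b} → x ≢ 0ℚ → x * a ≡ x * b → a ≡ b
*-cancelˡ {x} {a} {b} x≢0 e with inverse x≢0
... | y , yx = trans (lem a) (trans (cong (y *_) e) (sym (lem b)))
  where
  lem : ∀ a → a ≡ y * (x * a)
  lem a = trans (sym (ℚ.*-identityˡ a)) (trans (cong (_* a) (sym yx)) (ℚ.*-assoc y x a))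

fromℕ-suc≢0 : ∀ n → fromℕ (suc n) ≢ 0ℚ
fromℕ-suc≢0 n = fromℤ≢0 {+ suc n} (λ ())

/-*-cancel : ∀ i d .{{_ : ℕ.NonZero d}} → (i / d) * fromℕ d ≡ fromℤ i
/-*-cancel i (suc d) = ℚ.toℚᵘ-injective (ℚᵘ.≃-trans (ℚ.toℚᵘ-homo-* (i / suc d) (fromℕ (suc d)))
  (ℚᵘ.≃-trans (ℚᵘ.*-cong (ℚ.toℚᵘ-fromℚᵘ (ℚᵘ.mkℚᵘ i d)) (toℚᵘ-fromℤ (+ suc d)))
  (ℚᵘ.≃-trans (ℚᵘ.*≡* eq) (ℚᵘ.≃-sym (toℚᵘ-fromℤ i)))))
  where
  eq : (i ℤ.* + suc d) ℤ.* + 1 ≡ i ℤ.* (+ (suc d ℕ.* 1))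
  eq = trans (ℤ.*-identityʳ (i ℤ.* + suc d)) (cong (λ z → i ℤ.* (+ z)) (sym (ℕ.*-identityʳ (suc d))))

-- Finite sums

∑ : ℕ → (ℕ → ℚ) → ℚ
∑ zero f = 0ℚ
∑ (suc n) f = ∑ n f + f n

∑-cong< : ∀ n {f g} → (∀ i → i < n → f i ≡ g i) → ∑ n f ≡ ∑ n g
∑-cong< zero e = refl
∑-cong< (suc n) e = cong₂ _+_ (∑-cong< n (λ i i<n → e i (ℕ.m≤n⇒m≤1+n i<n))) (e n ℕ.≤-refl)

∑-cong : ∀ n {f g : ℕ → ℚ} → (∀ i → f i ≡ g i) → ∑ n f ≡ ∑ n g
∑-cong n e = ∑-cong< n (λ i _ → e i)

∑-zero : ∀ n {f} → (∀ i → i < n → f i ≡ 0ℚ) → ∑ n f ≡ 0ℚ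
∑-zero zero e = refl
∑-zero (suc n) e = trans (cong₂ _+_ (∑-zero n (λ i i<n → e i (ℕ.m≤n⇒m≤1+n i<n))) (e n ℕ.≤-refl)) (ℚ.+-identityˡ 0ℚ)

∑-+ : ∀ n f g → ∑ n (λ i → f i + g i) ≡ ∑ n f + ∑ n g
∑-+ zero f g = refl
∑-+ (suc n) f g = trans (cong (_+ (f n + g n)) (∑-+ n f g))
  (solve 4 (λ a b c d → (a :+ b) :+ (c :+ d) := (a :+ c) :+ (b :+ d)) refl (∑ n f) (∑ n g) (f n) (g n))

∑-*ˡ : ∀ n c f → ∑ n (λ i → c * f i) ≡ c * ∑ n f
∑-*ˡ zero c f = sym (ℚ.*-zeroʳ c)
∑-*ˡ (suc n) c f = trans (cong (_+ c * f n) (∑-*ˡ n c f)) (sym (ℚ.*-distribˡ-+ c (∑ n f) (f n)))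

∑-swap : ∀ m n (f : ℕ → ℕ → ℚ) → ∑ m (λ i → ∑ n (f i)) ≡ ∑ n (λ j → ∑ m (λ i → f i j))
∑-swap zero n f = sym (∑-zero n (λ _ _ → refl))
∑-swap (suc m) n f = trans (cong (_+ ∑ n (f m)) (∑-swap m n f)) (sym (∑-+ n (λ j → ∑ m (λ i → f i j)) (f m)))

∑-head : ∀ n f → ∑ (suc n) f ≡ f 0 + ∑ n (f ∘ suc)
∑-head zero f = ℚ.+-comm 0ℚ (f 0)
∑-head (suc n) f = trans (cong (_+ f (suc n)) (∑-head n f)) (ℚ.+-assoc (f 0) (∑ n (f ∘ suc)) (f (suc n)))

∑-extend : ∀ m n f → m ≤ n → (∀ i → m ≤ i → f i ≡ 0ℚ) → ∑ n f ≡ ∑ m f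
∑-extend zero n f m≤n e = ∑-zero n (λ i _ → e i z≤n)
∑-extend (suc m) (suc n) f (s≤s m≤n) e = begin
  ∑ (suc n) f              ≡⟨ ∑-head n f ⟩
  f 0 + ∑ n (f ∘ suc)      ≡⟨ cong (_+_ (f 0)) (∑-extend m n (f ∘ suc) m≤n (λ i m≤i → e (suc i) (s≤s m≤i))) ⟩
  f 0 + ∑ m (f ∘ suc)      ≡⟨ ∑-head m f ⟨
  ∑ (suc m) f              ∎
  where open ≡-Reasoning

foldr-applyUpTo : ∀ m (g : ℕ → ℕ) (f : ℕ → ℚ) → foldr (λ i acc → f i + acc) 0ℚ (applyUpTo g m) ≡ ∑ m (f ∘ g)
foldr-applyUpTo zero g f = refl
foldr-applyUpTo (suc m) g f = trans (cong (_+_ (f (g 0))) (foldr-applyUpTo m (g ∘ suc) f)) (sym (∑-head m (f ∘ g)))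

sumFrom1-∑ : ∀ m f → sumFrom1 m f ≡ ∑ m (f ∘ suc)
sumFrom1-∑ m f = foldr-applyUpTo m (λ i → i) (f ∘ suc)

-- Power series

one : Series
one zero = 1ℚ
one (suc _) = 0ℚ

shift : ℕ → Series → Series
shift zero f N = f N
shift (suc k) f zero = 0ℚ
shift (suc k) f (suc N) = shift k f N

shift-cong≤ : ∀ k {f g} N → (∀ n → n ≤ N → f n ≡ g n) → shift k f N ≡ shift k g N
shift-cong≤ zero N e = e N ℕ.≤-refl
shift-cong≤ (suc k) zero e = refl
shift-cong≤ (suc k) (suc N) e = shift-cong≤ k N (λ n n≤N → e n (ℕ.m≤n⇒m≤1+n n≤N))

shift-cong : ∀ k {f g : Series} N → (∀ n → f n ≡ g n) → shift k f N ≡ shift k g N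
shift-cong k N e = shift-cong≤ k N (λ n _ → e n)

shift-> : ∀ k f N → N < k → shift k f N ≡ 0ℚ
shift-> (suc k) f zero N<k = refl
shift-> (suc k) f (suc N) (s≤s N<k) = shift-> k f N N<k

shift-≤ : ∀ k f N → k ≤ N → shift k f N ≡ f (N ∸ k)
shift-≤ zero f N k≤N = refl
shift-≤ (suc k) f (suc N) (s≤s k≤N) = shift-≤ k f N k≤N

shift-+ : ∀ k f g N → shift k (λ n → f n + g n) N ≡ shift k f N + shift k g N
shift-+ zero f g N = refl
shift-+ (suc k) f g zero = refl
shift-+ (suc k) f g (suc N) = shift-+ k f g N

shift-*ˡ : ∀ k c f N → shift k (λ n → c * f n) N ≡ c * shift k f N
shift-*ˡ zero c f N = refl
shift-*ˡ (suc k) c f zero = sym (ℚ.*-zeroʳ c)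
shift-*ˡ (suc k) c f (suc N) = shift-*ˡ k c f N

shift-0 : ∀ k N → shift k (λ _ → 0ℚ) N ≡ 0ℚ
shift-0 zero N = refl
shift-0 (suc k) zero = refl
shift-0 (suc k) (suc N) = shift-0 k N

shift-∑ : ∀ k m (f : ℕ → Series) N → shift k (λ n → ∑ m (λ i → f i n)) N ≡ ∑ m (λ i → shift k (f i) N)
shift-∑ k zero f N = shift-0 k N
shift-∑ k (suc m) f N = trans (shift-+ k (λ n → ∑ m (λ i → f i n)) (f m) N) (cong (_+ shift k (f m) N) (shift-∑ k m f N))

shift-shift : ∀ k l f N → shift k (shift l f) N ≡ shift (k ℕ.+ l) f N
shift-shift zero l f N = refl
shift-shift (suc k) l f zero = refl
shift-shift (suc k) l f (suc N) = shift-shift k l f N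

infixl 7 _⊛_
-- Cauchy product. The recursion strips the first coefficient of `f`, so that inductions use
-- `f ∘ suc` in place of truncated subtraction of indices.
_⊛_ : Series → Series → Series
(f ⊛ g) zero = f 0 * g 0
(f ⊛ g) (suc n) = f 0 * g (suc n) + ((f ∘ suc) ⊛ g) n

⊛-cong≤ : ∀ {f f′ g g′ : Series} n → (∀ i → i ≤ n → f i ≡ f′ i) → (∀ i → i ≤ n → g i ≡ g′ i) → (f ⊛ g) n ≡ (f′ ⊛ g′) n
⊛-cong≤ zero e e′ = cong₂ _*_ (e 0 z≤n) (e′ 0 z≤n)
⊛-cong≤ (suc n) e e′ = cong₂ _+_ (cong₂ _*_ (e 0 z≤n) (e′ (suc n) ℕ.≤-refl))
  (⊛-cong≤ n (λ i i≤n → e (suc i) (s≤s i≤n)) (λ i i≤n → e′ i (ℕ.m≤n⇒m≤1+n i≤n)))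

⊛-cong : ∀ {f f′ g g′ : Series} n → (∀ i → f i ≡ f′ i) → (∀ i → g i ≡ g′ i) → (f ⊛ g) n ≡ (f′ ⊛ g′) n
⊛-cong n e e′ = ⊛-cong≤ n (λ i _ → e i) (λ i _ → e′ i)

⊛-sucʳ : ∀ f g n → (f ⊛ g) (suc n) ≡ (f ⊛ (g ∘ suc)) n + f (suc n) * g 0
⊛-sucʳ f g zero = refl
⊛-sucʳ f g (suc n) = trans (cong (_+_ (f 0 * g (2 ℕ.+ n))) (⊛-sucʳ (f ∘ suc) g n))
  (sym (ℚ.+-assoc (f 0 * g (2 ℕ.+ n)) (((f ∘ suc) ⊛ (g ∘ suc)) n) (f (2 ℕ.+ n) * g 0)))

⊛-∑ : ∀ f g n → (f ⊛ g) n ≡ ∑ (suc n) (λ i → f (n ∸ i) * g i)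
⊛-∑ f g zero = sym (ℚ.+-identityˡ (f 0 * g 0))
⊛-∑ f g (suc n) = begin
  f 0 * g (suc n) + ((f ∘ suc) ⊛ g) n
    ≡⟨ cong (_+_ (f 0 * g (suc n))) (⊛-∑ (f ∘ suc) g n) ⟩
  f 0 * g (suc n) + ∑ (suc n) (λ i → f (suc (n ∸ i)) * g i)
    ≡⟨ ℚ.+-comm (f 0 * g (suc n)) _ ⟩
  ∑ (suc n) (λ i → f (suc (n ∸ i)) * g i) + f 0 * g (suc n)
    ≡⟨ cong₂ _+_ (∑-cong< (suc n) (λ i i≤n → cong (λ z → f z * g i) (sym (ℕ.+-∸-assoc 1 (ℕ.≤-pred i≤n)))))
                 (cong (λ z → f z * g (suc n)) (sym (ℕ.n∸n≡0 n))) ⟩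
  ∑ (suc (suc n)) (λ i → f (suc n ∸ i) * g i) ∎
  where open ≡-Reasoning

⊛-+ˡ : ∀ f g h n → ((λ i → f i + g i) ⊛ h) n ≡ (f ⊛ h) n + (g ⊛ h) n
⊛-+ˡ f g h zero = ℚ.*-distribʳ-+ (h 0) (f 0) (g 0)
⊛-+ˡ f g h (suc n) = trans (cong (_+_ ((f 0 + g 0) * h (suc n))) (⊛-+ˡ (f ∘ suc) (g ∘ suc) h n))
  (solve 5 (λ a b c d e → (a :+ b) :* c :+ (d :+ e) := (a :* c :+ d) :+ (b :* c :+ e)) refl
    (f 0) (g 0) (h (suc n)) (((f ∘ suc) ⊛ h) n) (((g ∘ suc) ⊛ h) n))

⊛-*ˡ : ∀ c f h n → ((λ i → c * f i) ⊛ h) n ≡ c * (f ⊛ h) n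
⊛-*ˡ c f h zero = ℚ.*-assoc c (f 0) (h 0)
⊛-*ˡ c f h (suc n) = trans (cong (_+_ (c * f 0 * h (suc n))) (⊛-*ˡ c (f ∘ suc) h n))
  (solve 4 (λ a b d e → a :* b :* d :+ a :* e := a :* (b :* d :+ e)) refl c (f 0) (h (suc n)) (((f ∘ suc) ⊛ h) n))

⊛-comm : ∀ f g n → (f ⊛ g) n ≡ (g ⊛ f) n
⊛-comm f g zero = ℚ.*-comm (f 0) (g 0)
⊛-comm f g (suc n) = trans (ℚ.+-comm (f 0 * g (suc n)) (((f ∘ suc) ⊛ g) n))
  (trans (cong₂ _+_ (⊛-comm (f ∘ suc) g n) (ℚ.*-comm (f 0) (g (suc n)))) (sym (⊛-sucʳ g f n)))

⊛-+ʳ : ∀ f g h n → (h ⊛ (λ i → f i + g i)) n ≡ (h ⊛ f) n + (h ⊛ g) n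
⊛-+ʳ f g h n = trans (⊛-comm h (λ i → f i + g i) n) (trans (⊛-+ˡ f g h n) (cong₂ _+_ (⊛-comm f h n) (⊛-comm g h n)))

⊛-*ʳ : ∀ c f h n → (h ⊛ (λ i → c * f i)) n ≡ c * (h ⊛ f) n
⊛-*ʳ c f h n = trans (⊛-comm h (λ i → c * f i) n) (trans (⊛-*ˡ c f h n) (cong (c *_) (⊛-comm f h n)))

⊛-0ˡ : ∀ h n → ((λ _ → 0ℚ) ⊛ h) n ≡ 0ℚ
⊛-0ˡ h zero = ℚ.*-zeroˡ (h 0)
⊛-0ˡ h (suc n) = trans (cong₂ _+_ (ℚ.*-zeroˡ (h (suc n))) (⊛-0ˡ h n)) (ℚ.+-identityˡ 0ℚ)

⊛-identityˡ : ∀ h n → (one ⊛ h) n ≡ h n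
⊛-identityˡ h zero = ℚ.*-identityˡ (h 0)
⊛-identityˡ h (suc n) = trans (cong₂ _+_ (ℚ.*-identityˡ (h (suc n))) (⊛-0ˡ h n)) (ℚ.+-identityʳ (h (suc n)))

⊛-identityʳ : ∀ h n → (h ⊛ one) n ≡ h n
⊛-identityʳ h n = trans (⊛-comm h one n) (⊛-identityˡ h n)

⊛-∑ˡ : ∀ m (f : ℕ → Series) h n → ((λ i → ∑ m (λ j → f j i)) ⊛ h) n ≡ ∑ m (λ j → (f j ⊛ h) n)
⊛-∑ˡ zero f h n = ⊛-0ˡ h n
⊛-∑ˡ (suc m) f h n = trans (⊛-+ˡ (λ i → ∑ m (λ j → f j i)) (f m) h n) (cong (_+ (f m ⊛ h) n) (⊛-∑ˡ m f h n))

shift-⊛ˡ : ∀ k f g N → (shift k f ⊛ g) N ≡ shift k (f ⊛ g) N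
shift-⊛ˡ zero f g N = refl
shift-⊛ˡ (suc k) f g zero = ℚ.*-zeroˡ (g 0)
shift-⊛ˡ (suc k) f g (suc N) = trans (cong₂ _+_ (ℚ.*-zeroˡ (g (suc N))) (shift-⊛ˡ k f g N)) (ℚ.+-identityˡ _)

-- Divided powers xⁿ/n!

-- The number 1/(n + 1), opaque so that normalisation of divided powers stops here; `recip-suc` is
-- all that is known about it.
abstract
  recip : ℕ → ℚ
  recip n = proj₁ (inverse (fromℕ-suc≢0 n))

  recip-suc : ∀ n → recip n * fromℕ (suc n) ≡ 1ℚ
  recip-suc n = proj₂ (inverse (fromℕ-suc≢0 n))

dp : ℕ → ℚ → ℚ
dp zero x = 1ℚ
dp (suc n) x = recip n * (x * dp n x)

dp-suc : ∀ n x → fromℕ (suc n) * dp (suc n) x ≡ x * dp n x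
dp-suc n x = trans (solve 3 (λ a b c → a :* (b :* c) := (b :* a) :* c) refl (fromℕ (suc n)) (recip n) (x * dp n x))
  (trans (cong (_* (x * dp n x)) (recip-suc n)) (ℚ.*-identityˡ _))

factorial-dp : ∀ n u → dp n (fromℕ u) * fromℕ (n !) ≡ fromℕ (u ^ n)
factorial-dp zero u = refl
factorial-dp (suc n) u = begin
  dp (suc n) x * fromℕ (suc n ℕ.* n !)        ≡⟨ cong (dp (suc n) x *_) (fromℕ-* (suc n) (n !)) ⟩
  dp (suc n) x * (fromℕ (suc n) * fromℕ (n !))
    ≡⟨ solve 3 (λ a b c → a :* (b :* c) := (b :* a) :* c) refl (dp (suc n) x) (fromℕ (suc n)) (fromℕ (n !)) ⟩
  fromℕ (suc n) * dp (suc n) x * fromℕ (n !)   ≡⟨ cong (_* fromℕ (n !)) (dp-suc n x) ⟩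
  x * dp n x * fromℕ (n !)                     ≡⟨ ℚ.*-assoc x (dp n x) _ ⟩
  x * (dp n x * fromℕ (n !))                   ≡⟨ cong (x *_) (factorial-dp n u) ⟩
  x * fromℕ (u ^ n)                            ≡⟨ fromℕ-* u (u ^ n) ⟨
  fromℕ (u ^ suc n)                            ∎
  where
  open ≡-Reasoning
  x = fromℕ u

factorial≢0 : ∀ n → fromℕ (n !) ≢ 0ℚ
factorial≢0 n = fromℤ≢0 λ e → ℕ.≢-nonZero⁻¹ (n !) {{n ℕ.!≢0}} (ℤ.+-injective e)

power/factorial : ∀ n u → ((+ (u ^ n)) / (n !)) {{n ℕ.!≢0}} ≡ dp n (fromℕ u)
power/factorial n u = *-cancelˡ (factorial≢0 n) (trans (ℚ.*-comm (fromℕ (n !)) (((+ (u ^ n)) / (n !)) {{n ℕ.!≢0}}))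
  (trans (/-*-cancel (+ (u ^ n)) (n !) {{n ℕ.!≢0}}) (trans (sym (factorial-dp n u)) (ℚ.*-comm (dp n (fromℕ u)) _))))

binom : ℕ → ℕ → ℕ
binom n zero = 1
binom zero (suc k) = 0
binom (suc n) (suc k) = binom n k ℕ.+ binom n (suc k)

binom-> : ∀ n k → n < k → binom n k ≡ 0
binom-> zero (suc k) _ = refl
binom-> (suc n) (suc k) (s≤s n<k) = cong₂ ℕ._+_ (binom-> n k n<k) (binom-> n (suc k) (ℕ.m≤n⇒m≤1+n n<k))

binom-n-n : ∀ n → binom n n ≡ 1
binom-n-n zero = refl
binom-n-n (suc n) = cong₂ ℕ._+_ (binom-n-n n) (binom-> n (suc n) ℕ.≤-refl)

-- Multiply by the total order: as in the Leibniz rule, `dp-suc` lowers the order of one factor at a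
-- time, and the two resulting coefficients add up by Pascal's rule.
dp-* : ∀ a b x → dp a x * dp b x ≡ fromℕ (binom (a ℕ.+ b) a) * dp (a ℕ.+ b) x
dp-* zero b x = refl
dp-* (suc a) zero x = trans (ℚ.*-identityʳ (dp (suc a) x)) (trans (sym (ℚ.*-identityˡ (dp (suc a) x)))
  (cong₂ (λ n m → fromℕ n * dp m x) (sym (trans (cong (λ z → binom z (suc a)) (ℕ.+-identityʳ (suc a))) (binom-n-n (suc a))))
    (sym (ℕ.+-identityʳ (suc a)))))
dp-* (suc a) (suc b) x = *-cancelˡ (fromℕ-suc≢0 (a ℕ.+ suc b)) (begin
  fromℕ (suc (a ℕ.+ suc b)) * (A * B)
    ≡⟨ cong (_* (A * B)) (fromℕ-+ (suc a) (suc b)) ⟩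
  (fromℕ (suc a) + fromℕ (suc b)) * (A * B)
    ≡⟨ solve 4 (λ p q r s → (p :+ q) :* (r :* s) := p :* r :* s :+ r :* (q :* s)) refl (fromℕ (suc a)) (fromℕ (suc b)) A B ⟩
  fromℕ (suc a) * A * B + A * (fromℕ (suc b) * B)
    ≡⟨ cong₂ (λ p q → p * B + A * q) (dp-suc a x) (dp-suc b x) ⟩
  x * dp a x * B + A * (x * dp b x)
    ≡⟨ solve 5 (λ x p q r s → x :* p :* q :+ r :* (x :* s) := x :* (p :* q :+ r :* s)) refl x (dp a x) B A (dp b x) ⟩
  x * (dp a x * B + A * dp b x)
    ≡⟨ cong (x *_) (cong₂ _+_ (dp-* a (suc b) x) (trans (dp-* (suc a) b x) (cong (λ z → fromℕ (binom z (suc a)) * dp z x) (sym (ℕ.+-suc a b))))) ⟩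
  x * (fromℕ P * D + fromℕ Q * D)
    ≡⟨ solve 4 (λ x p q d → x :* (p :* d :+ q :* d) := (p :+ q) :* (x :* d)) refl x (fromℕ P) (fromℕ Q) D ⟩
  (fromℕ P + fromℕ Q) * (x * D)
    ≡⟨ cong₂ _*_ (sym (fromℕ-+ P Q)) (sym (dp-suc (a ℕ.+ suc b) x)) ⟩
  fromℕ (P ℕ.+ Q) * (fromℕ (suc (a ℕ.+ suc b)) * dp (suc (a ℕ.+ suc b)) x)
    ≡⟨ solve 3 (λ p q d → p :* (q :* d) := q :* (p :* d)) refl (fromℕ (P ℕ.+ Q)) (fromℕ (suc (a ℕ.+ suc b))) (dp (suc (a ℕ.+ suc b)) x) ⟩
  fromℕ (suc (a ℕ.+ suc b)) * (fromℕ (P ℕ.+ Q) * dp (suc (a ℕ.+ suc b)) x) ∎)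
  where
  open ≡-Reasoning
  A = dp (suc a) x
  B = dp (suc b) x
  D = dp (a ℕ.+ suc b) x
  P = binom (a ℕ.+ suc b) a
  Q = binom (a ℕ.+ suc b) (suc a)

-- The operator q d/dq is a derivation.
⊛-derivation : ∀ f g n → fromℕ n * (f ⊛ g) n ≡ ((λ i → fromℕ i * f i) ⊛ g) n + (f ⊛ (λ i → fromℕ i * g i)) n
⊛-derivation f g zero = solve 2 (λ a b → con 0ℚ :* (a :* b) := con 0ℚ :* a :* b :+ a :* (con 0ℚ :* b)) refl (f 0) (g 0)
⊛-derivation f g (suc n) = begin
  s * (f 0 * g (suc n) + (f′ ⊛ g) n)
    ≡⟨ ℚ.*-distribˡ-+ s (f 0 * g (suc n)) ((f′ ⊛ g) n) ⟩
  s * (f 0 * g (suc n)) + s * (f′ ⊛ g) n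
    ≡⟨ cong (λ z → s * (f 0 * g (suc n)) + z * (f′ ⊛ g) n) (fromℕ-suc n) ⟩
  s * (f 0 * g (suc n)) + (1ℚ + fromℕ n) * (f′ ⊛ g) n
    ≡⟨ cong (_+_ (s * (f 0 * g (suc n)))) (trans (ℚ.*-distribʳ-+ ((f′ ⊛ g) n) 1ℚ (fromℕ n)) (cong (_+_ (1ℚ * (f′ ⊛ g) n)) (⊛-derivation f′ g n))) ⟩
  s * (f 0 * g (suc n)) + (1ℚ * (f′ ⊛ g) n + (X + Y))
    ≡⟨ solve 6 (λ s a b p x y → s :* (a :* b) :+ (con 1ℚ :* p :+ (x :+ y)) := (con 0ℚ :* a :* b :+ (p :+ x)) :+ (a :* (s :* b) :+ y)) refl
         s (f 0) (g (suc n)) ((f′ ⊛ g) n) X Y ⟩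
  (fromℕ 0 * f 0 * g (suc n) + ((f′ ⊛ g) n + X)) + (f 0 * (s * g (suc n)) + Y)
    ≡⟨ cong (λ z → (fromℕ 0 * f 0 * g (suc n) + z) + (f 0 * (s * g (suc n)) + Y)) (sym (⊛-+ˡ f′ (λ i → fromℕ i * f′ i) g n)) ⟩
  (fromℕ 0 * f 0 * g (suc n) + ((λ i → f′ i + fromℕ i * f′ i) ⊛ g) n) + (f 0 * (s * g (suc n)) + Y)
    ≡⟨ cong (λ z → (fromℕ 0 * f 0 * g (suc n) + z) + (f 0 * (s * g (suc n)) + Y)) (⊛-cong n lem (λ _ → refl)) ⟩
  (fromℕ 0 * f 0 * g (suc n) + ((λ i → fromℕ (suc i) * f′ i) ⊛ g) n) + (f 0 * (s * g (suc n)) + Y) ∎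
  where
  open ≡-Reasoning
  f′ = f ∘ suc
  s = fromℕ (suc n)
  X = ((λ i → fromℕ i * f′ i) ⊛ g) n
  Y = (f′ ⊛ (λ i → fromℕ i * g i)) n
  lem : ∀ i → f′ i + fromℕ i * f′ i ≡ fromℕ (suc i) * f′ i
  lem i = trans (solve 2 (λ a b → b :+ a :* b := (con 1ℚ :+ a) :* b) refl (fromℕ i) (f′ i)) (cong (_* f′ i) (sym (fromℕ-suc i)))

-- Binomial theorem. After multiplication by n + 1, `⊛-derivation` splits the right side into two
-- parts, and `dp-suc` takes the factor x out of one and y out of the other.
dp-+ : ∀ n x y → dp n (x + y) ≡ ((λ i → dp i x) ⊛ (λ i → dp i y)) n
dp-+ zero x y = refl
dp-+ (suc n) x y = *-cancelˡ (fromℕ-suc≢0 n) (begin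
  fromℕ (suc n) * dp (suc n) (x + y)  ≡⟨ dp-suc n (x + y) ⟩
  (x + y) * dp n (x + y)              ≡⟨ cong ((x + y) *_) (dp-+ n x y) ⟩
  (x + y) * (F ⊛ G) n                 ≡⟨ ℚ.*-distribʳ-+ ((F ⊛ G) n) x y ⟩
  x * (F ⊛ G) n + y * (F ⊛ G) n       ≡⟨ cong₂ _+_ (⊛-*ˡ x F G n) (⊛-*ʳ y G F n) ⟨
  ((λ i → x * F i) ⊛ G) n + (F ⊛ (λ i → y * G i)) n
    ≡⟨ cong₂ _+_ (⊛-cong n (λ i → sym (dp-suc i x)) (λ _ → refl)) (⊛-cong n (λ _ → refl) (λ i → sym (dp-suc i y))) ⟩
  ((λ i → fromℕ (suc i) * F (suc i)) ⊛ G) n + (F ⊛ (λ i → fromℕ (suc i) * G (suc i))) n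
    ≡⟨ solve 5 (λ a b c d e → a :+ b := (con 0ℚ :* c :* d :+ a) :+ (b :+ e :* (con 0ℚ :* c))) refl
         (((λ i → fromℕ (suc i) * F (suc i)) ⊛ G) n) ((F ⊛ (λ i → fromℕ (suc i) * G (suc i))) n) 1ℚ (G (suc n)) (F (suc n)) ⟩
  (fromℕ 0 * F 0 * G (suc n) + ((λ i → fromℕ (suc i) * F (suc i)) ⊛ G) n)
    + ((F ⊛ (λ i → fromℕ (suc i) * G (suc i))) n + F (suc n) * (fromℕ 0 * G 0))
    ≡⟨ cong (_+_ ((fromℕ 0 * F 0 * G (suc n) + ((λ i → fromℕ (suc i) * F (suc i)) ⊛ G) n))) (⊛-sucʳ F (λ i → fromℕ i * G i) n) ⟨
  ((λ i → fromℕ i * F i) ⊛ G) (suc n) + (F ⊛ (λ i → fromℕ i * G i)) (suc n)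
    ≡⟨ ⊛-derivation F G (suc n) ⟨
  fromℕ (suc n) * (F ⊛ G) (suc n) ∎)
  where
  open ≡-Reasoning
  F G : ℕ → ℚ
  F i = dp i x
  G i = dp i y

sgn : ℕ → ℤ
sgn zero = + 1
sgn (suc n) = ℤ.- sgn n

dp-neg : ∀ n x → dp n (- x) ≡ fromℤ (sgn n) * dp n x
dp-neg zero x = refl
dp-neg (suc n) x = trans (cong (λ z → recip n * (- x * z)) (dp-neg n x))
  (trans (solve 4 (λ r x s d → r :* (:- x :* (s :* d)) := :- s :* (r :* (x :* d))) refl (recip n) x (fromℤ (sgn n)) (dp n x))
    (cong (_* dp (suc n) x) (sym (fromℤ-neg (sgn n)))))

-- Apply the binomial theorem to (t + d) - t. This is what turns powers of differences of summation
-- indices into powers of the indices themselves.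
dp-diff : ∀ n t d → dp n (fromℕ d) ≡ ∑ (suc n) (λ i → dp (n ∸ i) (fromℕ (t ℕ.+ d)) * (fromℤ (sgn i) * dp i (fromℕ t)))
dp-diff n t d = begin
  dp n (fromℕ d)
    ≡⟨ cong (dp n) (solve 2 (λ t d → d := (t :+ d) :+ :- t) refl (fromℕ t) (fromℕ d)) ⟩
  dp n ((fromℕ t + fromℕ d) - fromℕ t)
    ≡⟨ cong (λ z → dp n (z - fromℕ t)) (fromℕ-+ t d) ⟨
  dp n (fromℕ (t ℕ.+ d) - fromℕ t)
    ≡⟨ dp-+ n (fromℕ (t ℕ.+ d)) (- fromℕ t) ⟩
  ((λ i → dp i (fromℕ (t ℕ.+ d))) ⊛ (λ i → dp i (- fromℕ t))) n
    ≡⟨ ⊛-∑ (λ i → dp i (fromℕ (t ℕ.+ d))) (λ i → dp i (- fromℕ t)) n ⟩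
  ∑ (suc n) (λ i → dp (n ∸ i) (fromℕ (t ℕ.+ d)) * dp i (- fromℕ t))
    ≡⟨ ∑-cong (suc n) (λ i → cong (dp (n ∸ i) (fromℕ (t ℕ.+ d)) *_) (dp-neg i (fromℕ t))) ⟩
  ∑ (suc n) (λ i → dp (n ∸ i) (fromℕ (t ℕ.+ d)) * (fromℤ (sgn i) * dp i (fromℕ t))) ∎
  where open ≡-Reasoning

-- Spans of families of ℚ-valued functions

ev : {I X : Set} → (I → X → ℚ) → List (ℚ × I) → X → ℚ
ev gen L x = foldr (λ p acc → proj₁ p * gen (proj₂ p) x + acc) 0ℚ L

-- For `gen = biBracket` this unfolds to `InSpan`, so the final statements need no conversion. Other
-- generating families are `H`, `pw` and `β`.
Span : {I X : Set} → (I → X → ℚ) → (I → Set) → (X → ℚ) → Set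
Span {I} gen P f = Σ (List (ℚ × I)) λ L → All (λ p → P (proj₂ p)) L × (∀ x → f x ≡ ev gen L x)

-- Linear subspaces as predicates, with `ext` standing in for function extensionality. An abstract
-- predicate lets the elimination be proved sound once, for spans and for vanishing alike.
record Closed {X : Set} (S : (X → ℚ) → Set) : Set where
  field
    ext  : ∀ {f g} → f ≗ g → S g → S f
    nil  : S (λ _ → 0ℚ)
    plus : ∀ {f g} → S f → S g → S (λ x → f x + g x)
    mult : ∀ c {f} → S f → S (λ x → c * f x)

  minus : ∀ {f g} → S f → S g → S (λ x → f x - g x)
  minus {f} {g} sf sg = ext (λ x → solve 2 (λ a b → a :- b := a :+ (:- con 1ℚ) :* b) refl (f x) (g x)) (plus sf (mult (- 1ℚ) sg))

  congruent : ∀ {f g} → S (λ x → f x - g x) → S g → S f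
  congruent {f} {g} d s = ext (λ x → solve 2 (λ a b → a := (a :- b) :+ b) refl (f x) (g x)) (plus d s)

ev-++ : ∀ {I X : Set} (gen : I → X → ℚ) L L′ x → ev gen (L ++ L′) x ≡ ev gen L x + ev gen L′ x
ev-++ gen [] L′ x = sym (ℚ.+-identityˡ _)
ev-++ gen ((c , i) ∷ L) L′ x = trans (cong (_+_ (c * gen i x)) (ev-++ gen L L′ x)) (sym (ℚ.+-assoc (c * gen i x) (ev gen L x) (ev gen L′ x)))

ev-* : ∀ {I X : Set} (gen : I → X → ℚ) c L x → ev gen (map (λ p → c * proj₁ p , proj₂ p) L) x ≡ c * ev gen L x
ev-* gen c [] x = sym (ℚ.*-zeroʳ c)
ev-* gen c ((d , i) ∷ L) x = trans (cong (_+_ (c * d * gen i x)) (ev-* gen c L x))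
  (solve 4 (λ c d g e → c :* d :* g :+ c :* e := c :* (d :* g :+ e)) refl c d (gen i x) (ev gen L x))

span-closed : ∀ {I X : Set} {gen : I → X → ℚ} {P} → Closed (Span gen P)
span-closed {gen = gen} = record
  { ext  = λ e (L , p , q) → L , p , λ x → trans (e x) (q x)
  ; nil  = [] , [] , λ x → refl
  ; plus = λ (L , p , q) (L′ , p′ , q′) → L ++ L′ , All.++⁺ p p′ , λ x → trans (cong₂ _+_ (q x) (q′ x)) (sym (ev-++ gen L L′ x))
  ; mult = λ c (L , p , q) → map (λ z → c * proj₁ z , proj₂ z) L , All.map⁺ p , λ x → trans (cong (c *_) (q x)) (sym (ev-* gen c L x))
  }

span-gen : ∀ {I X : Set} {gen : I → X → ℚ} {P : I → Set} i → P i → Span gen P (gen i)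
span-gen {gen = gen} i p = (1ℚ , i) ∷ [] , p ∷ [] , λ x → sym (trans (ℚ.+-identityʳ _) (ℚ.*-identityˡ (gen i x)))

record Linear {X Y : Set} (T : (X → ℚ) → (Y → ℚ)) : Set where
  field
    T-cong : ∀ {f g} → f ≗ g → T f ≗ T g
    T-+    : ∀ f g → T (λ x → f x + g x) ≗ (λ y → T f y + T g y)
    T-*    : ∀ c f → T (λ x → c * f x) ≗ (λ y → c * T f y)

  T-0 : T (λ _ → 0ℚ) ≗ (λ _ → 0ℚ)
  T-0 y = trans (T-cong (λ _ → sym (ℚ.*-zeroˡ 0ℚ)) y) (trans (T-* 0ℚ (λ _ → 0ℚ) y) (ℚ.*-zeroˡ (T (λ _ → 0ℚ) y)))

  T-- : ∀ f g → T (λ x → f x - g x) ≗ (λ y → T f y - T g y)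
  T-- f g y = begin
    T (λ x → f x - g x) y            ≡⟨ T-cong (λ x → solve 2 (λ a b → a :- b := a :+ (:- con 1ℚ) :* b) refl (f x) (g x)) y ⟩
    T (λ x → f x + (- 1ℚ) * g x) y    ≡⟨ T-+ f (λ x → (- 1ℚ) * g x) y ⟩
    T f y + T (λ x → (- 1ℚ) * g x) y  ≡⟨ cong (_+_ (T f y)) (T-* (- 1ℚ) g y) ⟩
    T f y + (- 1ℚ) * T g y            ≡⟨ solve 2 (λ a b → a :- b := a :+ (:- con 1ℚ) :* b) refl (T f y) (T g y) ⟨
    T f y - T g y                    ∎
    where open ≡-Reasoning

  -- Checking on generators suffices; this is how lower-weight remainders are transported through
  -- the summation operators.
  span-map : ∀ {I} {gen : I → X → ℚ} {P : I → Set} {S} → Closed S → (∀ i → P i → S (T (gen i))) → ∀ {f} → Span gen P f → S (T f)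
  span-map {gen = gen} {P} {S} cl h {f} (L , p , q) = ext (T-cong q) (go L p)
    where
    open Closed cl
    go : ∀ L → All (λ p → P (proj₂ p)) L → S (T (ev gen L))
    go [] [] = ext T-0 nil
    go ((c , i) ∷ L) (p ∷ ps) = ext (λ y → trans (T-+ (λ x → c * gen i x) (ev gen L) y) (cong (_+ T (ev gen L) y) (T-* c (gen i) y)))
      (plus (mult c (h i p)) (go L ps))

id-linear : ∀ {X : Set} → Linear {X} {X} (λ f → f)
id-linear = record { T-cong = λ e → e ; T-+ = λ f g y → refl ; T-* = λ c f y → refl }

span-least : ∀ {I X : Set} {gen : I → X → ℚ} {P : I → Set} {S} → Closed S → (∀ i → P i → S (gen i)) → ∀ {f} → Span gen P f → S f
span-least = Linear.span-map id-linear

span-mono : ∀ {I X : Set} {gen : I → X → ℚ} {P Q : I → Set} → (∀ {i} → P i → Q i) → ∀ {f} → Span gen P f → Span gen Q f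
span-mono h (L , p , q) = L , All.map h p , q

-- Powers and binomial coefficients, as functions of i = v - 1

pw : ℕ → Series
pw a i = dp a (fromℕ (suc i))

-- With v = i + 1 this is C(v - 1, a), whose generating function is (x / (1 - x))^(a + 1).
-- Convolution adds the exponents a + 1, so on this basis it is exact, in contrast to powers of v.
β : ℕ → Series
β a i = fromℕ (binom i a)

*-binom : ∀ i j → suc i ℕ.* binom i j ≡ suc j ℕ.* binom (suc i) (suc j)
*-binom zero zero = refl
*-binom zero (suc j) = sym (ℕ.*-zeroʳ (suc (suc j)))
*-binom (suc i) zero = begin
  suc (suc i) ℕ.* 1                             ≡⟨ cong suc (*-binom i zero) ⟩
  suc (1 ℕ.* (1 ℕ.+ binom i 1))                 ≡⟨ cong suc (ℕ.*-identityˡ _) ⟩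
  suc (1 ℕ.+ binom i 1)                         ≡⟨ ℕ.*-identityˡ _ ⟨
  1 ℕ.* (1 ℕ.+ (1 ℕ.+ binom i 1))               ∎
  where open ≡-Reasoning
*-binom (suc i) (suc j) = begin
  suc (suc i) ℕ.* (p ℕ.+ q)
    ≡⟨ cong (p ℕ.+ q ℕ.+_) (ℕ.*-distribˡ-+ (suc i) p q) ⟩
  (p ℕ.+ q) ℕ.+ (suc i ℕ.* p ℕ.+ suc i ℕ.* q)
    ≡⟨ cong (p ℕ.+ q ℕ.+_) (cong₂ ℕ._+_ (*-binom i j) (*-binom i (suc j))) ⟩
  (p ℕ.+ q) ℕ.+ (suc j ℕ.* (p ℕ.+ q) ℕ.+ suc (suc j) ℕ.* t)
    ≡⟨ ℕ.+-assoc (p ℕ.+ q) _ _ ⟨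
  suc (suc j) ℕ.* (p ℕ.+ q) ℕ.+ suc (suc j) ℕ.* t
    ≡⟨ ℕ.*-distribˡ-+ (suc (suc j)) (p ℕ.+ q) t ⟨
  suc (suc j) ℕ.* ((p ℕ.+ q) ℕ.+ t) ∎
  where
  open ≡-Reasoning
  p = binom i j
  q = binom i (suc j)
  t = binom (suc i) (suc (suc j))

module _ (a : ℕ) where
  -- Multiplication by v / (a + 1). It takes `pw a` to `pw (suc a)` by definition and, by
  -- absorption, `β j` to a multiple of `β j` plus `β (suc j)`; this drives both base changes below.
  raise : Series → Series
  raise f i = recip a * (fromℕ (suc i) * f i)

  raise-linear : Linear raise
  raise-linear = record
    { T-cong = λ e y → cong (λ z → recip a * (fromℕ (suc y) * z)) (e y)
    ; T-+ = λ f g y → solve 4 (λ r s f g → r :* (s :* (f :+ g)) := r :* (s :* f) :+ r :* (s :* g)) refl (recip a) (fromℕ (suc y)) (f y) (g y)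
    ; T-* = λ c f y → solve 4 (λ r s f c → r :* (s :* (c :* f)) := c :* (r :* (s :* f))) refl (recip a) (fromℕ (suc y)) (f y) c
    }

  raise-β : ∀ j i → raise (β j) i ≡ (recip a * fromℕ (suc j)) * (β j i + β (suc j) i)
  raise-β j i = begin
    recip a * (fromℕ (suc i) * fromℕ (binom i j))
      ≡⟨ cong (recip a *_) (trans (sym (fromℕ-* (suc i) (binom i j))) (trans (cong fromℕ (*-binom i j)) (fromℕ-* (suc j) (binom i j ℕ.+ binom i (suc j))))) ⟩
    recip a * (fromℕ (suc j) * fromℕ (binom i j ℕ.+ binom i (suc j)))
      ≡⟨ cong (λ z → recip a * (fromℕ (suc j) * z)) (fromℕ-+ (binom i j) (binom i (suc j))) ⟩
    recip a * (fromℕ (suc j) * (β j i + β (suc j) i))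
      ≡⟨ ℚ.*-assoc (recip a) (fromℕ (suc j)) _ ⟨
    (recip a * fromℕ (suc j)) * (β j i + β (suc j) i) ∎
    where open ≡-Reasoning

  raise-β-top : ∀ i → raise (β a) i ≡ β a i + β (suc a) i
  raise-β-top i = trans (raise-β a i) (trans (cong (_* (β a i + β (suc a) i)) (recip-suc a)) (ℚ.*-identityˡ _))

  raise-pw : ∀ j i → raise (pw j) i ≡ (recip a * fromℕ (suc j)) * pw (suc j) i
  raise-pw j i = trans (cong (recip a *_) (sym (dp-suc j (fromℕ (suc i))))) (sym (ℚ.*-assoc (recip a) (fromℕ (suc j)) _))

-- Both are polynomials in v with leading term v^a / a!, so the change of basis is unitriangular.
pw-β : ∀ a → Span β (_< a) (λ i → pw a i - β a i)
pw-β zero = Closed.ext span-closed (λ i → refl) (Closed.nil span-closed)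
pw-β (suc a) = ext (λ i → begin
    pw (suc a) i - β (suc a) i
      ≡⟨ solve 3 (λ p b c → p :- c := (p :- (b :+ c)) :+ b) refl (pw (suc a) i) (β a i) (β (suc a) i) ⟩
    (pw (suc a) i - (β a i + β (suc a) i)) + β a i
      ≡⟨ cong (λ z → (pw (suc a) i - z) + β a i) (raise-β-top a i) ⟨
    (raise a (pw a) i - raise a (β a) i) + β a i
      ≡⟨ cong (_+ β a i) (T-- (pw a) (β a) i) ⟨
    raise a (λ i → pw a i - β a i) i + β a i ∎)
  (plus (span-map span-closed (λ j j<a → ext (raise-β a j) (mult (recip a * fromℕ (suc j)) (plus (span-gen j (ℕ.m≤n⇒m≤1+n j<a)) (span-gen (suc j) (s≤s j<a))))) (pw-β a))
        (span-gen a ℕ.≤-refl))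
  where
  open ≡-Reasoning
  open Closed (span-closed {gen = β} {_< suc a})
  open Linear (raise-linear a)

β-pw : ∀ a → Span pw (_< a) (λ i → β a i - pw a i)
β-pw zero = Closed.ext span-closed (λ i → refl) (Closed.nil span-closed)
β-pw (suc a) = ext (λ i → begin
    β (suc a) i - pw (suc a) i
      ≡⟨ solve 3 (λ p b c → c :- p := ((b :+ c) :- p) :- b) refl (pw (suc a) i) (β a i) (β (suc a) i) ⟩
    ((β a i + β (suc a) i) - pw (suc a) i) - β a i
      ≡⟨ cong (λ z → (z - pw (suc a) i) - β a i) (raise-β-top a i) ⟨
    (raise a (β a) i - raise a (pw a) i) - β a i
      ≡⟨ cong (_- β a i) (T-- (β a) (pw a) i) ⟨
    raise a (λ i → β a i - pw a i) i - β a i ∎)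
  (minus (span-map span-closed (λ j j<a → ext (raise-pw a j) (mult (recip a * fromℕ (suc j)) (span-gen (suc j) (s≤s j<a)))) (β-pw a))
         (congruent (span-mono ℕ.m≤n⇒m≤1+n (β-pw a)) (span-gen a ℕ.≤-refl)))
  where
  open ≡-Reasoning
  open Closed (span-closed {gen = pw} {_< suc a})
  open Linear (raise-linear a)

-- Σ_{v₁+v₂=v} f(v₁) g(v₂), where f and g list the values at v = 1, 2, …
conv : Series → Series → Series
conv f g = shift 1 (f ⊛ g)

conv-linearˡ : ∀ g → Linear (λ f → conv f g)
conv-linearˡ g = record
  { T-cong = λ e y → shift-cong 1 y (λ n → ⊛-cong n e (λ _ → refl))
  ; T-+ = λ f h y → trans (shift-cong 1 y (⊛-+ˡ f h g)) (shift-+ 1 (f ⊛ g) (h ⊛ g) y)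
  ; T-* = λ c f y → trans (shift-cong 1 y (⊛-*ˡ c f g)) (shift-*ˡ 1 c (f ⊛ g) y)
  }

conv-linearʳ : ∀ f → Linear (conv f)
conv-linearʳ f = record
  { T-cong = λ e y → shift-cong 1 y (λ n → ⊛-cong n (λ _ → refl) e)
  ; T-+ = λ g h y → trans (shift-cong 1 y (⊛-+ʳ g h f)) (shift-+ 1 (f ⊛ g) (f ⊛ h) y)
  ; T-* = λ c g y → trans (shift-cong 1 y (⊛-*ʳ c g f)) (shift-*ˡ 1 c (f ⊛ g) y)
  }

β-⊛ : ∀ a b n → (β a ⊛ β b) n ≡ β (suc (a ℕ.+ b)) (suc n)
β-⊛ zero b zero = trans (ℚ.*-identityˡ _) (cong fromℕ (sym (trans (cong (binom 0 b ℕ.+_) (binom-> 0 (suc b) (s≤s z≤n))) (ℕ.+-identityʳ _))))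
β-⊛ zero b (suc n) = begin
  1ℚ * β b (suc n) + (β 0 ⊛ β b) n   ≡⟨ cong₂ _+_ (ℚ.*-identityˡ (β b (suc n))) (β-⊛ zero b n) ⟩
  β b (suc n) + β (suc b) (suc n)   ≡⟨ fromℕ-+ (binom (suc n) b) (binom (suc n) (suc b)) ⟨
  β (suc b) (suc (suc n))           ∎
  where open ≡-Reasoning
β-⊛ (suc a) b zero = trans (ℚ.*-zeroˡ (β b 0)) (cong fromℕ (sym (binom-> 1 (suc (suc (a ℕ.+ b))) (s≤s (s≤s z≤n)))))
β-⊛ (suc a) b (suc n) = begin
  0ℚ * β b (suc n) + ((β (suc a) ∘ suc) ⊛ β b) n
    ≡⟨ cong₂ _+_ (ℚ.*-zeroˡ (β b (suc n))) (⊛-cong n (λ i → fromℕ-+ (binom i a) (binom i (suc a))) (λ _ → refl)) ⟩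
  0ℚ + ((λ i → β a i + β (suc a) i) ⊛ β b) n
    ≡⟨ ℚ.+-identityˡ _ ⟩
  ((λ i → β a i + β (suc a) i) ⊛ β b) n
    ≡⟨ ⊛-+ˡ (β a) (β (suc a)) (β b) n ⟩
  (β a ⊛ β b) n + (β (suc a) ⊛ β b) n
    ≡⟨ cong₂ _+_ (β-⊛ a b n) (β-⊛ (suc a) b n) ⟩
  β (suc (a ℕ.+ b)) (suc n) + β (suc (suc (a ℕ.+ b))) (suc n)
    ≡⟨ fromℕ-+ (binom (suc n) (suc (a ℕ.+ b))) (binom (suc n) (suc (suc (a ℕ.+ b)))) ⟨
  β (suc (suc (a ℕ.+ b))) (suc (suc n)) ∎
  where open ≡-Reasoning

conv-β : ∀ a b i → conv (β a) (β b) i ≡ β (suc (a ℕ.+ b)) i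
conv-β a b zero = refl
conv-β a b (suc n) = β-⊛ a b n

-- Pass to `β` in the second factor (`half`), then in the first (`topβ`), where convolution is
-- exact, and return to `pw`. Unitriangularity keeps the leading coefficient equal to 1.
conv-pw : ∀ a b → Span pw (_< suc (a ℕ.+ b)) (λ i → conv (pw a) (pw b) i - pw (suc (a ℕ.+ b)) i)
conv-pw a b = ext (λ i → solve 3 (λ c p b → c :- p := (c :- b) :+ (b :- p)) refl (conv (pw a) (pw b) i) (pw m i) (β m i))
  (plus (span-least span-closed (λ j j<m → congruent (span-mono (λ {k} k<j → ℕ.<-trans k<j j<m) (β-pw j)) (span-gen j j<m)) topβ) (β-pw m))
  where
  m = suc (a ℕ.+ b)
  open Closed (span-closed {gen = pw} {_< m})
  half : ∀ j → Span β (_< suc (j ℕ.+ b)) (λ i → conv (β j) (pw b) i - β (suc (j ℕ.+ b)) i)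
  half j = Closed.ext span-closed (λ i → trans (cong (λ z → conv (β j) (pw b) i - z) (sym (conv-β j b i))) (sym (T-- (pw b) (β b) i)))
    (span-map span-closed (λ l l<b → Closed.ext span-closed (conv-β j l) (span-gen (suc (j ℕ.+ l)) (s≤s (ℕ.+-monoʳ-< j l<b)))) (pw-β b))
    where open Linear (conv-linearʳ (β j))
  topβ : Span β (_< m) (λ i → conv (pw a) (pw b) i - β m i)
  topβ = Closed.ext span-closed
    (λ i → trans (solve 3 (λ x y z → x :- z := (x :- y) :+ (y :- z)) refl (conv (pw a) (pw b) i) (conv (β a) (pw b) i) (β m i))
       (cong (_+ (conv (β a) (pw b) i - β m i)) (sym (T-- (pw a) (β a) i))))
    (Closed.plus span-closed
      (span-map span-closed (λ j j<a → Closed.congruent span-closed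
          (span-mono (λ {k} k< → ℕ.<-trans k< (s≤s (ℕ.+-monoˡ-< b j<a))) (half j))
          (span-gen (suc (j ℕ.+ b)) (s≤s (ℕ.+-monoˡ-< b j<a)))) (pw-β a))
      (half a))
    where open Linear (conv-linearˡ (pw b))

-- Truncated bi-brackets

-- Σ_{v≥1} a(v) q^{uv} f, where a lists the values at v = 1, 2, …
S : ℕ → Series → Series → Series
S u a f N = ∑ N (λ i → a i * shift (u ℕ.* suc i) f N)

-- The range of v in `S` depends on the coefficient N. For a positive index, terms with v > N have
-- exponent above N, so one common range can be used for all coefficients before sums are exchanged.
S-bound : ∀ u a f {N K} → N ≤ K → S (suc u) a f N ≡ ∑ K (λ i → a i * shift (suc u ℕ.* suc i) f N)
S-bound u a f {N} {K} N≤K = sym (∑-extend N K _ N≤K (λ i N≤i →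
  trans (cong (a i *_) (shift-> (suc u ℕ.* suc i) f N (ℕ.<-≤-trans (s≤s N≤i) (ℕ.m≤m+n (suc i) (u ℕ.* suc i))))) (ℚ.*-zeroʳ (a i))))

S-vanish : ∀ u a f N → N < u → S u a f N ≡ 0ℚ
S-vanish u a f N N<u = ∑-zero N (λ i _ → trans (cong (a i *_) (shift-> (u ℕ.* suc i) f N
  (ℕ.<-≤-trans N<u (ℕ.m≤m*n u (suc i))))) (ℚ.*-zeroʳ (a i)))

S-cong≤ : ∀ u a {f g} N → (∀ n → n ≤ N → f n ≡ g n) → S u a f N ≡ S u a g N
S-cong≤ u a N e = ∑-cong N (λ i → cong (a i *_) (shift-cong≤ (u ℕ.* suc i) N e))

S-linear : ∀ u a → Linear (S u a)
S-linear u a = record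
  { T-cong = λ e N → S-cong≤ u a N (λ n _ → e n)
  ; T-+ = λ f g N → trans (∑-cong N (λ i → trans (cong (a i *_) (shift-+ (u ℕ.* suc i) f g N)) (ℚ.*-distribˡ-+ (a i) _ _))) (∑-+ N _ _)
  ; T-* = λ c f N → trans (∑-cong N (λ i → trans (cong (a i *_) (shift-*ˡ (u ℕ.* suc i) c f N))
      (solve 3 (λ a c x → a :* (c :* x) := c :* (a :* x)) refl (a i) c (shift (u ℕ.* suc i) f N)))) (∑-*ˡ N c (λ i → a i * shift (u ℕ.* suc i) f N))
  }

S-linearᵃ : ∀ u f → Linear (λ a → S u a f)
S-linearᵃ u f = record
  { T-cong = λ e N → ∑-cong N (λ i → cong (_* shift (u ℕ.* suc i) f N) (e i))
  ; T-+ = λ a b N → trans (∑-cong N (λ i → ℚ.*-distribʳ-+ (shift (u ℕ.* suc i) f N) (a i) (b i))) (∑-+ N _ _)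
  ; T-* = λ c a N → trans (∑-cong N (λ i → ℚ.*-assoc c (a i) (shift (u ℕ.* suc i) f N))) (∑-*ˡ N c (λ i → a i * shift (u ℕ.* suc i) f N))
  }

-- Since `c` vanishes from K on, only the triangle i + j < K of the square contributes, and
-- collecting its diagonals gives the Cauchy product.
∑-triangle : ∀ K (a b c : Series) → (∀ n → K ≤ n → c n ≡ 0ℚ) →
  ∑ K (λ i → ∑ K (λ j → a i * (b j * c (i ℕ.+ j)))) ≡ ∑ K (λ n → (a ⊛ b) n * c n)
∑-triangle zero a b c z = refl
∑-triangle (suc K) a b c z = begin
  ∑ (suc K) (λ i → ∑ (suc K) (λ j → a i * (b j * c (i ℕ.+ j))))
    ≡⟨ ∑-head K _ ⟩
  ∑ (suc K) (λ j → a 0 * (b j * c j)) + ∑ K (λ i → ∑ (suc K) (λ j → a (suc i) * (b j * c (suc i ℕ.+ j))))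
    ≡⟨ cong₂ _+_ (∑-head K _) (∑-cong K λ i → trans (cong (_+_ (∑ K (λ j → a (suc i) * (b j * c (suc i ℕ.+ j))))) (last i)) (ℚ.+-identityʳ _)) ⟩
  (a 0 * (b 0 * c 0) + ∑ K (λ j → a 0 * (b (suc j) * c (suc j)))) + ∑ K (λ i → ∑ K (λ j → a (suc i) * (b j * c (suc i ℕ.+ j))))
    ≡⟨ cong (_+_ ((a 0 * (b 0 * c 0) + ∑ K (λ j → a 0 * (b (suc j) * c (suc j)))))) (∑-triangle K (a ∘ suc) b (c ∘ suc) (λ n K≤n → z (suc n) (s≤s K≤n))) ⟩
  (a 0 * (b 0 * c 0) + ∑ K (λ j → a 0 * (b (suc j) * c (suc j)))) + ∑ K (λ n → ((a ∘ suc) ⊛ b) n * c (suc n))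
    ≡⟨ ℚ.+-assoc (a 0 * (b 0 * c 0)) _ _ ⟩
  a 0 * (b 0 * c 0) + (∑ K (λ j → a 0 * (b (suc j) * c (suc j))) + ∑ K (λ n → ((a ∘ suc) ⊛ b) n * c (suc n)))
    ≡⟨ cong₂ _+_ (sym (ℚ.*-assoc (a 0) (b 0) (c 0))) (trans (sym (∑-+ K _ _)) (∑-cong K λ n →
         solve 4 (λ a b c d → a :* (b :* c) :+ d :* c := (a :* b :+ d) :* c) refl (a 0) (b (suc n)) (c (suc n)) (((a ∘ suc) ⊛ b) n))) ⟩
  a 0 * b 0 * c 0 + ∑ K (λ n → (a ⊛ b) (suc n) * c (suc n))
    ≡⟨ ∑-head K (λ n → (a ⊛ b) n * c n) ⟨
  ∑ (suc K) (λ n → (a ⊛ b) n * c n) ∎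
  where
  open ≡-Reasoning
  last : ∀ i → a (suc i) * (b K * c (suc i ℕ.+ K)) ≡ 0ℚ
  last i = trans (cong (λ x → a (suc i) * (b K * x)) (z (suc i ℕ.+ K) (s≤s (ℕ.m≤n+m K i))))
    (solve 2 (λ a b → a :* (b :* con 0ℚ) := con 0ℚ) refl (a (suc i)) (b K))

-- Two factors with the same index u merge: q^(u v) q^(u v′) depends only on v + v′.
S-S : ∀ u a b f N → S (suc u) a (S (suc u) b f) N ≡ S (suc u) (conv a b) f N
S-S u a b f zero = refl
S-S u a b f N@(suc K) = begin
  ∑ N (λ i → a i * shift (U ℕ.* suc i) (S U b f) N)
    ≡⟨ ∑-cong N (λ i → cong (a i *_) (trans (shift-cong≤ (U ℕ.* suc i) N (λ n n≤N → S-bound u b f n≤N)) (shift-∑ (U ℕ.* suc i) N (λ j n → b j * shift (U ℕ.* suc j) f n) N))) ⟩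
  ∑ N (λ i → a i * ∑ N (λ j → shift (U ℕ.* suc i) (λ n → b j * shift (U ℕ.* suc j) f n) N))
    ≡⟨ ∑-cong N (λ i → trans (cong (a i *_) (∑-cong N (λ j → trans (shift-*ˡ (U ℕ.* suc i) (b j) (shift (U ℕ.* suc j) f) N) (cong (b j *_) (expo i j))))) (sym (∑-*ˡ N (a i) (λ j → b j * c (i ℕ.+ j))))) ⟩
  ∑ N (λ i → ∑ N (λ j → a i * (b j * c (i ℕ.+ j))))
    ≡⟨ ∑-triangle N a b c (λ n N≤n → shift-> (U ℕ.* suc (suc n)) f N (big n N≤n)) ⟩
  ∑ N (λ n → (a ⊛ b) n * c n)
    -- Here n stands for v + v′ = n + 2, whereas position i of `conv` stands for i + 1. The shift by
    -- one costs the last term, which vanishes, and gains a zero in front.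
    ≡⟨ cong (_+_ (∑ K (λ n → (a ⊛ b) n * c n))) (trans (cong ((a ⊛ b) K *_) (shift-> (U ℕ.* suc (suc K)) f N (ℕ.m≤m+n (suc N) (u ℕ.* suc N)))) (ℚ.*-zeroʳ ((a ⊛ b) K))) ⟩
  ∑ K (λ n → (a ⊛ b) n * c n) + 0ℚ
    ≡⟨ ℚ.+-comm (∑ K (λ n → (a ⊛ b) n * c n)) 0ℚ ⟩
  0ℚ + ∑ K (λ n → (a ⊛ b) n * c n)
    ≡⟨ cong (_+ ∑ K (λ n → (a ⊛ b) n * c n)) (ℚ.*-zeroˡ (shift (U ℕ.* 1) f N)) ⟨
  0ℚ * shift (U ℕ.* 1) f N + ∑ K (λ n → (a ⊛ b) n * c n)
    ≡⟨ ∑-head K (λ i → conv a b i * shift (U ℕ.* suc i) f N) ⟨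
  ∑ N (λ i → conv a b i * shift (U ℕ.* suc i) f N) ∎
  where
  open ≡-Reasoning
  U = suc u
  c : Series
  c n = shift (U ℕ.* suc (suc n)) f N
  big : ∀ n → N ≤ n → N < U ℕ.* suc (suc n)
  big n N≤n = ℕ.<-≤-trans (s≤s (ℕ.m≤n⇒m≤1+n N≤n)) (ℕ.m≤m+n (suc (suc n)) (u ℕ.* suc (suc n)))
  expo : ∀ i j → shift (U ℕ.* suc i) (shift (U ℕ.* suc j) f) N ≡ c (i ℕ.+ j)
  expo i j = trans (shift-shift (U ℕ.* suc i) (U ℕ.* suc j) f N)
    (cong (λ z → shift z f N) (trans (sym (ℕ.*-distribˡ-+ U (suc i) (suc j))) (cong (λ z → U ℕ.* suc z) (ℕ.+-suc i j))))

S-⊛ˡ : ∀ u a f g N → (S (suc u) a f ⊛ g) N ≡ S (suc u) a (f ⊛ g) N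
S-⊛ˡ u a f g N = begin
  (S (suc u) a f ⊛ g) N
    ≡⟨ ⊛-cong≤ N (λ n n≤N → S-bound u a f n≤N) (λ _ _ → refl) ⟩
  ((λ n → ∑ N (λ i → a i * shift (suc u ℕ.* suc i) f n)) ⊛ g) N
    ≡⟨ ⊛-∑ˡ N (λ i n → a i * shift (suc u ℕ.* suc i) f n) g N ⟩
  ∑ N (λ i → ((λ n → a i * shift (suc u ℕ.* suc i) f n) ⊛ g) N)
    ≡⟨ ∑-cong N (λ i → trans (⊛-*ˡ (a i) (shift (suc u ℕ.* suc i) f) g N) (cong (a i *_) (shift-⊛ˡ (suc u ℕ.* suc i) f g N))) ⟩
  S (suc u) a (f ⊛ g) N ∎
  where open ≡-Reasoning

S-⊛ʳ : ∀ u a f g N → (f ⊛ S (suc u) a g) N ≡ S (suc u) a (f ⊛ g) N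
S-⊛ʳ u a f g N = trans (⊛-comm f (S (suc u) a g) N) (trans (S-⊛ˡ u a g f N) (S-cong≤ (suc u) a N (λ n _ → ⊛-comm g f n)))

-- A family assigns to (m , N) the coefficient of q^N of a sum truncated at u ≤ m.
Family : Set
Family = ℕ × ℕ → ℚ

infixl 7 _⊙_
_⊙_ : Family → Family → Family
(F ⊙ G) (m , N) = ((λ n → F (m , n)) ⊛ (λ n → G (m , n))) N

-- Adjoins a new largest index u = i + 1 ≤ m with factor b(u) a(v) q^(u v). The inner family is
-- taken at i because the remaining indices must be smaller than u.
I : Series → (ℕ → ℚ) → Family → Family
I a b F (m , N) = ∑ m (λ i → b (suc i) * S (suc i) a (λ n → F (i , n)) N)

I-linear : ∀ a b → Linear (I a b)
I-linear a b = record
  { T-cong = λ e (m , N) → ∑-cong m (λ i → cong (b (suc i) *_) (Linear.T-cong (S-linear (suc i) a) (λ n → e (i , n)) N))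
  ; T-+ = λ F G (m , N) → trans (∑-cong m (λ i → trans (cong (b (suc i) *_) (Linear.T-+ (S-linear (suc i) a) (λ n → F (i , n)) (λ n → G (i , n)) N)) (ℚ.*-distribˡ-+ (b (suc i)) _ _))) (∑-+ m _ _)
  ; T-* = λ c F (m , N) → trans (∑-cong m (λ i → trans (cong (b (suc i) *_) (Linear.T-* (S-linear (suc i) a) c (λ n → F (i , n)) N))
      (solve 3 (λ a c x → a :* (c :* x) := c :* (a :* x)) refl (b (suc i)) c (S (suc i) a (λ n → F (i , n)) N)))) (∑-*ˡ m c (λ i → b (suc i) * S (suc i) a (λ n → F (i , n)) N))
  }

I-linearᵃ : ∀ b F → Linear (λ a → I a b F)
I-linearᵃ b F = record
  { T-cong = λ e (m , N) → ∑-cong m (λ i → cong (b (suc i) *_) (Linear.T-cong (S-linearᵃ (suc i) (λ n → F (i , n))) e N))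
  ; T-+ = λ a a′ (m , N) → trans (∑-cong m (λ i → trans (cong (b (suc i) *_) (Linear.T-+ (S-linearᵃ (suc i) (λ n → F (i , n))) a a′ N)) (ℚ.*-distribˡ-+ (b (suc i)) _ _))) (∑-+ m _ _)
  ; T-* = λ c a (m , N) → trans (∑-cong m (λ i → trans (cong (b (suc i) *_) (Linear.T-* (S-linearᵃ (suc i) (λ n → F (i , n))) c a N))
      (solve 3 (λ a c x → a :* (c :* x) := c :* (a :* x)) refl (b (suc i)) c (S (suc i) a (λ n → F (i , n)) N)))) (∑-*ˡ m c (λ i → b (suc i) * S (suc i) a (λ n → F (i , n)) N))
  }

I-*ᵇ : ∀ a {b b′ : ℕ → ℚ} c F → (∀ u → b u ≡ c * b′ u) → I a b F ≗ (λ x → c * I a b′ F x)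
I-*ᵇ a {b} {b′} c F e (m , N) = trans (∑-cong m (λ i → trans (cong (_* S (suc i) a (λ n → F (i , n)) N) (e (suc i))) (ℚ.*-assoc c _ _)))
  (∑-*ˡ m c (λ i → b′ (suc i) * S (suc i) a (λ n → F (i , n)) N))

-- The quasi-shuffle recursion: the largest summation index of the product belongs to the first factor, to the second, or to both.
I-⊙ : ∀ a b a′ b′ F G →
  (I a b F ⊙ I a′ b′ G) ≗ (λ x → I a b (F ⊙ I a′ b′ G) x + (I a′ b′ (I a b F ⊙ G) x + I (conv a a′) (λ u → b u * b′ u) (F ⊙ G) x))
I-⊙ a b a′ b′ F G (zero , N) = ⊛-0ˡ (λ _ → 0ℚ) N
I-⊙ a b a′ b′ F G (suc m , N) = begin
  ((λ n → A n + x * s n) ⊛ (λ n → A′ n + x′ * s′ n)) N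
    ≡⟨ ⊛-+ˡ A (λ n → x * s n) (λ n → A′ n + x′ * s′ n) N ⟩
  (A ⊛ (λ n → A′ n + x′ * s′ n)) N + ((λ n → x * s n) ⊛ (λ n → A′ n + x′ * s′ n)) N
    ≡⟨ cong₂ _+_ (⊛-+ʳ A′ (λ n → x′ * s′ n) A N) (trans (⊛-+ʳ A′ (λ n → x′ * s′ n) (λ n → x * s n) N)
         (cong₂ _+_ (⊛-*ˡ x s A′ N) (trans (⊛-*ˡ x s (λ n → x′ * s′ n) N) (cong (x *_) (⊛-*ʳ x′ s′ s N))))) ⟩
  ((A ⊛ A′) N + (A ⊛ (λ n → x′ * s′ n)) N) + (x * (s ⊛ A′) N + x * (x′ * (s ⊛ s′) N))
    ≡⟨ cong₂ _+_ (cong₂ _+_ (I-⊙ a b a′ b′ F G (m , N)) (trans (⊛-*ʳ x′ s′ A N) (cong (x′ *_) (S-⊛ʳ m a′ A g N))))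
         (cong₂ _+_ (cong (x *_) (S-⊛ˡ m a f A′ N)) (cong (λ z → x * (x′ * z)) ss)) ⟩
  ((P + (Q + R)) + x′ * S M a′ (A ⊛ g) N) + (x * S M a (f ⊛ A′) N + x * (x′ * S M (conv a a′) (f ⊛ g) N))
    ≡⟨ solve 8 (λ p q r x y s t w → ((p :+ (q :+ r)) :+ y :* t) :+ (x :* s :+ x :* (y :* w)) := (p :+ x :* s) :+ ((q :+ y :* t) :+ (r :+ x :* y :* w))) refl
         P Q R x x′ (S M a (f ⊛ A′) N) (S M a′ (A ⊛ g) N) (S M (conv a a′) (f ⊛ g) N) ⟩
  (P + x * S M a (f ⊛ A′) N) + ((Q + x′ * S M a′ (A ⊛ g) N) + (R + x * x′ * S M (conv a a′) (f ⊛ g) N)) ∎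
  where
  open ≡-Reasoning
  M = suc m
  x = b M
  x′ = b′ M
  f g A A′ s s′ : Series
  f n = F (m , n)
  g n = G (m , n)
  A n = I a b F (m , n)
  A′ n = I a′ b′ G (m , n)
  s = S M a f
  s′ = S M a′ g
  P = I a b (F ⊙ I a′ b′ G) (m , N)
  Q = I a′ b′ (I a b F ⊙ G) (m , N)
  R = I (conv a a′) (λ u → b u * b′ u) (F ⊙ G) (m , N)
  ss : (s ⊛ s′) N ≡ S M (conv a a′) (f ⊛ g) N
  ss = trans (S-⊛ˡ m a f s′ N) (trans (S-cong≤ M a N (λ n _ → S-⊛ʳ m a′ f g n)) (S-S m a a′ (f ⊛ g) N))

pu : ℕ → ℕ → ℚ
pu r u = dp r (fromℕ u)

H : BiIndex → Family
H [] (m , N) = one N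
H ((s , r) ∷ w) = I (pw (s ∸ 1)) (pu r) (H w)

-- Formal ℤ-linear combinations

-- In the divided-power normalisation all relations used have integral coefficients, so the
-- computations stay in ℤ.
LC : Set → Set
LC A = List (ℤ × A)

evZ : {A X : Set} → (A → X → ℚ) → LC A → X → ℚ
evZ gen [] x = 0ℚ
evZ gen ((c , a) ∷ L) x = fromℤ c * gen a x + evZ gen L x

evZ-++ : ∀ {A X : Set} (gen : A → X → ℚ) L L′ x → evZ gen (L ++ L′) x ≡ evZ gen L x + evZ gen L′ x
evZ-++ gen [] L′ x = sym (ℚ.+-identityˡ _)
evZ-++ gen ((c , a) ∷ L) L′ x = trans (cong (_+_ (fromℤ c * gen a x)) (evZ-++ gen L L′ x)) (sym (ℚ.+-assoc (fromℤ c * gen a x) (evZ gen L x) (evZ gen L′ x)))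

evZ-closed : ∀ {A X : Set} {gen : A → X → ℚ} {S} → Closed S → ∀ {L} → All (λ p → S (gen (proj₂ p))) L → S (evZ gen L)
evZ-closed cl [] = Closed.nil cl
evZ-closed cl {(c , a) ∷ L} (s ∷ ss) = Closed.plus cl (Closed.mult cl (fromℤ c) s) (evZ-closed cl ss)

evZ-linear : ∀ {A X Y : Set} {gen : A → X → ℚ} {T : (X → ℚ) → (Y → ℚ)} → Linear T → ∀ L → T (evZ gen L) ≗ evZ (λ a → T (gen a)) L
evZ-linear lin [] = Linear.T-0 lin
evZ-linear {gen = gen} {T} lin ((c , a) ∷ L) y = trans (T-+ (λ x → fromℤ c * gen a x) (evZ gen L) y) (cong₂ _+_ (T-* (fromℤ c) (gen a) y) (evZ-linear lin L y))
  where open Linear lin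

evZ-concatMap : ∀ {A B X : Set} (gen : A → X → ℚ) (f : B → LC A) xs x → evZ gen (concatMap f xs) x ≡ foldr (λ b acc → evZ gen (f b) x + acc) 0ℚ xs
evZ-concatMap gen f [] x = refl
evZ-concatMap gen f (b ∷ xs) x = trans (evZ-++ gen (f b) (concatMap f xs) x) (cong (_+_ (evZ gen (f b) x)) (evZ-concatMap gen f xs x))

scale : ∀ {A} → ℤ → LC A → LC A
scale c = map (λ p → c ℤ.* proj₁ p , proj₂ p)

evZ-scale : ∀ {A X : Set} (gen : A → X → ℚ) c L x → evZ gen (scale c L) x ≡ fromℤ c * evZ gen L x
evZ-scale gen c [] x = sym (ℚ.*-zeroʳ (fromℤ c))
evZ-scale gen c ((d , a) ∷ L) x = trans (cong₂ _+_ (cong (_* gen a x) (fromℤ-* c d)) (evZ-scale gen c L x))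
  (solve 4 (λ c d g e → c :* d :* g :+ c :* e := c :* (d :* g :+ e)) refl (fromℤ c) (fromℤ d) (gen a x) (evZ gen L x))

prepend : ℕ × ℕ → LC BiIndex → LC BiIndex
prepend l = map (λ p → proj₁ p , l ∷ proj₂ p)

evZ-prepend : ∀ s r L x → evZ H (prepend (s , r) L) x ≡ I (pw (s ∸ 1)) (pu r) (evZ H L) x
evZ-prepend s r L x = trans (go L) (sym (evZ-linear (I-linear (pw (s ∸ 1)) (pu r)) L x))
  where
  go : ∀ L → evZ H (prepend (s , r) L) x ≡ evZ (λ w → I (pw (s ∸ 1)) (pu r) (H w)) L x
  go [] = refl
  go ((c , w) ∷ L) = cong (_+_ (fromℤ c * H ((s , r) ∷ w) x)) (go L)

Homogeneous : ℕ → BiIndex → Set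
Homogeneous n w = ValidBi w × weight w ≡ n

HomogeneousLC : ℕ → LC BiIndex → Set
HomogeneousLC n = All (λ p → Homogeneous n (proj₂ p))

prepend-homogeneous : ∀ {s r n m} L → 1 ≤ s → s ℕ.+ r ℕ.+ n ≡ m → HomogeneousLC n L → HomogeneousLC m (prepend (s , r) L)
prepend-homogeneous L 1≤s refl h = All.map⁺ (All.map (λ { (v , refl) → 1≤s ∷ v , refl }) h)

scale-homogeneous : ∀ {n} c L → HomogeneousLC n L → HomogeneousLC n (scale c L)
scale-homogeneous c L h = All.map⁺ h

-- Quasi-shuffle product, top weight part

-- In the merged term, s + s′ is the leading term of the convolution of powers of v, and the
-- binomial coefficient comes from multiplying the divided powers of the common u.
stuffle : BiIndex → BiIndex → LC BiIndex
stuffle [] v = (+ 1 , v) ∷ []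
stuffle w@(_ ∷ _) [] = (+ 1 , w) ∷ []
stuffle ((s , r) ∷ w) ((s′ , r′) ∷ v) =
  prepend (s , r) (stuffle w ((s′ , r′) ∷ v)) ++ (prepend (s′ , r′) (stuffle ((s , r) ∷ w) v) ++
  scale (+ binom (r ℕ.+ r′) r) (prepend (s ℕ.+ s′ , r ℕ.+ r′) (stuffle w v)))

private
  arrange₁ : ∀ s r s′ r′ w v → s′ ℕ.+ r′ ℕ.+ (s ℕ.+ r ℕ.+ w ℕ.+ v) ≡ s ℕ.+ r ℕ.+ w ℕ.+ (s′ ℕ.+ r′ ℕ.+ v)
  arrange₁ = solve-∀
  arrange₂ : ∀ s r s′ r′ w v → (s ℕ.+ s′) ℕ.+ (r ℕ.+ r′) ℕ.+ (w ℕ.+ v) ≡ s ℕ.+ r ℕ.+ w ℕ.+ (s′ ℕ.+ r′ ℕ.+ v)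
  arrange₂ = solve-∀

stuffle-homogeneous : ∀ w v → ValidBi w → ValidBi v → HomogeneousLC (weight w ℕ.+ weight v) (stuffle w v)
stuffle-homogeneous [] v hw hv = (hv , refl) ∷ []
stuffle-homogeneous (l ∷ w) [] hw hv = (hw , sym (ℕ.+-identityʳ _)) ∷ []
stuffle-homogeneous ((s , r) ∷ w) ((s′ , r′) ∷ v) (p ∷ hw) (q ∷ hv) =
  All.++⁺ (prepend-homogeneous _ p (sym (ℕ.+-assoc (s ℕ.+ r) (weight w) _)) (stuffle-homogeneous w ((s′ , r′) ∷ v) hw (q ∷ hv)))
  (All.++⁺ (prepend-homogeneous _ q (arrange₁ s r s′ r′ (weight w) (weight v)) (stuffle-homogeneous ((s , r) ∷ w) v (p ∷ hw) hv))
    (scale-homogeneous (+ binom (r ℕ.+ r′) r) _ (prepend-homogeneous _ (ℕ.≤-trans p (ℕ.m≤m+n s s′)) (arrange₂ s r s′ r′ (weight w) (weight v)) (stuffle-homogeneous w v hw hv))))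

Lower : ℕ → BiIndex → Set
Lower n w = ValidBi w × weight w < n

LowerSpan : ℕ → Family → Set
LowerSpan n = Span H (Lower n)

I-lower : ∀ {s r n m} → 1 ≤ s → s ℕ.+ r ℕ.+ n ≡ m → ∀ {F} → LowerSpan n F → LowerSpan m (I (pw (s ∸ 1)) (pu r) F)
I-lower {s} {r} {n} 1≤s refl = Linear.span-map (I-linear (pw (s ∸ 1)) (pu r)) span-closed
  (λ w (v , w<n) → span-gen ((s , r) ∷ w) (1≤s ∷ v , ℕ.+-monoʳ-< (s ℕ.+ r) w<n))

-- Merging two letters with s = a + 1 and s′ = a′ + 1 gives the letter with s + s′ up to letters of smaller weight.
merge-lower : ∀ a a′ r r′ n {F G} → LowerSpan n (λ x → F x - G x) → Span H (Homogeneous n) G →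
  LowerSpan (suc a ℕ.+ suc a′ ℕ.+ (r ℕ.+ r′) ℕ.+ n)
    (λ x → I (conv (pw a) (pw a′)) (λ u → pu r u * pu r′ u) F x - fromℕ (binom (r ℕ.+ r′) r) * I (pw (suc a ℕ.+ a′)) (pu (r ℕ.+ r′)) G x)
merge-lower a a′ r r′ n {F} {G} F-G hG = ext (λ x → begin
    I (conv (pw a) (pw a′)) (λ u → pu r u * pu r′ u) F x - C * I (pw t) b G x
      ≡⟨ cong (_- C * I (pw t) b G x) (I-*ᵇ (conv (pw a) (pw a′)) C F (λ u → dp-* r r′ (fromℕ u)) x) ⟩
    C * I (conv (pw a) (pw a′)) b F x - C * I (pw t) b G x
      ≡⟨ solve 4 (λ c p q s → c :* p :- c :* s := c :* ((p :- q) :+ (q :- s))) refl C (I (conv (pw a) (pw a′)) b F x) (I (pw t) b F x) (I (pw t) b G x) ⟩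
    C * ((I (conv (pw a) (pw a′)) b F x - I (pw t) b F x) + (I (pw t) b F x - I (pw t) b G x))
      ≡⟨ cong (C *_) (cong₂ _+_ (Linear.T-- (I-linearᵃ b F) (conv (pw a) (pw a′)) (pw t) x) (Linear.T-- (I-linear (pw t) b) F G x)) ⟨
    C * (I (λ i → conv (pw a) (pw a′) i - pw t i) b F x + I (pw t) b (λ x → F x - G x) x) ∎)
  (mult C (plus (Linear.span-map (I-linearᵃ b F) span-closed letter (conv-pw a a′)) (span-mono weaken (I-lower {suc t} (s≤s z≤n) refl F-G))))
  where
  open ≡-Reasoning
  t = suc a ℕ.+ a′
  b = pu (r ℕ.+ r′)
  C = fromℕ (binom (r ℕ.+ r′) r)
  m = suc a ℕ.+ suc a′ ℕ.+ (r ℕ.+ r′) ℕ.+ n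
  open Closed (span-closed {gen = H} {Lower m})
  m≡ : suc t ℕ.+ (r ℕ.+ r′) ℕ.+ n ≡ m
  m≡ = cong (λ z → z ℕ.+ (r ℕ.+ r′) ℕ.+ n) (sym (ℕ.+-suc (suc a) a′))
  weaken : ∀ {w} → Lower (suc t ℕ.+ (r ℕ.+ r′) ℕ.+ n) w → Lower m w
  weaken {w} (v , l) = v , subst (weight w <_) m≡ l
  -- `F` agrees with `G` only up to lower weight, but weight at most n is enough below a letter
  -- whose own weight has dropped.
  F-span : Span H (λ w → ValidBi w × weight w ≤ n) F
  F-span = Closed.congruent span-closed (span-mono (λ { (v , l) → v , ℕ.<⇒≤ l }) F-G) (span-mono (λ { (v , e) → v , ℕ.≤-reflexive e }) hG)
  letter : ∀ c → c < t → LowerSpan m (I (pw c) b F)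
  letter c c<t = Linear.span-map (I-linear (pw c) b) span-closed
    (λ w (v , w≤n) → span-gen ((suc c , r ℕ.+ r′) ∷ w) (s≤s z≤n ∷ v ,
       subst (suc c ℕ.+ (r ℕ.+ r′) ℕ.+ weight w <_) m≡ (ℕ.+-mono-<-≤ (ℕ.+-monoˡ-< (r ℕ.+ r′) (s≤s c<t)) w≤n))) F-span

evZ-homogeneous : ∀ {n} L → HomogeneousLC n L → Span H (Homogeneous n) (evZ H L)
evZ-homogeneous L h = evZ-closed span-closed (All.map (λ {p} hp → span-gen (proj₂ p) hp) h)

-- The three terms of `I-⊙` match the three of `stuffle`. The first two differ by adjoining a letter
-- to a remainder from the induction; the merged one is `merge-lower`.
⊙-stuffle : ∀ w v → ValidBi w → ValidBi v → LowerSpan (weight w ℕ.+ weight v) (λ x → (H w ⊙ H v) x - evZ H (stuffle w v) x)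
⊙-stuffle [] v hw hv = ext (λ x → trans (cong (λ z → z - (1ℚ * H v x + 0ℚ)) (⊛-identityˡ (λ n → H v (proj₁ x , n)) (proj₂ x)))
    (solve 1 (λ a → a :- (con 1ℚ :* a :+ con 0ℚ) := con 0ℚ) refl (H v x))) nil
  where open Closed (span-closed {gen = H} {Lower (weight v)})
⊙-stuffle w@(_ ∷ _) [] hw hv = ext (λ x → trans (cong (λ z → z - (1ℚ * H w x + 0ℚ)) (⊛-identityʳ (λ n → H w (proj₁ x , n)) (proj₂ x)))
    (solve 1 (λ a → a :- (con 1ℚ :* a :+ con 0ℚ) := con 0ℚ) refl (H w x))) nil
  where open Closed (span-closed {gen = H} {Lower (weight w ℕ.+ 0)})
⊙-stuffle ((suc a , r) ∷ w) ((suc a′ , r′) ∷ v) (p ∷ hw) (q ∷ hv) = ext (λ x → begin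
    (H W ⊙ H V) x - evZ H (stuffle W V) x
      ≡⟨ cong₂ _-_ (I-⊙ (pw a) (pu r) (pw a′) (pu r′) (H w) (H v) x)
           (trans (evZ-++ H (prepend (suc a , r) X) _ x) (cong₂ _+_ (evZ-prepend (suc a) r X x)
             (trans (evZ-++ H (prepend (suc a′ , r′) Y) _ x) (cong₂ _+_ (evZ-prepend (suc a′) r′ Y x)
               (trans (evZ-scale H (+ binom (r ℕ.+ r′) r) (prepend (suc a ℕ.+ suc a′ , r ℕ.+ r′) Z) x) (cong (C *_) (trans (evZ-prepend (suc a ℕ.+ suc a′) (r ℕ.+ r′) Z x)
                 (cong (λ t → I (pw t) (pu (r ℕ.+ r′)) (evZ H Z) x) (ℕ.+-suc a a′))))))))) ⟩
    (P x + (Q x + R x)) - (P′ x + (Q′ x + C * R′ x))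
      ≡⟨ solve 6 (λ p q r s t u → (p :+ (q :+ r)) :- (s :+ (t :+ u)) := (p :- s) :+ ((q :- t) :+ (r :- u))) refl (P x) (Q x) (R x) (P′ x) (Q′ x) (C * R′ x) ⟩
    (P x - P′ x) + ((Q x - Q′ x) + (R x - C * R′ x))
      ≡⟨ cong₂ (λ y z → y + (z + (R x - C * R′ x))) (Linear.T-- (I-linear (pw a) (pu r)) (H w ⊙ H V) (evZ H X) x) (Linear.T-- (I-linear (pw a′) (pu r′)) (H W ⊙ H v) (evZ H Y) x) ⟨
    I (pw a) (pu r) (λ x → (H w ⊙ H V) x - evZ H X x) x + (I (pw a′) (pu r′) (λ x → (H W ⊙ H v) x - evZ H Y x) x + (R x - C * R′ x)) ∎)
  (plus (I-lower {suc a} (s≤s z≤n) (sym (ℕ.+-assoc (suc a ℕ.+ r) (weight w) (weight V))) (⊙-stuffle w V hw (q ∷ hv)))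
    (plus (I-lower {suc a′} (s≤s z≤n) (arrange₁ (suc a) r (suc a′) r′ (weight w) (weight v)) (⊙-stuffle W v (p ∷ hw) hv))
      (span-mono (λ {u} (hu , l) → hu , subst (weight u <_) (arrange₂ (suc a) r (suc a′) r′ (weight w) (weight v)) l)
        (merge-lower a a′ r r′ (weight w ℕ.+ weight v) (⊙-stuffle w v hw hv) (evZ-homogeneous Z (stuffle-homogeneous w v hw hv))))))
  where
  open ≡-Reasoning
  W = (suc a , r) ∷ w
  V = (suc a′ , r′) ∷ v
  X = stuffle w V
  Y = stuffle W v
  Z = stuffle w v
  C = fromℕ (binom (r ℕ.+ r′) r)
  P P′ Q Q′ R R′ : Family
  P = I (pw a) (pu r) (H w ⊙ H V)
  P′ = I (pw a) (pu r) (evZ H X)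
  Q = I (pw a′) (pu r′) (H W ⊙ H v)
  Q′ = I (pw a′) (pu r′) (evZ H Y)
  R = I (conv (pw a) (pw a′)) (λ u → pu r u * pu r′ u) (H w ⊙ H v)
  R′ = I (pw (suc a ℕ.+ a′)) (pu (r ℕ.+ r′)) (evZ H Z)
  open Closed (span-closed {gen = H} {Lower (weight W ℕ.+ weight V)})

-- Bi-brackets as truncated sums

-- `coefSum` bounds the indices strictly and `H` weakly, whence `suc m`. The test u v ≤ N becomes
-- the vanishing of `shift` beyond N.
coefSum-H : ∀ w N m → coefSum w N (suc m) ≡ H w (m , N)
coefSum-H [] zero m = refl
coefSum-H [] (suc N) m = refl
coefSum-H ((s , r) ∷ w) N m = trans (sumFrom1-∑ m (λ u → sumFrom1 N (f u))) (∑-cong m λ i →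
  trans (sumFrom1-∑ N (f (suc i))) (trans (∑-cong N (summand i))
    (∑-*ˡ N (pu r (suc i)) (λ j → pw (s ∸ 1) j * shift (suc i ℕ.* suc j) (λ n → H w (i , n)) N))))
  where
  f : ℕ → ℕ → ℚ
  f u v = if ⌊ u ℕ.* v ℕ.≤? N ⌋ then term s r u v * coefSum w (N ∸ u ℕ.* v) u else 0ℚ
  summand : ∀ i j → f (suc i) (suc j) ≡ pu r (suc i) * (pw (s ∸ 1) j * shift (suc i ℕ.* suc j) (λ n → H w (i , n)) N)
  summand i j with suc i ℕ.* suc j ℕ.≤? N
  ... | yes k≤N = trans (cong₂ _*_ (cong₂ _*_ (power/factorial r (suc i)) (power/factorial (s ∸ 1) (suc j)))
                          (trans (coefSum-H w (N ∸ suc i ℕ.* suc j) i) (sym (shift-≤ (suc i ℕ.* suc j) (λ n → H w (i , n)) N k≤N))))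
                        (ℚ.*-assoc (pu r (suc i)) (pw (s ∸ 1) j) _)
  ... | no k≰N = sym (trans (cong (λ z → pu r (suc i) * (pw (s ∸ 1) j * z)) (shift-> (suc i ℕ.* suc j) (λ n → H w (i , n)) N (ℕ.≰⇒> k≰N)))
                        (solve 2 (λ a b → a :* (b :* con 0ℚ) := con 0ℚ) refl (pu r (suc i)) (pw (s ∸ 1) j)))

biBracket-H : ∀ w N → biBracket w N ≡ H w (N , N)
biBracket-H w N = coefSum-H w N N

-- Since v ≥ 1, an index above N contributes nothing to q^N. Hence all coefficients entering a
-- product up to q^N can be read at the same truncation.
H-stable : ∀ w {m N} → N ≤ m → H w (m , N) ≡ H w (N , N)
H-stable [] N≤m = refl
H-stable ((s , r) ∷ w) {m} {N} N≤m = ∑-extend N m _ N≤m (λ i N≤i →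
  trans (cong (pu r (suc i) *_) (S-vanish (suc i) (pw (s ∸ 1)) (λ n → H w (i , n)) N (s≤s N≤i))) (ℚ.*-zeroʳ (pu r (suc i))))

diagonal : Family → Series
diagonal F N = F (N , N)

diagonal-linear : Linear diagonal
diagonal-linear = record { T-cong = λ e N → e (N , N) ; T-+ = λ F G N → refl ; T-* = λ c F N → refl }

evZ-biBracket : ∀ L N → evZ biBracket L N ≡ evZ H L (N , N)
evZ-biBracket [] N = refl
evZ-biBracket ((c , w) ∷ L) N = cong₂ _+_ (cong (fromℤ c *_) (biBracket-H w N)) (evZ-biBracket L N)

biBracket-⊛ : ∀ w v N → (biBracket w ⊛ biBracket v) N ≡ (H w ⊙ H v) (N , N)
biBracket-⊛ w v N = ⊛-cong≤ N (λ n n≤N → trans (biBracket-H w n) (sym (H-stable w n≤N))) (λ n n≤N → trans (biBracket-H v n) (sym (H-stable v n≤N)))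

-- Products of bi-brackets and of relations modulo lower weight

Below : ℕ → Series → Set
Below n = Span biBracket (Lower n)

⊛-stuffle : ∀ w v → ValidBi w → ValidBi v → Below (weight w ℕ.+ weight v) (λ N → (biBracket w ⊛ biBracket v) N - evZ biBracket (stuffle w v) N)
⊛-stuffle w v hw hv = Closed.ext span-closed (λ N → cong₂ _-_ (biBracket-⊛ w v N) (evZ-biBracket (stuffle w v) N))
  (Linear.span-map diagonal-linear span-closed (λ u l → Closed.ext span-closed (λ N → sym (biBracket-H u N)) (span-gen u l)) (⊙-stuffle w v hw hv))

stuffleLC : LC BiIndex → BiIndex → LC BiIndex
stuffleLC L v = concatMap (λ p → scale (proj₁ p) (stuffle (proj₂ p) v)) L

⊛-stuffleLC : ∀ {n v} L → HomogeneousLC n L → ValidBi v → Below (n ℕ.+ weight v) (λ N → (evZ biBracket L ⊛ biBracket v) N - evZ biBracket (stuffleLC L v) N)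
⊛-stuffleLC {n} {v} [] [] hv = Closed.ext span-closed (λ N → cong (_- 0ℚ) (⊛-0ˡ (biBracket v) N)) (Closed.nil span-closed)
⊛-stuffleLC {n} {v} ((c , w) ∷ L) ((hw , refl) ∷ h) hv = ext (λ N → begin
    ((λ i → fromℤ c * biBracket w i + evZ biBracket L i) ⊛ biBracket v) N - evZ biBracket (scale c (stuffle w v) ++ stuffleLC L v) N
      ≡⟨ cong₂ _-_ (trans (⊛-+ˡ (λ i → fromℤ c * biBracket w i) (evZ biBracket L) (biBracket v) N) (cong (_+ (evZ biBracket L ⊛ biBracket v) N) (⊛-*ˡ (fromℤ c) (biBracket w) (biBracket v) N)))
           (trans (evZ-++ biBracket (scale c (stuffle w v)) (stuffleLC L v) N) (cong (_+ evZ biBracket (stuffleLC L v) N) (evZ-scale biBracket c (stuffle w v) N))) ⟩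
    (fromℤ c * (biBracket w ⊛ biBracket v) N + (evZ biBracket L ⊛ biBracket v) N) - (fromℤ c * evZ biBracket (stuffle w v) N + evZ biBracket (stuffleLC L v) N)
      ≡⟨ solve 5 (λ c p q r s → (c :* p :+ q) :- (c :* r :+ s) := c :* (p :- r) :+ (q :- s)) refl (fromℤ c) ((biBracket w ⊛ biBracket v) N) ((evZ biBracket L ⊛ biBracket v) N) (evZ biBracket (stuffle w v) N) (evZ biBracket (stuffleLC L v) N) ⟩
    fromℤ c * ((biBracket w ⊛ biBracket v) N - evZ biBracket (stuffle w v) N) + ((evZ biBracket L ⊛ biBracket v) N - evZ biBracket (stuffleLC L v) N) ∎)
  (plus (mult (fromℤ c) (⊛-stuffle w v hw hv)) (⊛-stuffleLC L h hv))
  where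
  open ≡-Reasoning
  open Closed (span-closed {gen = biBracket} {Lower (weight w ℕ.+ weight v)})

-- A vanishing combination times a bi-bracket vanishes, so its quasi-shuffle expansion consists of
-- nothing but the lower-weight error.
stuffleLC-relation : ∀ {n v} L → HomogeneousLC n L → ValidBi v → (∀ N → evZ biBracket L N ≡ 0ℚ) → Below (n ℕ.+ weight v) (evZ biBracket (stuffleLC L v))
stuffleLC-relation {n} {v} L h hv z = Closed.ext span-closed
  (λ N → trans (solve 1 (λ x → x := (:- con 1ℚ) :* (con 0ℚ :- x)) refl (evZ biBracket (stuffleLC L v) N))
     (cong (λ y → (- 1ℚ) * (y - evZ biBracket (stuffleLC L v) N)) (sym (trans (⊛-cong N z (λ _ → refl)) (⊛-0ˡ (biBracket v) N)))))
  (Closed.mult span-closed (- 1ℚ) (⊛-stuffleLC L h hv))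

-- Duality

-- Difference words: the letter (s , α) carries v^{s-1} and the divided power of order α of u_j - u_{j+1}.

Letters : ℕ → Set
Letters = Vec (ℕ × ℕ)

-- The part in which the largest index equals u; the next index t runs over t < u. The empty word
-- sits at index 0, which encodes u_(l+1) = 0 and makes the last difference u_l itself.
Z : ∀ {l} → Letters l → ℕ → Series
Z [] zero = one
Z [] (suc _) = λ _ → 0ℚ
Z ((s , α) ∷ w) u = S u (pw (s ∸ 1)) (λ n → ∑ u (λ t → dp α (fromℕ (u ∸ t)) * Z w t n))

-- expand x w is the difference word w with an additional factor u₀^x/x!, u₀ the largest index, written in bi-indices.
expand : ℕ → BiIndex → LC BiIndex
expand zero [] = (+ 1 , []) ∷ []
expand (suc x) [] = []
expand x ((s , α) ∷ w) =
  concatMap (λ y → scale (sgn y ℤ.* + binom (x ℕ.+ (α ∸ y)) x) (prepend (s , x ℕ.+ (α ∸ y)) (expand y w))) (upTo (suc α))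

-- By `dp-diff` the power α of u_j - u_(j+1) splits into a power α - y of u_j, which merges with the
-- given power x by `dp-*`, and a power y of u_(j+1), which is handed to the rest of the word. At
-- the end a positive power meets u_(l+1) = 0 and vanishes.
expand-Z : ∀ {l} (w : Letters l) x m N → ∑ (suc m) (λ t → dp x (fromℕ t) * Z w t N) ≡ evZ H (expand x (toList w)) (m , N)
expand-Z [] zero m N = trans (∑-head m (λ t → dp 0 (fromℕ t) * Z [] t N)) (cong (_+_ (1ℚ * one N)) (∑-zero m (λ t _ → ℚ.*-zeroʳ 1ℚ)))
expand-Z [] (suc x) m N = ∑-zero (suc m) zeros
  where
  zeros : ∀ t → t < suc m → dp (suc x) (fromℕ t) * Z [] t N ≡ 0ℚ
  zeros zero _ = solve 3 (λ a b c → a :* (con 0ℚ :* b) :* c := con 0ℚ) refl (recip x) (dp x 0ℚ) (one N)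
  zeros (suc t) _ = ℚ.*-zeroʳ (dp (suc x) (fromℕ (suc t)))
expand-Z ((s , α) ∷ w) x m N = begin
  ∑ (suc m) (λ t → dp x (fromℕ t) * Z ((s , α) ∷ w) t N)
    -- At t = 0 the sum inside `Z` is empty, so the meaningless value of `S` at index 0 does no
    -- harm.
    ≡⟨ trans (∑-head m _) (trans (cong (_+ rest) (trans (cong (dp x 0ℚ *_) (Linear.T-0 (S-linear 0 a) N)) (ℚ.*-zeroʳ (dp x 0ℚ)))) (ℚ.+-identityˡ rest)) ⟩
  rest
    ≡⟨ ∑-cong m inner ⟩
  ∑ m (λ i → ∑ (suc α) (λ y → c y * (pu (e y) (suc i) * S (suc i) a (λ n → E y (i , n)) N)))
    ≡⟨ ∑-swap m (suc α) _ ⟩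
  ∑ (suc α) (λ y → ∑ m (λ i → c y * (pu (e y) (suc i) * S (suc i) a (λ n → E y (i , n)) N)))
    ≡⟨ ∑-cong (suc α) (λ y → trans (∑-*ˡ m (c y) _) (trans (cong (c y *_) (sym (evZ-prepend s (e y) (expand y (toList w)) (m , N))))
         (sym (evZ-scale H (cℤ y) (prepend (s , e y) (expand y (toList w))) (m , N))))) ⟩
  ∑ (suc α) (λ y → evZ H (scale (cℤ y) (prepend (s , e y) (expand y (toList w)))) (m , N))
    ≡⟨ foldr-applyUpTo (suc α) (λ y → y) (λ y → evZ H (scale (cℤ y) (prepend (s , e y) (expand y (toList w)))) (m , N)) ⟨
  foldr (λ y acc → evZ H (scale (cℤ y) (prepend (s , e y) (expand y (toList w)))) (m , N) + acc) 0ℚ (upTo (suc α))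
    ≡⟨ evZ-concatMap H (λ y → scale (cℤ y) (prepend (s , e y) (expand y (toList w)))) (upTo (suc α)) (m , N) ⟨
  evZ H (concatMap (λ y → scale (cℤ y) (prepend (s , e y) (expand y (toList w)))) (upTo (suc α))) (m , N)
    ≡⟨ cong (λ L → evZ H L (m , N)) (unfold x) ⟨
  evZ H (expand x (toList ((s , α) ∷ w))) (m , N) ∎
  where
  open ≡-Reasoning
  a = pw (s ∸ 1)
  e : ℕ → ℕ
  e y = x ℕ.+ (α ∸ y)
  cℤ : ℕ → ℤ
  cℤ y = sgn y ℤ.* + binom (e y) x
  c : ℕ → ℚ
  c y = fromℤ (cℤ y)
  E : ℕ → Family
  E y = evZ H (expand y (toList w))
  rest = ∑ m (λ i → dp x (fromℕ (suc i)) * Z ((s , α) ∷ w) (suc i) N)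
  -- `expand` matches on its first argument before the word, so the last clause computes only after
  -- x is split.
  unfold : ∀ x → expand x ((s , α) ∷ toList w)
    ≡ concatMap (λ y → scale (sgn y ℤ.* + binom (x ℕ.+ (α ∸ y)) x) (prepend (s , x ℕ.+ (α ∸ y)) (expand y (toList w)))) (upTo (suc α))
  unfold zero = refl
  unfold (suc x) = refl
  D : ℕ → ℕ → ℚ
  D i y = dp (α ∸ y) (fromℕ (suc i)) * fromℤ (sgn y)
  diff : ∀ i n → ∑ (suc i) (λ t → dp α (fromℕ (suc i ∸ t)) * Z w t n) ≡ ∑ (suc α) (λ y → D i y * E y (i , n))
  diff i n = begin
    ∑ (suc i) (λ t → dp α (fromℕ (suc i ∸ t)) * Z w t n)
      ≡⟨ ∑-cong< (suc i) (λ t t≤i → cong (_* Z w t n) (trans (dp-diff α t (suc i ∸ t))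
           (∑-cong (suc α) (λ y → cong (λ z → dp (α ∸ y) (fromℕ z) * (fromℤ (sgn y) * dp y (fromℕ t))) (ℕ.m+[n∸m]≡n (ℕ.<⇒≤ t≤i)))))) ⟩
    ∑ (suc i) (λ t → ∑ (suc α) (λ y → dp (α ∸ y) (fromℕ (suc i)) * (fromℤ (sgn y) * dp y (fromℕ t))) * Z w t n)
      ≡⟨ ∑-cong (suc i) (λ t → trans (ℚ.*-comm _ (Z w t n)) (sym (∑-*ˡ (suc α) (Z w t n) _))) ⟩
    ∑ (suc i) (λ t → ∑ (suc α) (λ y → Z w t n * (dp (α ∸ y) (fromℕ (suc i)) * (fromℤ (sgn y) * dp y (fromℕ t)))))
      ≡⟨ ∑-swap (suc i) (suc α) _ ⟩
    ∑ (suc α) (λ y → ∑ (suc i) (λ t → Z w t n * (dp (α ∸ y) (fromℕ (suc i)) * (fromℤ (sgn y) * dp y (fromℕ t)))))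
      ≡⟨ ∑-cong (suc α) (λ y → trans (∑-cong (suc i) (λ t → solve 4 (λ z p q r → z :* (p :* (q :* r)) := (p :* q) :* (r :* z)) refl
           (Z w t n) (dp (α ∸ y) (fromℕ (suc i))) (fromℤ (sgn y)) (dp y (fromℕ t)))) (∑-*ˡ (suc i) (D i y) _)) ⟩
    ∑ (suc α) (λ y → D i y * ∑ (suc i) (λ t → dp y (fromℕ t) * Z w t n))
      ≡⟨ ∑-cong (suc α) (λ y → cong (D i y *_) (expand-Z w y i n)) ⟩
    ∑ (suc α) (λ y → D i y * E y (i , n)) ∎
  S-sum : ∀ u k (d : ℕ → ℚ) (F : ℕ → Series) → S u a (λ n → ∑ k (λ y → d y * F y n)) N ≡ ∑ k (λ y → d y * S u a (F y) N)
  S-sum u zero d F = Linear.T-0 (S-linear u a) N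
  S-sum u (suc k) d F = trans (Linear.T-+ (S-linear u a) (λ n → ∑ k (λ y → d y * F y n)) (λ n → d k * F k n) N)
    (cong₂ _+_ (S-sum u k d F) (Linear.T-* (S-linear u a) (d k) (F k) N))
  inner : ∀ i → dp x (fromℕ (suc i)) * Z ((s , α) ∷ w) (suc i) N ≡ ∑ (suc α) (λ y → c y * (pu (e y) (suc i) * S (suc i) a (λ n → E y (i , n)) N))
  inner i = begin
    dp x U * S (suc i) a (λ n → ∑ (suc i) (λ t → dp α (fromℕ (suc i ∸ t)) * Z w t n)) N
      ≡⟨ cong (dp x U *_) (trans (Linear.T-cong (S-linear (suc i) a) (diff i) N) (S-sum (suc i) (suc α) (D i) (λ y n → E y (i , n)))) ⟩
    dp x U * ∑ (suc α) (λ y → D i y * S (suc i) a (λ n → E y (i , n)) N)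
      ≡⟨ ∑-*ˡ (suc α) (dp x U) _ ⟨
    ∑ (suc α) (λ y → dp x U * (D i y * S (suc i) a (λ n → E y (i , n)) N))
      ≡⟨ ∑-cong (suc α) (λ y → trans (solve 4 (λ p q r t → p :* (q :* r :* t) := r :* ((p :* q) :* t)) refl (dp x U) (dp (α ∸ y) U) (fromℤ (sgn y)) (S (suc i) a (λ n → E y (i , n)) N))
           (trans (cong (λ z → fromℤ (sgn y) * (z * S (suc i) a (λ n → E y (i , n)) N)) (dp-* x (α ∸ y) U))
           (trans (solve 4 (λ p q r t → p :* (q :* r :* t) := p :* q :* (r :* t)) refl (fromℤ (sgn y)) (fromℕ (binom (e y) x)) (dp (e y) U) (S (suc i) a (λ n → E y (i , n)) N))
             (cong (_* (pu (e y) (suc i) * S (suc i) a (λ n → E y (i , n)) N)) (sym (fromℤ-* (sgn y) (+ binom (e y) x))))))) ⟩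
    ∑ (suc α) (λ y → c y * (pu (e y) (suc i) * S (suc i) a (λ n → E y (i , n)) N)) ∎
    where U = fromℕ (suc i)

expand-biBracket : ∀ {l} (w : Letters l) N → evZ biBracket (expand 0 (toList w)) N ≡ ∑ (suc N) (λ t → Z w t N)
expand-biBracket w N = trans (evZ-biBracket (expand 0 (toList w)) N) (trans (sym (expand-Z w 0 N N)) (∑-cong (suc N) (λ t → ℚ.*-identityˡ (Z w t N))))

expand-homogeneous : ∀ x w → ValidBi w → HomogeneousLC (x ℕ.+ weight w) (expand x w)
expand-homogeneous zero [] h = ([] , refl) ∷ []
expand-homogeneous (suc x) [] h = []
expand-homogeneous x ((s , α) ∷ w) (p ∷ h) = subst (HomogeneousLC (x ℕ.+ (s ℕ.+ α ℕ.+ weight w))) (sym (unfold x))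
  (All.concat⁺ (All.map⁺ (All.applyUpTo⁺₁ (λ y → y) (suc α) (λ {y} y≤α → scale-homogeneous (sgn y ℤ.* + binom (x ℕ.+ (α ∸ y)) x) _
    (prepend-homogeneous (expand y w) p (eq y (ℕ.≤-pred y≤α)) (expand-homogeneous y w h))))))
  where
  unfold : ∀ x → expand x ((s , α) ∷ w)
    ≡ concatMap (λ y → scale (sgn y ℤ.* + binom (x ℕ.+ (α ∸ y)) x) (prepend (s , x ℕ.+ (α ∸ y)) (expand y w))) (upTo (suc α))
  unfold zero = refl
  unfold (suc x) = refl
  arrange : ∀ s x d y w → s ℕ.+ (x ℕ.+ d) ℕ.+ (y ℕ.+ w) ≡ x ℕ.+ (s ℕ.+ (d ℕ.+ y) ℕ.+ w)
  arrange = solve-∀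
  eq : ∀ y → y ≤ α → s ℕ.+ (x ℕ.+ (α ∸ y)) ℕ.+ (y ℕ.+ weight w) ≡ x ℕ.+ (s ℕ.+ α ℕ.+ weight w)
  eq y y≤α = trans (arrange s x (α ∸ y) y (weight w)) (cong (λ z → x ℕ.+ (s ℕ.+ z ℕ.+ weight w)) (ℕ.m∸n+n≡m y≤α))

-- Sums over boxes

-- In what follows an entry i of a vector stands for the positive integer i + 1.

box : ∀ l → ℕ → (Vec ℕ l → ℚ) → ℚ
box zero K f = f []
box (suc l) K f = ∑ K (λ i → box l K (λ is → f (i ∷ is)))

box-cong : ∀ l K {f g : Vec ℕ l → ℚ} → (∀ is → f is ≡ g is) → box l K f ≡ box l K g
box-cong zero K e = e []
box-cong (suc l) K e = ∑-cong K (λ i → box-cong l K (λ is → e (i ∷ is)))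

box-∑ : ∀ l K n (f : ℕ → Vec ℕ l → ℚ) → box l K (λ is → ∑ n (λ i → f i is)) ≡ ∑ n (λ i → box l K (f i))
box-∑ zero K n f = refl
box-∑ (suc l) K n f = trans (∑-cong K (λ j → box-∑ l K n (λ i is → f i (j ∷ is)))) (∑-swap K n (λ j i → box l K (λ is → f i (j ∷ is))))

box-*ˡ : ∀ l K c (f : Vec ℕ l → ℚ) → box l K (λ is → c * f is) ≡ c * box l K f
box-*ˡ zero K c f = refl
box-*ˡ (suc l) K c f = trans (∑-cong K (λ i → box-*ˡ l K c (λ is → f (i ∷ is)))) (∑-*ˡ K c (λ i → box l K (λ is → f (i ∷ is))))

box-swap : ∀ l l′ K (f : Vec ℕ l → Vec ℕ l′ → ℚ) → box l K (λ is → box l′ K (f is)) ≡ box l′ K (λ js → box l K (λ is → f is js))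
box-swap zero l′ K f = refl
box-swap (suc l) l′ K f = trans (∑-cong K (λ i → box-swap l l′ K (λ is → f (i ∷ is)))) (sym (box-∑ l′ K K (λ i js → box l K (λ is → f (i ∷ is) js))))

infixl 5 _▷_
_▷_ : ∀ {A : Set} {l} → Vec A l → A → Vec A (suc l)
[] ▷ x = x ∷ []
(y ∷ ys) ▷ x = y ∷ (ys ▷ x)

rev : ∀ {A : Set} {l} → Vec A l → Vec A l
rev [] = []
rev (x ∷ xs) = rev xs ▷ x

box-▷ : ∀ l K (f : Vec ℕ (suc l) → ℚ) → box (suc l) K f ≡ ∑ K (λ i → box l K (λ is → f (is ▷ i)))
box-▷ zero K f = refl
box-▷ (suc l) K f = trans (∑-cong K (λ j → box-▷ l K (λ is → f (j ∷ is)))) (∑-swap K K (λ j i → box l K (λ is → f (j ∷ (is ▷ i)))))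

box-rev : ∀ l K (f : Vec ℕ l → ℚ) → box l K (f ∘ rev) ≡ box l K f
box-rev zero K f = refl
box-rev (suc l) K f = trans (∑-cong K (λ i → box-rev l K (λ is → f (is ▷ i)))) (sym (box-▷ l K f))

-- Change of variables u = t + d with d = i + 1 ≥ 1: the square of pairs (t, d) covers all t < u ≤
-- K, and the rest has u > K.
∑-difference : ∀ K (g : ℕ → ℕ → ℚ) → (∀ u t → K < u → g u t ≡ 0ℚ) →
  ∑ (suc K) (λ t → ∑ K (λ i → g (suc i ℕ.+ t) t)) ≡ ∑ (suc K) (λ u → ∑ u (g u))
∑-difference zero g z = refl
∑-difference (suc K) g z = begin
  ∑ (suc (suc K)) (λ t → ∑ (suc K) (λ i → g (suc i ℕ.+ t) t))
    ≡⟨ ∑-head (suc K) _ ⟩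
  ∑ (suc K) (λ i → g (suc i ℕ.+ 0) 0) + ∑ (suc K) (λ t → ∑ (suc K) (λ i → g (suc i ℕ.+ suc t) (suc t)))
    ≡⟨ cong₂ _+_ (∑-cong (suc K) (λ i → cong (λ u → g u 0) (ℕ.+-identityʳ (suc i)))) (∑-cong (suc K) (λ t → trans
         (∑-extend K (suc K) _ (ℕ.n≤1+n K) (λ i K≤i → z _ (suc t) (s≤s (ℕ.≤-<-trans K≤i (ℕ.m<m+n i (s≤s z≤n))))))
         (∑-cong K (λ i → cong (λ u → g (suc u) (suc t)) (ℕ.+-suc i t))))) ⟩
  ∑ (suc K) (λ u → g (suc u) 0) + ∑ (suc K) (λ t → ∑ K (λ i → g (suc (suc i ℕ.+ t)) (suc t)))
    ≡⟨ cong (_+_ (∑ (suc K) (λ u → g (suc u) 0))) (∑-difference K (λ u t → g (suc u) (suc t)) (λ u t K<u → z (suc u) (suc t) (s≤s K<u))) ⟩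
  ∑ (suc K) (λ u → g (suc u) 0) + ∑ (suc K) (λ u → ∑ u (λ t → g (suc u) (suc t)))
    ≡⟨ ∑-+ (suc K) _ _ ⟨
  ∑ (suc K) (λ u → g (suc u) 0 + ∑ u (λ t → g (suc u) (suc t)))
    ≡⟨ ∑-cong (suc K) (λ u → ∑-head u (g (suc u))) ⟨
  ∑ (suc K) (λ u → ∑ (suc u) (g (suc u)))
    ≡⟨ ℚ.+-identityˡ _ ⟨
  0ℚ + ∑ (suc K) (λ u → ∑ (suc u) (g (suc u)))
    ≡⟨ ∑-head (suc K) (λ u → ∑ u (g u)) ⟨
  ∑ (suc (suc K)) (λ u → ∑ u (g u)) ∎
  where open ≡-Reasoning

total : ∀ {l} → Vec ℕ l → ℕ
total [] = 0
total (d ∷ ds) = suc d ℕ.+ total ds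

-- The part of Z with prescribed differences u_j - u_{j+1} = d_j + 1
Y : ∀ {l} → Letters l → Vec ℕ l → Series
Y [] [] = one
Y ((s , α) ∷ w) (d ∷ ds) N = dp α (fromℕ (suc d)) * S (suc d ℕ.+ total ds) (pw (s ∸ 1)) (Y w ds) N

-- The operator `G` makes the induction possible: it holds the letters already treated, which see
-- the tail only through its largest index. In the step, `G′` absorbs the first letter together with
-- the sum over its difference.
box-Z : ∀ {l} (w : Letters l) K (G : ℕ → Series → ℕ → ℚ) → (∀ u → Linear (G u)) → (∀ u f N → K < u → G u f N ≡ 0ℚ) → ∀ N →
  box l K (λ ds → G (total ds) (Y w ds) N) ≡ ∑ (suc K) (λ u → G u (Z w u) N)
box-Z [] K G lin z N = sym (trans (∑-head K (λ u → G u (Z [] u) N)) (trans (cong (_+_ (G 0 one N)) (∑-zero K (λ i _ → Linear.T-0 (lin (suc i)) N))) (ℚ.+-identityʳ _)))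
box-Z {suc l} ((s , α) ∷ w) K G lin z N = begin
  ∑ K (λ i → box l K (λ ds → G (suc i ℕ.+ total ds) (Y ((s , α) ∷ w) (i ∷ ds)) N))
    ≡⟨ box-∑ l K K (λ i ds → G (suc i ℕ.+ total ds) (Y ((s , α) ∷ w) (i ∷ ds)) N) ⟨
  box l K (λ ds → G′ (total ds) (Y w ds) N)
    ≡⟨ box-Z w K G′ lin′ z′ N ⟩
  ∑ (suc K) (λ t → ∑ K (λ i → G (suc i ℕ.+ t) (λ n → dp α (fromℕ (suc i)) * S (suc i ℕ.+ t) a (Z w t) n) N))
    ≡⟨ ∑-cong (suc K) (λ t → ∑-cong K (λ i → cong (λ d → G (suc i ℕ.+ t) (λ n → dp α (fromℕ d) * S (suc i ℕ.+ t) a (Z w t) n) N) (sym (ℕ.m+n∸n≡m (suc i) t)))) ⟩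
  ∑ (suc K) (λ t → ∑ K (λ i → g (suc i ℕ.+ t) t))
    ≡⟨ ∑-difference K g (λ u t K<u → z u _ N K<u) ⟩
  ∑ (suc K) (λ u → ∑ u (g u))
    ≡⟨ ∑-cong (suc K) (λ u → sym (G-sum u u)) ⟩
  ∑ (suc K) (λ u → G u (Z ((s , α) ∷ w) u) N) ∎
  where
  open ≡-Reasoning
  a = pw (s ∸ 1)
  g : ℕ → ℕ → ℚ
  g u t = G u (λ n → dp α (fromℕ (u ∸ t)) * S u a (Z w t) n) N
  G′ : ℕ → Series → ℕ → ℚ
  G′ t f N = ∑ K (λ i → G (suc i ℕ.+ t) (λ n → dp α (fromℕ (suc i)) * S (suc i ℕ.+ t) a f n) N)
  lin′ : ∀ t → Linear (G′ t)
  lin′ t = record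
    { T-cong = λ e N → ∑-cong K (λ i → Linear.T-cong (lin _) (λ n → cong (dp α (fromℕ (suc i)) *_) (Linear.T-cong (S-linear (suc i ℕ.+ t) a) e n)) N)
    ; T-+ = λ f h N → trans (∑-cong K (λ i → trans (Linear.T-cong (lin _) (λ n → trans (cong (dp α (fromℕ (suc i)) *_) (Linear.T-+ (S-linear (suc i ℕ.+ t) a) f h n)) (ℚ.*-distribˡ-+ (dp α (fromℕ (suc i))) _ _)) N)
        (Linear.T-+ (lin _) _ _ N))) (∑-+ K _ _)
    ; T-* = λ c f N → trans (∑-cong K (λ i → trans (Linear.T-cong (lin _) (λ n → trans (cong (dp α (fromℕ (suc i)) *_) (Linear.T-* (S-linear (suc i ℕ.+ t) a) c f n))
        (solve 3 (λ d c x → d :* (c :* x) := c :* (d :* x)) refl (dp α (fromℕ (suc i))) c (S (suc i ℕ.+ t) a f n))) N)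
        (Linear.T-* (lin _) c (λ n → dp α (fromℕ (suc i)) * S (suc i ℕ.+ t) a f n) N))) (∑-*ˡ K c _)
    }
  z′ : ∀ t f N → K < t → G′ t f N ≡ 0ℚ
  z′ t f N K<t = ∑-zero K (λ i _ → z _ _ N (ℕ.<-≤-trans K<t (ℕ.m≤n+m t (suc i))))
  G-sum : ∀ u k → G u (S u a (λ n → ∑ k (λ t → dp α (fromℕ (u ∸ t)) * Z w t n))) N ≡ ∑ k (g u)
  G-sum u zero = trans (Linear.T-cong (lin u) (Linear.T-0 (S-linear u a)) N) (Linear.T-0 (lin u) N)
  G-sum u (suc k) = trans (Linear.T-cong (lin u) (λ n → trans (Linear.T-+ (S-linear u a) (λ n → ∑ k (λ t → dp α (fromℕ (u ∸ t)) * Z w t n)) (λ n → dp α (fromℕ (u ∸ k)) * Z w k n) n)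
      (cong (_+_ (S u a (λ n → ∑ k (λ t → dp α (fromℕ (u ∸ t)) * Z w t n)) n)) (Linear.T-* (S-linear u a) (dp α (fromℕ (u ∸ k))) (Z w k) n))) N)
    (trans (Linear.T-+ (lin u) _ _ N) (cong (_+ g u k) (G-sum u k)))

Y-vanish : ∀ {l} (w : Letters l) ds N → N < total ds → Y w ds N ≡ 0ℚ
Y-vanish ((s , α) ∷ w) (d ∷ ds) N N< = trans (cong (dp α (fromℕ (suc d)) *_) (S-vanish (suc d ℕ.+ total ds) (pw (s ∸ 1)) (Y w ds) N N<)) (ℚ.*-zeroʳ (dp α (fromℕ (suc d))))

box-Y : ∀ {l} (w : Letters l) N → box l N (λ ds → Y w ds N) ≡ ∑ (suc N) (λ u → Z w u N)
box-Y {l} w N = begin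
  box l N (λ ds → Y w ds N)                          ≡⟨ box-cong l N (λ ds → cut (total ds) (Y w ds N) (Y-vanish w ds N)) ⟩
  box l N (λ ds → κ (total ds) * Y w ds N)           ≡⟨ box-Z w N (λ u f n → κ u * f n) lin z N ⟩
  ∑ (suc N) (λ u → κ u * Z w u N)                    ≡⟨ ∑-cong< (suc N) (λ u u≤N → sym (cut u (Z w u N) (λ N<u → ⊥-elim (ℕ.<⇒≱ N<u (ℕ.≤-pred u≤N))))) ⟩
  ∑ (suc N) (λ u → Z w u N)                          ∎
  where
  open ≡-Reasoning
  -- `box-Z` asks for an operator that vanishes above the bound. This cutoff alters nothing, as
  -- indices above N do not reach q^N.
  κ : ℕ → ℚ
  κ u with u ℕ.≤? N
  ... | yes _ = 1ℚ
  ... | no _ = 0ℚ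
  cut : ∀ u x → (N < u → x ≡ 0ℚ) → x ≡ κ u * x
  cut u x v with u ℕ.≤? N
  ... | yes _ = sym (ℚ.*-identityˡ x)
  ... | no u≰N = trans (v (ℕ.≰⇒> u≰N)) (sym (ℚ.*-zeroˡ x))
  z : ∀ u (f : Series) n → N < u → κ u * f n ≡ 0ℚ
  z u f n N<u with u ℕ.≤? N
  ... | yes u≤N = ⊥-elim (ℕ.<⇒≱ N<u u≤N)
  ... | no _ = ℚ.*-zeroˡ (f n)
  lin : ∀ u → Linear (λ f n → κ u * f n)
  lin u = record { T-cong = λ e n → cong (κ u *_) (e n) ; T-+ = λ f g n → ℚ.*-distribˡ-+ (κ u) (f n) (g n)
    ; T-* = λ c f n → solve 3 (λ k c x → k :* (c :* x) := c :* (k :* x)) refl (κ u) c (f n) }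

monomial : ∀ {l} → Letters l → Vec ℕ l → Vec ℕ l → ℚ
monomial [] [] [] = 1ℚ
monomial ((s , α) ∷ w) (d ∷ ds) (v ∷ vs) = monomial w ds vs * (dp α (fromℕ (suc d)) * dp (s ∸ 1) (fromℕ (suc v)))

exponent : ∀ {l} → Vec ℕ l → Vec ℕ l → ℕ
exponent [] [] = 0
exponent (d ∷ ds) (v ∷ vs) = (suc d ℕ.+ total ds) ℕ.* suc v ℕ.+ exponent ds vs

Y-box : ∀ {l} (w : Letters l) ds {N K} → N ≤ K → Y w ds N ≡ box l K (λ vs → monomial w ds vs * shift (exponent ds vs) one N)
Y-box [] [] N≤K = sym (ℚ.*-identityˡ _)
Y-box {suc l} ((s , α) ∷ w) (d ∷ ds) {N} {K} N≤K = begin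
  A * S u (pw (s ∸ 1)) (Y w ds) N
    ≡⟨ cong (A *_) (S-bound (d ℕ.+ total ds) (pw (s ∸ 1)) (Y w ds) N≤K) ⟩
  A * ∑ K (λ v → pw (s ∸ 1) v * shift (u ℕ.* suc v) (Y w ds) N)
    ≡⟨ ∑-*ˡ K A _ ⟨
  ∑ K (λ v → A * (pw (s ∸ 1) v * shift (u ℕ.* suc v) (Y w ds) N))
    ≡⟨ ∑-cong K (λ v → trans (sym (ℚ.*-assoc A _ _)) (trans (cong (A * pw (s ∸ 1) v *_) (tail v)) (sym (box-*ˡ l K (A * pw (s ∸ 1) v) _)))) ⟩
  ∑ K (λ v → box l K (λ vs → A * pw (s ∸ 1) v * (monomial w ds vs * shift (u ℕ.* suc v ℕ.+ exponent ds vs) one N)))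
    ≡⟨ ∑-cong K (λ v → box-cong l K (λ vs → solve 3 (λ a m s → a :* (m :* s) := (m :* a) :* s) refl (A * pw (s ∸ 1) v) (monomial w ds vs) (shift (u ℕ.* suc v ℕ.+ exponent ds vs) one N))) ⟩
  box (suc l) K (λ vs → monomial ((s , α) ∷ w) (d ∷ ds) vs * shift (exponent (d ∷ ds) vs) one N) ∎
  where
  open ≡-Reasoning
  A = dp α (fromℕ (suc d))
  u = suc d ℕ.+ total ds
  shift-box : ∀ l k (c : Vec ℕ l → ℚ) (e : Vec ℕ l → ℕ) →
    shift k (λ n → box l K (λ vs → c vs * shift (e vs) one n)) N ≡ box l K (λ vs → c vs * shift (k ℕ.+ e vs) one N)
  shift-box zero k c e = trans (shift-*ˡ k (c []) (shift (e []) one) N) (cong (c [] *_) (shift-shift k (e []) one N))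
  shift-box (suc l) k c e = trans (shift-∑ k K (λ i n → box l K (λ vs → c (i ∷ vs) * shift (e (i ∷ vs)) one n)) N)
    (∑-cong K (λ i → shift-box l k (λ vs → c (i ∷ vs)) (λ vs → e (i ∷ vs))))
  tail : ∀ v → shift (u ℕ.* suc v) (Y w ds) N ≡ box l K (λ vs → monomial w ds vs * shift (u ℕ.* suc v ℕ.+ exponent ds vs) one N)
  tail v = trans (shift-cong≤ (u ℕ.* suc v) N (λ n n≤N → Y-box w ds (ℕ.≤-trans n≤N N≤K))) (shift-box l (u ℕ.* suc v) (monomial w ds) (exponent ds))

-- This is conjugation of partitions. With parts u_j of multiplicity v_j, the conjugate has parts
-- v_1 + ⋯ + v_j of multiplicity d_j, so the exponents α of d and s - 1 of v trade places and the
-- order is reversed.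
dual : ∀ {l} → Letters l → Letters l
dual [] = []
dual ((s , α) ∷ w) = dual w ▷ (suc α , s ∸ 1)

monomial-▷ : ∀ {l} (w : Letters l) s α ds d vs v →
  monomial (w ▷ (s , α)) (ds ▷ d) (vs ▷ v) ≡ monomial w ds vs * (dp α (fromℕ (suc d)) * dp (s ∸ 1) (fromℕ (suc v)))
monomial-▷ [] s α [] d [] v = refl
monomial-▷ ((s′ , α′) ∷ w) s α (d′ ∷ ds) d (v′ ∷ vs) v =
  trans (cong (_* (dp α′ (fromℕ (suc d′)) * dp (s′ ∸ 1) (fromℕ (suc v′)))) (monomial-▷ w s α ds d vs v))
    (solve 3 (λ a b c → a :* b :* c := a :* c :* b) refl (monomial w ds vs) _ _)

monomial-dual : ∀ {l} (w : Letters l) ds vs → monomial (dual w) (rev vs) (rev ds) ≡ monomial w ds vs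
monomial-dual [] [] [] = refl
monomial-dual ((s , α) ∷ w) (d ∷ ds) (v ∷ vs) = trans (monomial-▷ (dual w) (suc α) (s ∸ 1) (rev vs) v (rev ds) d)
  (cong₂ _*_ (monomial-dual w ds vs) (ℚ.*-comm (dp (s ∸ 1) (fromℕ (suc v))) (dp α (fromℕ (suc d)))))

total-▷ : ∀ {l} (ds : Vec ℕ l) d → total (ds ▷ d) ≡ total ds ℕ.+ suc d
total-▷ [] d = ℕ.+-identityʳ (suc d)
total-▷ (e ∷ ds) d = trans (cong (suc e ℕ.+_) (total-▷ ds d)) (sym (ℕ.+-assoc (suc e) (total ds) (suc d)))

total-rev : ∀ {l} (ds : Vec ℕ l) → total (rev ds) ≡ total ds
total-rev [] = refl
total-rev (d ∷ ds) = trans (total-▷ (rev ds) d) (trans (ℕ.+-comm (total (rev ds)) (suc d)) (cong (suc d ℕ.+_) (total-rev ds)))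

exponent-▷ : ∀ {l} (ds : Vec ℕ l) d vs v → exponent (ds ▷ d) (vs ▷ v) ≡ exponent ds vs ℕ.+ suc d ℕ.* (total vs ℕ.+ suc v)
exponent-▷ [] d [] v = trans (ℕ.+-identityʳ _) (cong (ℕ._* suc v) (ℕ.+-identityʳ (suc d)))
exponent-▷ (e ∷ ds) d (x ∷ vs) v = trans (cong₂ (λ a b → (suc e ℕ.+ a) ℕ.* suc x ℕ.+ b) (total-▷ ds d) (exponent-▷ ds d vs v))
  (arrange (suc e) (total ds) (suc d) (suc x) (exponent ds vs) (total vs) (suc v))
  where
  arrange : ∀ e t d x q r v → (e ℕ.+ (t ℕ.+ d)) ℕ.* x ℕ.+ (q ℕ.+ d ℕ.* (r ℕ.+ v)) ≡ (e ℕ.+ t) ℕ.* x ℕ.+ q ℕ.+ d ℕ.* (x ℕ.+ r ℕ.+ v)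
  arrange = solve-∀

-- The exponent Σ_{j ≤ i} d_i v_j is symmetric under reversing and exchanging d and v.
exponent-rev : ∀ {l} (ds vs : Vec ℕ l) → exponent (rev vs) (rev ds) ≡ exponent ds vs
exponent-rev [] [] = refl
exponent-rev (d ∷ ds) (v ∷ vs) = trans (exponent-▷ (rev vs) v (rev ds) d)
  (trans (cong₂ (λ a b → a ℕ.+ suc v ℕ.* (b ℕ.+ suc d)) (exponent-rev ds vs) (total-rev ds)) (arrange (exponent ds vs) (suc v) (total ds) (suc d)))
  where
  arrange : ∀ q v t d → q ℕ.+ v ℕ.* (t ℕ.+ d) ≡ (d ℕ.+ t) ℕ.* v ℕ.+ q
  arrange = solve-∀

Z-box : ∀ {l} (w : Letters l) N → ∑ (suc N) (λ u → Z w u N) ≡ box l N (λ ds → box l N (λ vs → monomial w ds vs * shift (exponent ds vs) one N))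
Z-box {l} w N = trans (sym (box-Y w N)) (box-cong l N (λ ds → Y-box w ds ℕ.≤-refl))

Z-dual : ∀ {l} (w : Letters l) N → ∑ (suc N) (λ u → Z (dual w) u N) ≡ ∑ (suc N) (λ u → Z w u N)
Z-dual {l} w N = begin
  ∑ (suc N) (λ u → Z (dual w) u N)                        ≡⟨ Z-box (dual w) N ⟩
  box l N (λ vs → box l N (λ ds → f (dual w) vs ds))       ≡⟨ box-rev l N (λ vs → box l N (λ ds → f (dual w) vs ds)) ⟨
  box l N (λ vs → box l N (λ ds → f (dual w) (rev vs) ds)) ≡⟨ box-cong l N (λ vs → box-rev l N (f (dual w) (rev vs))) ⟨
  box l N (λ vs → box l N (λ ds → f (dual w) (rev vs) (rev ds)))
    ≡⟨ box-cong l N (λ vs → box-cong l N (λ ds → cong₂ (λ m e → m * shift e one N) (monomial-dual w ds vs) (exponent-rev ds vs))) ⟩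
  box l N (λ vs → box l N (λ ds → f w ds vs))             ≡⟨ box-swap l l N (λ vs ds → f w ds vs) ⟩
  box l N (λ ds → box l N (λ vs → f w ds vs))             ≡⟨ Z-box w N ⟨
  ∑ (suc N) (λ u → Z w u N) ∎
  where
  open ≡-Reasoning
  f : Letters l → Vec ℕ l → Vec ℕ l → ℚ
  f w ds vs = monomial w ds vs * shift (exponent ds vs) one N

τ : BiIndex → BiIndex
τ [] = []
τ ((s , α) ∷ w) = τ w ++ ((suc α , s ∸ 1) ∷ [])

toList-▷ : ∀ {A : Set} {l} (xs : Vec A l) x → toList (xs ▷ x) ≡ toList xs ++ (x ∷ [])
toList-▷ [] x = refl
toList-▷ (y ∷ xs) x = cong (y ∷_) (toList-▷ xs x)

toList-dual : ∀ {l} (w : Letters l) → toList (dual w) ≡ τ (toList w)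
toList-dual [] = refl
toList-dual ((s , α) ∷ w) = trans (toList-▷ (dual w) (suc α , s ∸ 1)) (cong (_++ ((suc α , s ∸ 1) ∷ [])) (toList-dual w))

duality : BiIndex → LC BiIndex
duality w = expand 0 w ++ scale (ℤ.- (+ 1)) (expand 0 (τ w))

duality-relation : ∀ w N → evZ biBracket (duality w) N ≡ 0ℚ
duality-relation w N = begin
  evZ biBracket (duality w) N
    ≡⟨ trans (evZ-++ biBracket (expand 0 w) _ N) (cong (_+_ (evZ biBracket (expand 0 w) N)) (evZ-scale biBracket (ℤ.- (+ 1)) (expand 0 (τ w)) N)) ⟩
  evZ biBracket (expand 0 w) N + (- 1ℚ) * evZ biBracket (expand 0 (τ w)) N
    ≡⟨ cong₂ (λ x y → x + (- 1ℚ) * y) (side w) (trans (cong (λ v → evZ biBracket (expand 0 v) N) τ≡) (trans (expand-biBracket (dual (fromList w)) N) (Z-dual (fromList w) N))) ⟩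
  X + (- 1ℚ) * X
    ≡⟨ solve 1 (λ x → x :+ (:- con 1ℚ) :* x := con 0ℚ) refl X ⟩
  0ℚ ∎
  where
  open ≡-Reasoning
  X = ∑ (suc N) (λ u → Z (fromList w) u N)
  side : ∀ w → evZ biBracket (expand 0 w) N ≡ ∑ (suc N) (λ u → Z (fromList w) u N)
  side w = trans (cong (λ v → evZ biBracket (expand 0 v) N) (sym (Vec.toList∘fromList w))) (expand-biBracket (fromList w) N)
  τ≡ : τ w ≡ toList (dual (fromList w))
  τ≡ = trans (cong τ (sym (Vec.toList∘fromList w))) (sym (toList-dual (fromList w)))

weight-++ : ∀ w v → weight (w ++ v) ≡ weight w ℕ.+ weight v
weight-++ [] v = refl
weight-++ ((s , r) ∷ w) v = trans (cong (s ℕ.+ r ℕ.+_) (weight-++ w v)) (sym (ℕ.+-assoc (s ℕ.+ r) (weight w) (weight v)))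

τ-homogeneous : ∀ w → ValidBi w → Homogeneous (weight w) (τ w)
τ-homogeneous [] [] = [] , refl
τ-homogeneous ((suc a , α) ∷ w) (_ ∷ h) with τ-homogeneous w h
... | v , e = All.++⁺ v (s≤s z≤n ∷ []) , trans (weight-++ (τ w) _) (trans (cong (ℕ._+ _) e) (arrange (weight w) a α))
  where
  arrange : ∀ w a α → w ℕ.+ (suc α ℕ.+ a ℕ.+ 0) ≡ suc a ℕ.+ α ℕ.+ w
  arrange = solve-∀

duality-homogeneous : ∀ w → ValidBi w → HomogeneousLC (weight w) (duality w)
duality-homogeneous w h with τ-homogeneous w h
... | v , e = All.++⁺ (expand-homogeneous 0 w h) (scale-homogeneous (ℤ.- (+ 1)) _ (subst (λ n → HomogeneousLC n (expand 0 (τ w))) e (expand-homogeneous 0 (τ w) v)))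

-- Sparse fraction-free Gaussian elimination

≡ᵇ-sound : ∀ m n → (m ≡ᵇ n) ≡ true → m ≡ n
≡ᵇ-sound m n e = ℕ.≡ᵇ⇒≡ m n (subst T (sym e) tt)

if-case : {A : Set} (P : A → Set) (b : Bool) {x y : A} → (b ≡ true → P x) → (b ≡ false → P y) → P (if b then x else y)
if-case P true t f = t refl
if-case P false t f = f refl

-- Variables occur in decreasing order.
Row : Set
Row = LC ℕ

cons : ℤ → ℕ → Row → Row
cons (+ 0) x r = r
cons c x r = (c , x) ∷ r

combine : ℤ → Row → ℤ → Row → Row
combine a [] b [] = []
combine a [] b ((d , y) ∷ ys) = (b ℤ.* d , y) ∷ combine a [] b ys
combine a ((c , x) ∷ xs) b [] = (a ℤ.* c , x) ∷ combine a xs b []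
combine a ((c , x) ∷ xs) b ((d , y) ∷ ys) =
  if x ≡ᵇ y then cons (a ℤ.* c ℤ.+ b ℤ.* d) x (combine a xs b ys)
  else if y <ᵇ x then (a ℤ.* c , x) ∷ combine a xs b ((d , y) ∷ ys)
  else (b ℤ.* d , y) ∷ combine a ((c , x) ∷ xs) b ys

-- Neither this value nor its fuel has to be trusted: `divideBy` divides only after `divides` has
-- confirmed that the division is exact.
gcd′ : ℕ → ℕ → ℕ → ℕ
gcd′ zero a b = 1
gcd′ (suc fuel) a zero = a
gcd′ (suc fuel) a (suc b) = gcd′ fuel (suc b) (a % suc b)

content : ℕ → Row → ℕ
content g [] = g
content 1 _ = 1
content g ((c , _) ∷ r) = content (gcd′ 10000 ℤ.∣ c ∣ g) r

quotient : ℤ → ℕ → ℤ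
quotient c zero = c
quotient (+ n) (suc g) = + (n div suc g)
quotient -[1+ n ] (suc g) = ℤ.- (+ (suc n div suc g))

equal : ℤ → ℤ → Bool
equal (+ a) (+ b) = a ≡ᵇ b
equal -[1+ a ] -[1+ b ] = a ≡ᵇ b
equal _ _ = false

divideRow : ℕ → Row → Row
divideRow g = map (λ p → quotient (proj₁ p) g , proj₂ p)

divides : ℕ → Row → Bool
divides g [] = true
divides g ((c , _) ∷ r) = equal (+ g ℤ.* quotient c g) c ∧ divides g r

divideBy : ℕ → Row → Row
divideBy 0 r = r
divideBy 1 r = r
divideBy g@(suc (suc _)) r = if divides g r then divideRow g r else r

after : {A : Set} → Row → A → A
after [] a = a
after ((+ zero , _) ∷ r) a = after r a
after ((+ suc _ , _) ∷ r) a = after r a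
after ((-[1+ _ ] , _) ∷ r) a = after r a

-- The identity, but evaluating all coefficients: unevaluated rows would keep all earlier rows in memory.
force : Row → Row
force r = after r r

after-id : {A : Set} (r : Row) (a : A) → after r a ≡ a
after-id [] a = refl
after-id ((+ zero , _) ∷ r) a = after-id r a
after-id ((+ suc _ , _) ∷ r) a = after-id r a
after-id ((-[1+ _ ] , _) ∷ r) a = after-id r a

primitive-part : Row → Row
primitive-part r = force (divideBy (content 0 r) r)

-- A search tree of pivot rows: `node l c x r t` holds the row with leading entry c at x and tail r.
-- Its ordering is not proved; a misplaced node could only make a reduction be missed.
data Tree : Set where
  leaf : Tree
  node : Tree → ℤ → ℕ → Row → Tree → Tree

find : ℕ → Tree → Maybe (ℤ × Row)
find x leaf = nothing
find x (node l c y r t) = if x ≡ᵇ y then just (c , r) else (if x <ᵇ y then find x l else find x t)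

insert : ℤ → ℕ → Row → Tree → Tree
insert c x r leaf = node leaf c x r leaf
insert c x r (node a d y s b) = if x <ᵇ y then node (insert c x r a) d y s b else node a d y s (insert c x r b)

-- The row c x + r and the pivot row p x + q combine to p r - c q, where x has cancelled, so only
-- tails are merged. When the fuel runs out, the row returned is still a relation.
reduce : ℕ → Tree → Row → Row
reduce zero t r = r
reduce (suc fuel) t [] = []
reduce (suc fuel) t ((c , x) ∷ r) with find x t
... | nothing = (c , x) ∷ r
... | just (p , q) = reduce fuel t (primitive-part (combine p r (ℤ.- c) q))

addRow : Row → Tree → Tree
addRow r t with reduce 1000 t r
... | [] = t
... | (c , x) ∷ s = insert c x s t

eliminate : List Row → Tree → Tree
eliminate [] t = t
eliminate (r ∷ rs) t = eliminate rs (addRow r t)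

-- One merging pass, meant for two lists in decreasing order. On other input it may answer `false`
-- too often, which is harmless.
covers : List ℕ → Row → Bool
covers _ [] = true
covers [] (_ ∷ _) = false
covers (k ∷ ks) ((c , x) ∷ r) = if x ≡ᵇ k then covers ks r else covers ks ((c , x) ∷ r)

learn : ℤ → ℕ → Row → List ℕ → List ℕ
learn (+ 0) x r ks = ks
learn c x r ks = if covers ks r then x ∷ ks else ks

-- Pivots are visited in increasing order, so that the variables in the tail of a row have been treated before its pivot.
known : Tree → List ℕ → List ℕ
known leaf ks = ks
known (node l c x r t) ks = known t (learn c x r (known l ks))

member : ℕ → List ℕ → Bool
member x [] = false
member x (k ∷ ks) = if x ≡ᵇ k then true else member x ks

members : List ℕ → List ℕ → Bool
members [] ks = true
members (x ∷ xs) ks = if member x ks then members xs ks else false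

solves : List Row → List ℕ → Bool
solves rs xs = members xs (known (eliminate rs leaf) [])

-- Soundness of the elimination for an arbitrary linear subspace

module _ {X : Set} {S : (X → ℚ) → Set} (closed : Closed S) (val : ℕ → X → ℚ) where
  open Closed closed

  evZ-cons : ∀ c x r y → evZ val (cons c x r) y ≡ fromℤ c * val x y + evZ val r y
  evZ-cons (+ 0) x r y = sym (trans (cong (_+ evZ val r y) (ℚ.*-zeroˡ (val x y))) (ℚ.+-identityˡ _))
  evZ-cons (+ suc _) x r y = refl
  evZ-cons -[1+ _ ] x r y = refl

  evZ-combine : ∀ a r b q y → evZ val (combine a r b q) y ≡ fromℤ a * evZ val r y + fromℤ b * evZ val q y
  evZ-combine a [] b [] y = solve 2 (λ a b → con 0ℚ := a :* con 0ℚ :+ b :* con 0ℚ) refl (fromℤ a) (fromℤ b)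
  evZ-combine a [] b ((d , v) ∷ q) y = trans (cong₂ _+_ (cong (_* val v y) (fromℤ-* b d)) (evZ-combine a [] b q y))
    (solve 5 (λ a b d v q → b :* d :* v :+ (a :* con 0ℚ :+ b :* q) := a :* con 0ℚ :+ b :* (d :* v :+ q)) refl (fromℤ a) (fromℤ b) (fromℤ d) (val v y) (evZ val q y))
  evZ-combine a ((c , x) ∷ r) b [] y = trans (cong₂ _+_ (cong (_* val x y) (fromℤ-* a c)) (evZ-combine a r b [] y))
    (solve 5 (λ a b c v r → a :* c :* v :+ (a :* r :+ b :* con 0ℚ) := a :* (c :* v :+ r) :+ b :* con 0ℚ) refl (fromℤ a) (fromℤ b) (fromℤ c) (val x y) (evZ val r y))
  evZ-combine a R@((c , x) ∷ r) b Q@((d , v) ∷ q) y = if-case P (x ≡ᵇ v) (same (evZ-combine a r b q y))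
    (λ _ → if-case P (v <ᵇ x) (left (evZ-combine a r b Q y)) (right (evZ-combine a R b q y)))
    where
    P : Row → Set
    P s = evZ val s y ≡ fromℤ a * evZ val R y + fromℤ b * evZ val Q y
    same : evZ val (combine a r b q) y ≡ fromℤ a * evZ val r y + fromℤ b * evZ val q y → (x ≡ᵇ v) ≡ true → P (cons (a ℤ.* c ℤ.+ b ℤ.* d) x (combine a r b q))
    same ih e = trans (evZ-cons (a ℤ.* c ℤ.+ b ℤ.* d) x (combine a r b q) y)
      (trans (cong₂ _+_ (cong (_* val x y) (trans (fromℤ-+ (a ℤ.* c) (b ℤ.* d)) (cong₂ _+_ (fromℤ-* a c) (fromℤ-* b d)))) ih)
      (trans (solve 7 (λ a b c d v r q → (a :* c :+ b :* d) :* v :+ (a :* r :+ b :* q) := a :* (c :* v :+ r) :+ b :* (d :* v :+ q)) refl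
        (fromℤ a) (fromℤ b) (fromℤ c) (fromℤ d) (val x y) (evZ val r y) (evZ val q y))
        (cong (λ z → fromℤ a * evZ val R y + fromℤ b * (fromℤ d * val z y + evZ val q y)) (≡ᵇ-sound x v e))))
    left : evZ val (combine a r b Q) y ≡ fromℤ a * evZ val r y + fromℤ b * evZ val Q y → (v <ᵇ x) ≡ true → P ((a ℤ.* c , x) ∷ combine a r b Q)
    left ih _ = trans (cong₂ _+_ (cong (_* val x y) (fromℤ-* a c)) ih)
      (solve 6 (λ a b c v r q → a :* c :* v :+ (a :* r :+ b :* q) := a :* (c :* v :+ r) :+ b :* q) refl
        (fromℤ a) (fromℤ b) (fromℤ c) (val x y) (evZ val r y) (evZ val Q y))
    right : evZ val (combine a R b q) y ≡ fromℤ a * evZ val R y + fromℤ b * evZ val q y → (v <ᵇ x) ≡ false → P ((b ℤ.* d , v) ∷ combine a R b q)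
    right ih _ = trans (cong₂ _+_ (cong (_* val v y) (fromℤ-* b d)) ih)
      (solve 6 (λ a b d v r q → b :* d :* v :+ (a :* r :+ b :* q) := a :* r :+ b :* (d :* v :+ q)) refl
        (fromℤ a) (fromℤ b) (fromℤ d) (val v y) (evZ val R y) (evZ val q y))

  Holds : Row → Set
  Holds r = S (evZ val r)

  equal-sound : ∀ i j → equal i j ≡ true → i ≡ j
  equal-sound (+ a) (+ b) e = cong +_ (≡ᵇ-sound a b e)
  equal-sound -[1+ a ] -[1+ b ] e = cong -[1+_] (≡ᵇ-sound a b e)

  evZ-divideRow : ∀ g r → divides g r ≡ true → ∀ y → evZ val r y ≡ fromℕ g * evZ val (divideRow g r) y
  evZ-divideRow g [] e y = sym (ℚ.*-zeroʳ (fromℕ g))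
  evZ-divideRow g ((c , x) ∷ r) e y with equal (+ g ℤ.* quotient c g) c in e′
  ... | true = trans (cong₂ _+_ (cong (_* val x y) (trans (cong fromℤ (sym (equal-sound (+ g ℤ.* quotient c g) c e′))) (fromℤ-* (+ g) (quotient c g)))) (evZ-divideRow g r e y))
    (solve 4 (λ g q v r → g :* q :* v :+ g :* r := g :* (q :* v :+ r)) refl (fromℕ g) (fromℤ (quotient c g)) (val x y) (evZ val (divideRow g r) y))

  cancel-scalar : ∀ {c f} → c ≢ 0ℚ → S (λ y → c * f y) → S f
  cancel-scalar {c} {f} c≢0 s with inverse c≢0
  ... | d , dc = ext (λ y → trans (sym (ℚ.*-identityˡ (f y))) (trans (cong (_* f y) (sym dc)) (ℚ.*-assoc d c (f y)))) (mult d s)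

  divideBy-holds : ∀ g r → Holds r → Holds (divideBy g r)
  divideBy-holds 0 r h = h
  divideBy-holds 1 r h = h
  divideBy-holds g@(suc (suc k)) r h with divides g r in e
  ... | true = cancel-scalar (fromℕ-suc≢0 (suc k)) (ext (λ y → sym (evZ-divideRow g r e y)) h)
  ... | false = h

  Pivot : ℤ → ℕ → Row → Set
  Pivot c x r = S (λ y → fromℤ c * val x y + evZ val r y)

  data Sound : Tree → Set where
    leaf : Sound leaf
    node : ∀ {l c x r t} → Sound l → Pivot c x r → Sound t → Sound (node l c x r t)

  find-sound : ∀ x t → Sound t → ∀ {p q} → find x t ≡ just (p , q) → Pivot p x q
  find-sound x (node l c y r t) (node sl p st) e with x ≡ᵇ y in e₁
  find-sound x (node l c y r t) (node sl p st) refl | true = subst (λ z → Pivot c z r) (sym (≡ᵇ-sound x y e₁)) p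
  find-sound x (node l c y r t) (node sl p st) e | false with x <ᵇ y
  ... | true = find-sound x l sl e
  ... | false = find-sound x t st e

  insert-sound : ∀ c x r t → Pivot c x r → Sound t → Sound (insert c x r t)
  insert-sound c x r leaf p st = node leaf p leaf
  insert-sound c x r (node a d y s b) p (node sa q sb) with x <ᵇ y
  ... | true = node (insert-sound c x r a p sa) q sb
  ... | false = node sa q (insert-sound c x r b p sb)

  reduce-holds : ∀ fuel t r → Sound t → Holds r → Holds (reduce fuel t r)
  reduce-holds zero t r st h = h
  reduce-holds (suc fuel) t [] st h = h
  reduce-holds (suc fuel) t ((c , x) ∷ r) st h with find x t in e
  ... | nothing = h
  ... | just (p , q) = reduce-holds fuel t _ st (subst Holds (sym (after-id (divideBy (content 0 s) s) _)) (divideBy-holds (content 0 s) s (ext (λ y → trans (evZ-combine p r (ℤ.- c) q y)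
      (trans (cong (λ z → fromℤ p * evZ val r y + z * evZ val q y) (fromℤ-neg c))
        (solve 5 (λ p c v r q → p :* r :+ (:- c) :* q := p :* (c :* v :+ r) :+ (:- c) :* (p :* v :+ q)) refl (fromℤ p) (fromℤ c) (val x y) (evZ val r y) (evZ val q y))))
      (plus (mult (fromℤ p) h) (mult (- fromℤ c) (find-sound x t st e))))))
    where s = combine p r (ℤ.- c) q

  addRow-sound : ∀ r t → Holds r → Sound t → Sound (addRow r t)
  addRow-sound r t h st with reduce 1000 t r | reduce-holds 1000 t r st h
  ... | [] | _ = st
  ... | (c , x) ∷ s | h′ = insert-sound c x s t h′ st

  eliminate-sound : ∀ rs t → All Holds rs → Sound t → Sound (eliminate rs t)
  eliminate-sound [] t [] st = st
  eliminate-sound (r ∷ rs) t (h ∷ hs) st = eliminate-sound rs (addRow r t) hs (addRow-sound r t h st)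

  Vanish : List ℕ → Set
  Vanish = All (λ x → S (val x))

  covers-holds : ∀ ks r → Vanish ks → covers ks r ≡ true → Holds r
  covers-holds ks [] v e = nil
  covers-holds (k ∷ ks) ((c , x) ∷ r) (v ∷ vs) e with x ≡ᵇ k in e′
  ... | true = plus (mult (fromℤ c) (subst (λ z → S (val z)) (sym (≡ᵇ-sound x k e′)) v)) (covers-holds ks r vs e)
  ... | false = covers-holds ks ((c , x) ∷ r) vs e

  pivot-vanishes : ∀ {c x r} → c ≢ + 0 → Pivot c x r → Holds r → S (val x)
  pivot-vanishes {c} {x} {r} c≢0 p h = cancel-scalar (fromℤ≢0 c≢0)
    (ext (λ y → solve 2 (λ a b → a := (a :+ b) :- b) refl (fromℤ c * val x y) (evZ val r y)) (minus p h))

  learn-vanish : ∀ c x r ks → Pivot c x r → Vanish ks → Vanish (learn c x r ks)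
  learn-vanish (+ 0) x r ks p v = v
  learn-vanish (+ suc n) x r ks p v with covers ks r in e
  ... | true = pivot-vanishes {+ suc n} {x} {r} (λ ()) p (covers-holds ks r v e) ∷ v
  ... | false = v
  learn-vanish -[1+ n ] x r ks p v with covers ks r in e
  ... | true = pivot-vanishes { -[1+ n ]} {x} {r} (λ ()) p (covers-holds ks r v e) ∷ v
  ... | false = v

  known-vanish : ∀ t ks → Sound t → Vanish ks → Vanish (known t ks)
  known-vanish leaf ks st v = v
  known-vanish (node l c x r t) ks (node sl p st) v = known-vanish t _ st (learn-vanish c x r (known l ks) p (known-vanish l ks sl v))

  member-vanish : ∀ x ks → Vanish ks → member x ks ≡ true → S (val x)
  member-vanish x (k ∷ ks) (v ∷ vs) e with x ≡ᵇ k in e′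
  ... | true = subst (λ z → S (val z)) (sym (≡ᵇ-sound x k e′)) v
  ... | false = member-vanish x ks vs e

  members-vanish : ∀ xs ks → Vanish ks → members xs ks ≡ true → Vanish xs
  members-vanish [] ks v e = []
  members-vanish (x ∷ xs) ks v e with member x ks in e′
  ... | true = member-vanish x ks v e′ ∷ members-vanish xs ks v e

  solves-sound : ∀ rs xs → All Holds rs → solves rs xs ≡ true → Vanish xs
  solves-sound rs xs h = members-vanish xs _ (known-vanish (eliminate rs leaf) [] (eliminate-sound rs leaf h leaf) [])

-- Enumeration of the valid bi-indices of given weight

-- The first letter has weight i + 1 = s + r with r ≤ i, which forces s ≥ 1. The fuel makes the
-- recursion at `k ∸ i` structural.
words′ : ℕ → ℕ → List BiIndex
words′ fuel zero = [] ∷ []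
words′ zero (suc k) = []
words′ (suc fuel) (suc k) = concatMap (λ i → concatMap (λ r → map ((suc i ∸ r , r) ∷_) (words′ fuel (k ∸ i))) (upTo (suc i))) (upTo (suc k))

words : ℕ → List BiIndex
words k = words′ k k

All-concatMap : ∀ {A B : Set} {P : B → Set} (f : A → List B) {xs} → All (λ x → All P (f x)) xs → All P (concatMap f xs)
All-concatMap f h = All.concat⁺ (All.map⁺ h)

All-upTo : ∀ {P : ℕ → Set} n → (∀ i → i < n → P i) → All P (upTo n)
All-upTo n h = All.applyUpTo⁺₁ (λ i → i) n (λ {i} → h i)

∈-concatMap : ∀ {A B : Set} (f : A → List B) {x y xs} → x ∈ xs → y ∈ f x → y ∈ concatMap f xs
∈-concatMap f x∈ y∈ = ∈-concat⁺′ y∈ (∈-map⁺ f x∈)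

words′-homogeneous : ∀ fuel k → All (Homogeneous k) (words′ fuel k)
words′-homogeneous fuel zero = ([] , refl) ∷ []
words′-homogeneous zero (suc k) = []
words′-homogeneous (suc fuel) (suc k) = All-concatMap _ (All-upTo (suc k) λ i i≤k → All-concatMap _ (All-upTo (suc i) λ r r≤i →
  All.map⁺ (All.map (λ { (v , e) → ℕ.m<n⇒0<n∸m r≤i ∷ v ,
    trans (cong₂ ℕ._+_ (ℕ.m∸n+n≡m (ℕ.<⇒≤ r≤i)) e) (cong suc (ℕ.m+[n∸m]≡n (ℕ.≤-pred i≤k))) }) (words′-homogeneous fuel (k ∸ i)))))

words′-complete : ∀ fuel k → k ≤ fuel → ∀ w → Homogeneous k w → w ∈ words′ fuel k
words′-complete fuel zero k≤ [] h = here refl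
words′-complete fuel zero k≤ ((suc a , r) ∷ w) (v , ())
words′-complete fuel zero k≤ ((zero , r) ∷ w) (() ∷ v , _)
words′-complete (suc fuel) (suc k) (s≤s k≤) ((suc a , r) ∷ w) (_ ∷ v , e) =
  ∈-concatMap _ (∈-upTo⁺ (s≤s i≤k)) (∈-concatMap (λ t → map ((suc (a ℕ.+ r) ∸ t , t) ∷_) (words′ fuel (k ∸ (a ℕ.+ r)))) (∈-upTo⁺ (s≤s (ℕ.m≤n+m r a)))
    (subst (λ s → (suc a , r) ∷ w ∈ map ((s , r) ∷_) (words′ fuel (k ∸ (a ℕ.+ r)))) (sym (ℕ.m+n∸n≡m (suc a) r))
      (∈-map⁺ ((suc a , r) ∷_) (words′-complete fuel (k ∸ (a ℕ.+ r)) (ℕ.≤-trans (ℕ.m∸n≤m k (a ℕ.+ r)) k≤) w (v , weight-w)))))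
  where
  e′ : a ℕ.+ r ℕ.+ weight w ≡ k
  e′ = ℕ.suc-injective e
  i≤k : a ℕ.+ r ≤ k
  i≤k = subst (a ℕ.+ r ≤_) e′ (ℕ.m≤m+n (a ℕ.+ r) (weight w))
  weight-w : weight w ≡ k ∸ (a ℕ.+ r)
  weight-w = trans (sym (ℕ.m+n∸m≡n (a ℕ.+ r) (weight w))) (cong (_∸ (a ℕ.+ r)) e′)

-- Bases of the graded pieces

_≟ʷ_ : DecidableEquality BiIndex
_≟ʷ_ = List.≡-dec (Product.≡-dec ℕ._≟_ ℕ._≟_)

is123 : BiIndex → Bool
is123 [] = true
is123 ((s , r) ∷ w) = if s ≤ᵇ 3 then (if r ≡ᵇ 0 then is123 w else false) else false

-- Found by elimination: these brackets are combinations of the other 123-brackets of weight ≤ 7.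
dependent : List BiIndex
dependent = map (map (_, 0)) ((3 ∷ 1 ∷ 1 ∷ 1 ∷ []) ∷ (2 ∷ 2 ∷ 1 ∷ 1 ∷ 1 ∷ []) ∷ (3 ∷ 1 ∷ 1 ∷ 1 ∷ 1 ∷ []) ∷ (3 ∷ 2 ∷ 1 ∷ 1 ∷ []) ∷ [])

elem : BiIndex → List BiIndex → Bool
elem w [] = false
elem w (v ∷ vs) = if does (w ≟ʷ v) then true else elem w vs

basis : ℕ → List BiIndex
basis k = filterᵇ (λ w → if elem w dependent then false else is123 w) (words k)

All-filterᵇ : ∀ {A : Set} {P : A → Set} (p : A → Bool) {xs} → All P xs → All (λ x → P x × p x ≡ true) (filterᵇ p xs)
All-filterᵇ p [] = []
All-filterᵇ p (_∷_ {x} h hs) with p x in e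
... | true = (h , e) ∷ All-filterᵇ p hs
... | false = All-filterᵇ p hs

basis-homogeneous : ∀ k → All (λ w → Homogeneous k w × is123 w ≡ true) (basis k)
basis-homogeneous k = All.map (λ {w} (h , e) → h , second (elem w dependent) e) (All-filterᵇ _ (words′-homogeneous k k))
  where
  second : ∀ b {c : Bool} → (if b then false else c) ≡ true → c ≡ true
  second false e = e

-- Bi-indices as numbers: non-123-brackets are largest and get eliminated first.

code : ℕ → BiIndex → ℕ
code n [] = n
code n ((s , r) ∷ w) = code (n ℕ.* 64 ℕ.+ (r ℕ.* 8 ℕ.+ s)) w

order : BiIndex → ℕ
order w = foldr (λ l n → proj₂ l ℕ.+ n) (if is123 w then 0 else 8) w

encode : BiIndex → ℕ
encode w = order w ℕ.* 64 ^ 7 ℕ.+ code 0 w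

-- The constant is 64^7, so the remainder discards `order`. In weight at most 7 there are at most
-- seven letters, with r and s below 8, hence base 64 digits 8 r + s; they are nonzero since s ≥ 1,
-- so 0 marks the end.
decode : ℕ → BiIndex
decode n = go 8 (n % 4398046511104) []
  where
  go : ℕ → ℕ → BiIndex → BiIndex
  go zero n w = w
  go (suc fuel) n w = if n ≡ᵇ 0 then w else go fuel (n div 64) ((n % 8 , (n div 8) % 8) ∷ w)

-- The encoding is not proved injective; the round trip is tested on every bi-index that occurs. If
-- a test fails, `toRow` falls back to the empty row, the trivial relation.
codable : BiIndex → Bool
codable w = does (decode (encode w) ≟ʷ w)

codable-sound : ∀ w → codable w ≡ true → decode (encode w) ≡ w
codable-sound w e with decode (encode w) ≟ʷ w
... | yes p = p

all-codable : List BiIndex → Bool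
all-codable [] = true
all-codable (w ∷ ws) = if codable w then all-codable ws else false

all-codable-sound : ∀ ws → all-codable ws ≡ true → All (λ w → decode (encode w) ≡ w) ws
all-codable-sound [] e = []
all-codable-sound (w ∷ ws) e with codable w in e′
... | true = codable-sound w e′ ∷ all-codable-sound ws e

pairwise : List Row → List Row
pairwise [] = []
pairwise (a ∷ []) = a ∷ []
pairwise (a ∷ b ∷ rs) = combine (+ 1) a (+ 1) b ∷ pairwise rs

-- Balanced summation as in merge sort: starting from singletons it sorts the variables and collects
-- equal ones.
sumRows : ℕ → List Row → Row
sumRows (suc fuel) rs@(_ ∷ _ ∷ _) = sumRows fuel (pairwise rs)
sumRows _ rs = foldr (λ a b → combine (+ 1) a (+ 1) b) [] rs

toRow : LC BiIndex → Row
toRow L = if all-codable (map proj₂ L) then sumRows 32 (map (λ p → (proj₁ p , encode (proj₂ p)) ∷ []) L) else []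

decoded : ℕ → Series
decoded n = biBracket (decode n)

evRows : List Row → Series
evRows rs N = foldr (λ r acc → evZ decoded r N + acc) 0ℚ rs

evZ-combine₁ : ∀ a b N → evZ decoded (combine (+ 1) a (+ 1) b) N ≡ evZ decoded a N + evZ decoded b N
evZ-combine₁ a b N = trans (evZ-combine (span-closed {gen = biBracket} {λ _ → ⊥}) decoded (+ 1) a (+ 1) b N) (cong₂ _+_ (ℚ.*-identityˡ (evZ decoded a N)) (ℚ.*-identityˡ (evZ decoded b N)))

evRows-pairwise : ∀ rs N → evRows (pairwise rs) N ≡ evRows rs N
evRows-pairwise [] N = refl
evRows-pairwise (a ∷ []) N = refl
evRows-pairwise (a ∷ b ∷ rs) N = trans (cong₂ _+_ (evZ-combine₁ a b N) (evRows-pairwise rs N)) (ℚ.+-assoc (evZ decoded a N) (evZ decoded b N) _)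

evZ-sumRows : ∀ fuel rs N → evZ decoded (sumRows fuel rs) N ≡ evRows rs N
evZ-sumRows zero rs N = plain rs
  where
  plain : ∀ rs → evZ decoded (foldr (λ a b → combine (+ 1) a (+ 1) b) [] rs) N ≡ evRows rs N
  plain [] = refl
  plain (a ∷ rs) = trans (evZ-combine₁ a _ N) (cong (_+_ (evZ decoded a N)) (plain rs))
evZ-sumRows (suc fuel) [] N = refl
evZ-sumRows (suc fuel) (a ∷ []) N = trans (evZ-combine₁ a [] N) refl
evZ-sumRows (suc fuel) rs@(_ ∷ _ ∷ _) N = trans (evZ-sumRows fuel (pairwise rs) N) (evRows-pairwise rs N)

module _ {S : Series → Set} (closed : Closed S) where

  toRow-holds : ∀ L → S (evZ biBracket L) → S (evZ decoded (toRow L))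
  toRow-holds L h with all-codable (map proj₂ L) in e
  ... | false = Closed.nil closed
  ... | true = Closed.ext closed (λ N → trans (evZ-sumRows 32 (map (λ p → (proj₁ p , encode (proj₂ p)) ∷ []) L) N) (singles L (All.map⁻ (all-codable-sound (map proj₂ L) e)) N)) h
    where
    singles : ∀ L → All (λ p → decode (encode (proj₂ p)) ≡ proj₂ p) L → ∀ N → evRows (map (λ p → (proj₁ p , encode (proj₂ p)) ∷ []) L) N ≡ evZ biBracket L N
    singles [] [] N = refl
    singles ((c , w) ∷ L) (p ∷ ps) N = cong₂ _+_ (trans (ℚ.+-identityʳ _) (cong (λ v → fromℤ c * biBracket v N) p)) (singles L ps N)

-- Products of duality relations with bi-brackets of weight at most 3 suffice in weights up to 7.
relation : BiIndex → BiIndex → List (LC BiIndex)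
relation v g = if encode g <ᵇ encode (τ g) then stuffleLC (duality g) v ∷ [] else []

-- The basis enters as one-variable rows, so that elimination works modulo its span. The factor `v`
-- has weight j ≤ 3, and j = 0 gives plain duality. As `τ` is an involution on valid words and `g`,
-- `τ g` yield opposite relations, `relation` keeps one of each pair.
relations : ℕ → List (LC BiIndex)
relations k = map (λ w → (+ 1 , w) ∷ []) (basis k) ++
  concatMap (λ j → concatMap (λ v → concatMap (relation v) (words (k ∸ j))) (words j)) (upTo (4 ℕ.⊓ k))

-- The subspace for the elimination: a bi-bracket found to vanish modulo it is one that reduces to
-- the basis and lower weight.
Reduced : ℕ → Series → Set
Reduced k = Span biBracket (λ w → w ∈ basis k ⊎ Lower k w)

relation-holds : ∀ k v g → ValidBi v → ValidBi g → weight g ℕ.+ weight v ≡ k → All (λ L → Reduced k (evZ biBracket L)) (relation v g)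
relation-holds k v g hv hg refl with encode g <ᵇ encode (τ g)
... | true = span-mono inj₂ (stuffleLC-relation (duality g) (duality-homogeneous g hg) hv (duality-relation g)) ∷ []
... | false = []

∈-All : ∀ {A : Set} (xs : List A) → All (_∈ xs) xs
∈-All xs = All.tabulate (λ x∈ → x∈)

relations-hold : ∀ k → All (λ L → Reduced k (evZ biBracket L)) (relations k)
relations-hold k = All.++⁺
  (All.map⁺ (All.map (λ {w} w∈ → Closed.ext span-closed (λ N → trans (ℚ.+-identityʳ _) (ℚ.*-identityˡ (biBracket w N))) (span-gen w (inj₁ w∈))) (∈-All (basis k))))
  (All-concatMap _ (All-upTo (4 ℕ.⊓ k) λ j j< → All-concatMap _ (All.map (λ {v} (hv , wv) → All-concatMap (relation v)
    (All.map (λ {g} (hg , wg) → relation-holds k v g hv hg (trans (cong₂ ℕ._+_ wg wv) (ℕ.m∸n+n≡m (ℕ.<⇒≤ (ℕ.<-≤-trans j< (ℕ.m⊓n≤n 4 k))))))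
      (words′-homogeneous (k ∸ j) (k ∸ j)))) (words′-homogeneous j j))))

spanned : ℕ → Bool
spanned k = if all-codable (words k) then solves (map toRow (relations k)) (map encode (words k)) else false

spanned-sound : ∀ k → spanned k ≡ true → ∀ w → Homogeneous k w → Reduced k (biBracket w)
spanned-sound k e w h with all-codable (words k) in e′
... | true = subst (λ v → Reduced k (biBracket v)) (All.lookup (all-codable-sound (words k) e′) w∈)
  (All.lookup (All.map⁻ (solves-sound span-closed decoded (map toRow (relations k)) (map encode (words k))
    (All.map⁺ (All.map (λ {L} → toRow-holds span-closed L) (relations-hold k))) e)) w∈)
  where
  w∈ : w ∈ words k
  w∈ = words′-complete k k ℕ.≤-refl w h

-- Brackets with integral coefficients: bracket (a₁ , …) = [a₁ + 1, …], scaled by Π aⱼ!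

bracket : List ℕ → BiIndex
bracket = map (λ a → suc a , 0)

ipw : ℕ → Series
ipw a i = fromℕ (suc i ^ a)

IH : List ℕ → Family
IH [] = H []
IH (a ∷ as) = I (ipw a) (λ _ → 1ℚ) (IH as)

factorials : List ℕ → ℕ
factorials [] = 1
factorials (a ∷ as) = a ! ℕ.* factorials as

IH-H : ∀ as x → IH as x ≡ fromℕ (factorials as) * H (bracket as) x
IH-H [] x = sym (ℚ.*-identityˡ (H [] x))
IH-H (a ∷ as) x = begin
  I (ipw a) one′ (IH as) x
    ≡⟨ Linear.T-cong (I-linearᵃ one′ (IH as)) (λ i → trans (sym (factorial-dp a (suc i))) (ℚ.*-comm (pw a i) _)) x ⟩
  I (λ i → A * pw a i) one′ (IH as) x
    ≡⟨ Linear.T-* (I-linearᵃ one′ (IH as)) A (pw a) x ⟩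
  A * I (pw a) one′ (IH as) x
    ≡⟨ cong (A *_) (trans (Linear.T-cong (I-linear (pw a) one′) (IH-H as) x) (Linear.T-* (I-linear (pw a) one′) F (H (bracket as)) x)) ⟩
  A * (F * I (pw a) one′ (H (bracket as)) x)
    ≡⟨ ℚ.*-assoc A F _ ⟨
  A * F * H (bracket (a ∷ as)) x
    ≡⟨ cong (_* H (bracket (a ∷ as)) x) (fromℕ-* (a !) (factorials as)) ⟨
  fromℕ (factorials (a ∷ as)) * H (bracket (a ∷ as)) x ∎
  where
  open ≡-Reasoning
  one′ : ℕ → ℚ
  one′ _ = 1ℚ
  A = fromℕ (a !)
  F = fromℕ (factorials as)

factorials≢0 : ∀ as → fromℕ (factorials as) ≢ 0ℚ
factorials≢0 [] ()
factorials≢0 (a ∷ as) e = factorial≢0 a (trans (sym (ℚ.*-identityʳ _)) (*-cancelˡ (factorials≢0 as)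
  (trans (solve 2 (λ f a → f :* (a :* con 1ℚ) := a :* f) refl (fromℕ (factorials as)) (fromℕ (a !)))
    (trans (sym (fromℕ-* (a !) (factorials as))) (trans e (sym (ℚ.*-zeroʳ (fromℕ (factorials as)))))))))

-- Initial segments of coefficient sequences

data Rep : List ℕ → Series → Set where
  []  : ∀ {f} → Rep [] f
  _∷_ : ∀ {x xs f} → fromℕ x ≡ f 0 → Rep xs (f ∘ suc) → Rep (x ∷ xs) f

rep-cong : ∀ {xs f g} → (∀ n → f n ≡ g n) → Rep xs f → Rep xs g
rep-cong e [] = []
rep-cong e (p ∷ r) = trans p (e 0) ∷ rep-cong (λ n → e (suc n)) r

rep-+ : ∀ {xs ys f g} → Rep xs f → Rep ys g → Rep (zipWith ℕ._+_ xs ys) (λ n → f n + g n)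
rep-+ [] _ = []
rep-+ (p ∷ r) [] = []
rep-+ {x ∷ _} {y ∷ _} (p ∷ r) (q ∷ s) = trans (fromℕ-+ x y) (cong₂ _+_ p q) ∷ rep-+ r s

rep-* : ∀ c {xs f} → Rep xs f → Rep (map (c ℕ.*_) xs) (λ n → fromℕ c * f n)
rep-* c [] = []
rep-* c {x ∷ _} (p ∷ r) = trans (fromℕ-* c x) (cong (fromℕ c *_) p) ∷ rep-* c r

rep-take : ∀ n {xs f} → Rep xs f → Rep (take n xs) f
rep-take zero r = []
rep-take (suc n) [] = []
rep-take (suc n) (p ∷ r) = p ∷ rep-take n r

rep-shift : ∀ k {xs f} → Rep xs f → Rep (replicate k 0 ++ xs) (shift k f)
rep-shift zero r = r
rep-shift (suc k) r = refl ∷ rep-shift k r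

-- Σ_{j ≥ 0} (v + j)^a q^{(m+1)j} g
Geo : ℕ → ℕ → ℕ → Series → Series
Geo a m v g N = ∑ (suc N) (λ j → fromℕ ((v ℕ.+ j) ^ a) * shift (suc m ℕ.* j) g N)

shift-Geo : ∀ a m v g N → shift (suc m) (Geo a m v g) N ≡ ∑ N (λ i → fromℕ ((v ℕ.+ i) ^ a) * shift (suc m ℕ.* suc i) g N)
shift-Geo a m v g N = begin
  shift (suc m) (Geo a m v g) N
    ≡⟨ shift-cong≤ (suc m) N (λ n n≤N → sym (∑-extend (suc n) (suc N) (λ j → c j * shift (suc m ℕ.* j) g n) (s≤s n≤N)
         (λ j n<j → trans (cong (c j *_) (shift-> (suc m ℕ.* j) g n (ℕ.<-≤-trans n<j (ℕ.m≤m+n j (m ℕ.* j))))) (ℚ.*-zeroʳ (c j))))) ⟩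
  shift (suc m) (λ n → ∑ (suc N) (λ j → c j * shift (suc m ℕ.* j) g n)) N
    ≡⟨ shift-∑ (suc m) (suc N) (λ j n → c j * shift (suc m ℕ.* j) g n) N ⟩
  ∑ (suc N) (λ j → shift (suc m) (λ n → c j * shift (suc m ℕ.* j) g n) N)
    ≡⟨ ∑-cong (suc N) (λ j → trans (shift-*ˡ (suc m) (c j) (shift (suc m ℕ.* j) g) N)
         (cong (c j *_) (trans (shift-shift (suc m) (suc m ℕ.* j) g N) (cong (λ k → shift k g N) (sym (ℕ.*-suc (suc m) j)))))) ⟩
  ∑ N (λ i → c i * shift (suc m ℕ.* suc i) g N) + c N * shift (suc m ℕ.* suc N) g N
    ≡⟨ cong (_+_ (∑ N (λ i → c i * shift (suc m ℕ.* suc i) g N))) (trans (cong (c N *_) (shift-> (suc m ℕ.* suc N) g N (ℕ.m≤m+n (suc N) (m ℕ.* suc N)))) (ℚ.*-zeroʳ (c N))) ⟩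
  ∑ N (λ i → c i * shift (suc m ℕ.* suc i) g N) + 0ℚ
    ≡⟨ ℚ.+-identityʳ _ ⟩
  ∑ N (λ i → c i * shift (suc m ℕ.* suc i) g N) ∎
  where
  open ≡-Reasoning
  c : ℕ → ℚ
  c j = fromℕ ((v ℕ.+ j) ^ a)

-- Horner's scheme: split off j = 0 and factor q^(m+1) out of the rest.
Geo-rec : ∀ a m v g N → fromℕ (v ^ a) * g N + shift (suc m) (Geo a m (suc v) g) N ≡ Geo a m v g N
Geo-rec a m v g N = sym (trans (∑-head N _) (cong₂ _+_
  (cong₂ (λ x k → fromℕ (x ^ a) * shift k g N) (ℕ.+-identityʳ v) (ℕ.*-zeroʳ (suc m)))
  (trans (∑-cong N (λ i → cong (λ x → fromℕ (x ^ a) * shift (suc m ℕ.* suc i) g N) (ℕ.+-suc v i))) (sym (shift-Geo a m (suc v) g N)))))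

geo : ℕ → ℕ → ℕ → ℕ → ℕ → List ℕ → List ℕ
geo zero a m v n xs = []
geo (suc fuel) a m v zero xs = []
geo (suc fuel) a m v n@(suc _) xs = zipWith ℕ._+_ (map (v ^ a ℕ.*_) (take n xs)) (replicate (suc m) 0 ++ geo fuel a m (suc v) (n ∸ suc m) xs)

rep-geo : ∀ fuel a m v n {xs g} → Rep xs g → Rep (geo fuel a m v n xs) (Geo a m v g)
rep-geo zero a m v n r = []
rep-geo (suc fuel) a m v zero r = []
rep-geo (suc fuel) a m v n@(suc _) {g = g} r = rep-cong (Geo-rec a m v g)
  (rep-+ (rep-* (v ^ a) (rep-take n r)) (rep-shift (suc m) (rep-geo fuel a m (suc v) (n ∸ suc m) r)))

-- Entry i describes the family at truncation m + i. All truncations are kept, because adjoining a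
-- letter with index u uses the inner sum truncated at u - 1.
data Table (F : Family) : ℕ → ∀ {n} → Vec (List ℕ) n → Set where
  []  : ∀ {m} → Table F m []
  _∷_ : ∀ {m n xs} {t : Vec (List ℕ) n} → Rep xs (λ N → F (m , N)) → Table F (suc m) t → Table F m (xs ∷ t)

-- Evaluating the numbers of the list first keeps the memory consumption low.
afterℕ : {A : Set} → List ℕ → A → A
afterℕ [] a = a
afterℕ (zero ∷ xs) a = afterℕ xs a
afterℕ (suc _ ∷ xs) a = afterℕ xs a

afterℕ-id : {A : Set} (P : A → Set) (xs : List ℕ) {a : A} → P a → P (afterℕ xs a)
afterℕ-id P [] p = p
afterℕ-id P (zero ∷ xs) p = afterℕ-id P xs p
afterℕ-id P (suc _ ∷ xs) p = afterℕ-id P xs p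

-- Prefix sums: passing from truncation m to m + 1 adds the terms with largest index m + 1, a
-- shifted `Geo` of the inner row at m. One pass over the table gives every truncation of the longer
-- bracket; `acc` is the running sum.
extend : ∀ {n} → ℕ → ℕ → List ℕ → Vec (List ℕ) n → ℕ → Vec (List ℕ) n
extend a M acc [] m = []
extend a M acc (xs ∷ t) m = afterℕ acc (acc ∷ extend a M (zipWith ℕ._+_ acc (replicate (suc m) 0 ++ geo M a m 1 (M ∸ suc m) xs)) t (suc m))

table-extend : ∀ a as M acc {n} {t : Vec (List ℕ) n} m → Rep acc (λ N → IH (a ∷ as) (m , N)) → Table (IH as) m t → Table (IH (a ∷ as)) m (extend a M acc t m)
table-extend a as M acc m r [] = []
table-extend a as M acc m r (p ∷ t) = afterℕ-id (Table (IH (a ∷ as)) m) acc (r ∷ table-extend a as M _ (suc m)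
  (rep-cong (λ N → cong (_+_ (IH (a ∷ as) (m , N))) (trans (shift-Geo a m 1 (λ n → IH as (m , n)) N) (sym (ℚ.*-identityˡ _))))
    (rep-+ r (rep-shift (suc m) (rep-geo M a m 1 (M ∸ suc m) p)))) t)

final : ∀ {A : Set} {n} → Vec A (suc n) → A
final (x ∷ []) = x
final (x ∷ y ∷ ys) = final (y ∷ ys)

table-final : ∀ {F m n} {t : Vec (List ℕ) (suc n)} → Table F m t → Rep (final t) (λ N → F (m ℕ.+ n , N))
table-final {F} {m} (r ∷ []) = rep-cong (λ N → cong (λ k → F (k , N)) (sym (ℕ.+-identityʳ m))) r
table-final {F} {m} {suc n} (r ∷ t@(_ ∷ _)) = rep-cong (λ N → cong (λ k → F (k , N)) (sym (ℕ.+-suc m n))) (table-final t)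

zeros-rep : ∀ n f → (∀ i → f i ≡ 0ℚ) → Rep (replicate n 0) f
zeros-rep zero f z = []
zeros-rep (suc n) f z = sym (z 0) ∷ zeros-rep n (f ∘ suc) (z ∘ suc)

-- Coefficient columns of the integral 123-brackets

module _ (M : ℕ) where

  start : ∀ n → Vec (List ℕ) n
  start zero = []
  start (suc n) = (1 ∷ replicate M 0) ∷ start n

  start-table : ∀ m n → Table (IH []) m (start n)
  start-table m zero = []
  start-table m (suc n) = (refl ∷ zeros-rep M _ (λ _ → refl)) ∷ start-table (suc m) n

  -- Depth-first search that adjoins letters on the left, so brackets with a common tail share its
  -- table. The range `upTo 3` of a = s - 1 means entries in {1,2,3}, and `budget` is the weight
  -- left.
  walk : ℕ → ℕ → List ℕ → Vec (List ℕ) (suc M) → List (List ℕ × List ℕ)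
  walk zero budget as t = []
  walk (suc fuel) budget as t = afterℕ (final t) ((as , final t) ∷ concatMap (λ a →
    if suc a ≤ᵇ budget then walk fuel (budget ∸ suc a) (a ∷ as) (extend a (suc M) (replicate (suc M) 0) t 0) else []) (upTo 3))

  Column : List ℕ → List ℕ → Set
  Column as xs = Rep xs (λ N → IH as (M , N))

  walk-columns : ∀ fuel budget as t → Table (IH as) 0 t → All (λ p → Column (proj₁ p) (proj₂ p)) (walk fuel budget as t)
  walk-columns zero budget as t h = []
  walk-columns (suc fuel) budget as t h = afterℕ-id (All _) (final t) (table-final h ∷ All-concatMap _ (All-upTo 3 λ a _ →
    if-case (All _) (suc a ≤ᵇ budget)
      (λ _ → walk-columns fuel (budget ∸ suc a) (a ∷ as) _ (table-extend a as (suc M) (replicate (suc M) 0) 0 (zeros-rep (suc M) _ (λ _ → refl)) h))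
      (λ _ → [])))

  -- A bracket not found gets the empty column, for which `Column` is vacuous; `uncons` then
  -- produces no row, and the test cannot succeed by accident.
  column : List ℕ → List (List ℕ × List ℕ) → List ℕ
  column as [] = []
  column as ((bs , xs) ∷ ps) = if does (List.≡-dec ℕ._≟_ as bs) then xs else column as ps

  column-sound : ∀ as ps → All (λ p → Column (proj₁ p) (proj₂ p)) ps → Column as (column as ps)
  column-sound as [] [] = []
  column-sound as ((bs , xs) ∷ ps) (h ∷ hs) with List.≡-dec ℕ._≟_ as bs
  ... | yes refl = h
  ... | no _ = column-sound as ps hs

-- Rows of the linear system Σ_i x_i f_i(N) = 0; the unknown x_i is the variable K - i.

dot : List ℚ → List Series → Series
dot [] fs N = 0ℚ
dot (x ∷ xs) [] N = 0ℚ
dot (x ∷ xs) (f ∷ fs) N = x * f N + dot xs fs N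

-- The numbering K - i makes the variables decrease along the row, as the elimination expects.
row : ℕ → ℕ → List ℕ → Row
row K i [] = []
row K i (h ∷ hs) = cons (+ h) (K ∸ i) (row K (suc i) hs)

uncons : List (List ℕ) → Maybe (List ℕ × List (List ℕ))
uncons [] = just ([] , [])
uncons ([] ∷ cs) = nothing
uncons ((x ∷ xs) ∷ cs) with uncons cs
... | nothing = nothing
... | just (hs , ts) = just (x ∷ hs , xs ∷ ts)

rows : ℕ → ℕ → List (List ℕ) → List Row
rows K zero cs = []
rows K (suc M) cs with uncons cs
... | nothing = []
... | just (hs , ts) = row K 0 hs ∷ rows K M ts

nth : List ℚ → ℕ → ℚ
nth [] _ = 0ℚ
nth (x ∷ xs) zero = x
nth (x ∷ xs) (suc i) = nth xs i

data Columns : List (List ℕ) → List Series → Set where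
  []  : Columns [] []
  _∷_ : ∀ {c cs f fs} → Rep c f → Columns cs fs → Columns (c ∷ cs) (f ∷ fs)

data Heads : List ℕ → List Series → Set where
  []  : Heads [] []
  _∷_ : ∀ {h hs f fs} → fromℕ h ≡ f 0 → Heads hs fs → Heads (h ∷ hs) (f ∷ fs)

uncons-sound : ∀ {cs fs hs ts} → Columns cs fs → uncons cs ≡ just (hs , ts) → Heads hs fs × Columns ts (map (_∘ suc) fs)
uncons-sound [] refl = [] , []
uncons-sound {(x ∷ xs) ∷ cs} ((p ∷ r) ∷ rs) e with uncons cs in e′
uncons-sound {(x ∷ xs) ∷ cs} ((p ∷ r) ∷ rs) refl | just (hs , ts) with uncons-sound rs e′
... | hh , tt′ = p ∷ hh , r ∷ tt′

module _ (K : ℕ) (xs : List ℚ) where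

  unknown : ℕ → ⊤ → ℚ
  unknown n _ = nth xs (K ∸ n)

  -- The zero subspace of functions on a point: here a successful elimination says that the unknowns
  -- themselves are zero.
  Zero : (⊤ → ℚ) → Set
  Zero f = f tt ≡ 0ℚ

  zero-closed : Closed Zero
  zero-closed = record
    { ext = λ e z → trans (e tt) z ; nil = refl
    ; plus = λ z z′ → trans (cong₂ _+_ z z′) (ℚ.+-identityʳ 0ℚ) ; mult = λ c z → trans (cong (c *_) z) (ℚ.*-zeroʳ c) }

  sumFrom : ℕ → List Series → Series
  sumFrom i [] N = 0ℚ
  sumFrom i (f ∷ fs) N = nth xs i * f N + sumFrom (suc i) fs N

  evZ-row : ∀ i {hs fs} → Heads hs fs → i ℕ.+ length hs ≤ K → evZ unknown (row K i hs) tt ≡ sumFrom i fs 0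
  evZ-row i [] l = refl
  evZ-row i {h ∷ hs} {f ∷ fs} (p ∷ r) l = trans (evZ-cons zero-closed unknown (+ h) (K ∸ i) (row K (suc i) hs) tt)
    (cong₂ _+_ (trans (cong₂ _*_ p (cong (nth xs) (ℕ.m∸[m∸n]≡n (ℕ.≤-trans (ℕ.m≤m+n i _) l)))) (ℚ.*-comm (f 0) _))
      (evZ-row (suc i) r (subst (_≤ K) (ℕ.+-suc i (length hs)) l)))

  sumFrom-tail : ∀ i fs N → sumFrom i (map (_∘ suc) fs) N ≡ sumFrom i fs (suc N)
  sumFrom-tail i [] N = refl
  sumFrom-tail i (f ∷ fs) N = cong (_+_ (nth xs i * f (suc N))) (sumFrom-tail (suc i) fs N)

  heads-length : ∀ {hs fs} → Heads hs fs → length hs ≡ length fs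
  heads-length [] = refl
  heads-length (_ ∷ r) = cong suc (heads-length r)

  rows-hold : ∀ M {cs fs} → Columns cs fs → length fs ≤ K → (∀ N → N < M → sumFrom 0 fs N ≡ 0ℚ) → All (λ r → Zero (evZ unknown r)) (rows K M cs)
  rows-hold zero c l z = []
  rows-hold (suc M) {cs} {fs} c l z with uncons cs in e
  ... | nothing = []
  ... | just (hs , ts) with uncons-sound c e
  ...   | hh , ct = trans (evZ-row 0 hh (subst (_≤ K) (sym (heads-length hh)) l)) (z 0 (s≤s z≤n))
          ∷ rows-hold M ct (subst (_≤ K) (sym (List.length-map (_∘ suc) fs)) l) (λ N N<M → trans (sumFrom-tail 0 fs N) (z (suc N) (s≤s N<M)))

dot-sumFrom : ∀ K xs fs N → dot xs fs N ≡ sumFrom K xs 0 fs N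
dot-sumFrom K [] fs N = sym (zeros 0 fs)
  where
  zeros : ∀ i fs → sumFrom K [] i fs N ≡ 0ℚ
  zeros i [] = refl
  zeros i (f ∷ fs) = trans (cong₂ _+_ (ℚ.*-zeroˡ (f N)) (zeros (suc i) fs)) (ℚ.+-identityʳ 0ℚ)
dot-sumFrom K (x ∷ xs) [] N = refl
dot-sumFrom K (x ∷ xs) (f ∷ fs) N = cong (_+_ (x * f N)) (trans (dot-sumFrom K xs fs N) (later 0 fs))
  where
  later : ∀ i fs → sumFrom K xs i fs N ≡ sumFrom K (x ∷ xs) (suc i) fs N
  later i [] = refl
  later i (g ∷ gs) = cong (_+_ (nth xs i * g N)) (later (suc i) gs)

-- Independence is tested on the coefficients of q^0, …, q^M.
independent : ℕ → ℕ → List (List ℕ) → Bool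
independent M budget ws = test (walk M (suc budget) budget [] (start M (suc M)))
  where
  test : List (List ℕ × List ℕ) → Bool
  test table = solves (rows (length ws) (suc M) (map (λ as → column M as table) ws)) (map (length ws ∸_) (upTo (length ws)))

nth-zero : ∀ n xs → length xs ≤ n → (∀ i → i < n → nth xs i ≡ 0ℚ) → All (_≡ 0ℚ) xs
nth-zero n [] l z = []
nth-zero (suc n) (x ∷ xs) (s≤s l) z = z 0 (s≤s z≤n) ∷ nth-zero n xs l (λ i i<n → z (suc i) (s≤s i<n))

-- Dividing each coefficient by Π a_j! turns the relation into one between integral columns. Lists
-- shorter than `ws` are allowed, with `nth` supplying zeros, so the test also settles every initial
-- part of `ws`.
independent-sound : ∀ M budget ws → independent M budget ws ≡ true → ∀ xs → length xs ≤ length ws →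
  (∀ N → dot xs (map (biBracket ∘ bracket) ws) N ≡ 0ℚ) → All (_≡ 0ℚ) xs
independent-sound M budget ws e xs l z = rescaled-zero xs ws l (nth-zero K _ (subst (_≤ K) (sym (rescaled-length xs ws l)) l) nth≡0)
  where
  K = length ws
  table = walk M (suc budget) budget [] (start M (suc M))
  ρ : List ℕ → ℚ
  ρ as = proj₁ (inverse (factorials≢0 as))
  rescaled : List ℚ → List (List ℕ) → List ℚ
  rescaled = zipWith (λ x as → x * ρ as)
  rescaled-length : ∀ xs ws → length xs ≤ length ws → length (rescaled xs ws) ≡ length xs
  rescaled-length [] ws l = refl
  rescaled-length (x ∷ xs) (as ∷ ws) (s≤s l) = cong suc (rescaled-length xs ws l)
  ρ-factorials : ∀ as → ρ as * fromℕ (factorials as) ≡ 1ℚ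
  ρ-factorials as = proj₂ (inverse (factorials≢0 as))
  rescaled-zero : ∀ xs ws → length xs ≤ length ws → All (_≡ 0ℚ) (rescaled xs ws) → All (_≡ 0ℚ) xs
  rescaled-zero [] ws l h = []
  rescaled-zero (x ∷ xs) (as ∷ ws) (s≤s l) (p ∷ h) = (begin
    x                                       ≡⟨ ℚ.*-identityʳ x ⟨
    x * 1ℚ                                  ≡⟨ cong (x *_) (ρ-factorials as) ⟨
    x * (ρ as * fromℕ (factorials as))      ≡⟨ ℚ.*-assoc x (ρ as) _ ⟨
    x * ρ as * fromℕ (factorials as)        ≡⟨ cong (_* fromℕ (factorials as)) p ⟩
    0ℚ * fromℕ (factorials as)              ≡⟨ ℚ.*-zeroˡ (fromℕ (factorials as)) ⟩
    0ℚ                                      ∎) ∷ rescaled-zero xs ws l h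
    where open ≡-Reasoning
  integral : List ℕ → Series
  integral as N = IH as (M , N)
  rescaled-dot : ∀ xs ws N → N ≤ M → dot (rescaled xs ws) (map integral ws) N ≡ dot xs (map (biBracket ∘ bracket) ws) N
  rescaled-dot [] ws N l = refl
  rescaled-dot (x ∷ xs) [] N l = refl
  rescaled-dot (x ∷ xs) (as ∷ ws) N l = cong₂ _+_ (begin
    x * ρ as * IH as (M , N)
      ≡⟨ cong (x * ρ as *_) (trans (IH-H as (M , N)) (cong (fromℕ (factorials as) *_) (trans (H-stable (bracket as) l) (sym (biBracket-H (bracket as) N))))) ⟩
    x * ρ as * (fromℕ (factorials as) * biBracket (bracket as) N)
      ≡⟨ solve 4 (λ x r f b → x :* r :* (f :* b) := r :* f :* (x :* b)) refl x (ρ as) (fromℕ (factorials as)) (biBracket (bracket as) N) ⟩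
    ρ as * fromℕ (factorials as) * (x * biBracket (bracket as) N)
      ≡⟨ trans (cong (_* (x * biBracket (bracket as) N)) (ρ-factorials as)) (ℚ.*-identityˡ _) ⟩
    x * biBracket (bracket as) N ∎) (rescaled-dot xs ws N l)
    where open ≡-Reasoning
  ys = rescaled xs ws
  columns : ∀ ws → Columns (map (λ as → column M as table) ws) (map integral ws)
  columns [] = []
  columns (as ∷ ws) = column-sound M as table (walk-columns M (suc budget) budget [] _ (start-table M 0 (suc M))) ∷ columns ws
  holds : All (λ r → Zero K ys (evZ (unknown K ys) r)) (rows K (suc M) (map (λ as → column M as table) ws))
  holds = rows-hold K ys (suc M) (columns ws) (ℕ.≤-reflexive (List.length-map integral ws))
    (λ N N≤M → trans (sym (dot-sumFrom K ys (map integral ws) N)) (trans (rescaled-dot xs ws N (ℕ.≤-pred N≤M)) (z N)))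
  vanish : All (λ i → Zero K ys (unknown K ys (K ∸ i))) (upTo K)
  vanish = All.map⁻ (solves-sound (zero-closed K ys) (unknown K ys) _ _ holds e)
  nth≡0 : ∀ i → i < K → nth ys i ≡ 0ℚ
  nth≡0 i i<K = trans (cong (nth ys) (sym (ℕ.m∸[m∸n]≡n (ℕ.<⇒≤ i<K)))) (All.applyUpTo⁻ (λ i → i) K vanish i<K)

-- Bases and dimensions

bases : ℕ → List BiIndex
bases zero = []
bases (suc n) = bases n ++ basis n

All-bases : ∀ {P : BiIndex → Set} n → (∀ k → k < n → All P (basis k)) → All P (bases n)
All-bases zero h = []
All-bases (suc n) h = All.++⁺ (All-bases n (λ k k<n → h k (ℕ.m≤n⇒m≤1+n k<n))) (h n ℕ.≤-refl)

-- Induction on the weight: `spanned-sound` treats the top weight, and the induction hypothesis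
-- resolves the unspecified remainder of lower weight.
reduce-to-bases : ∀ n → (∀ k → k < n → spanned k ≡ true) → ∀ w → Lower n w → Span biBracket (_∈ bases n) (biBracket w)
reduce-to-bases (suc n) s w (v , w≤n) with ℕ.m≤n⇒m<n∨m≡n (ℕ.≤-pred w≤n)
... | inj₁ w<n = span-mono ∈-++⁺ˡ (reduce-to-bases n (λ k k<n → s k (ℕ.m≤n⇒m≤1+n k<n)) w (v , w<n))
... | inj₂ w≡n = span-least span-closed
  (λ { u (inj₁ u∈) → span-gen u (∈-++⁺ʳ (bases n) u∈)
     ; u (inj₂ l) → span-mono ∈-++⁺ˡ (reduce-to-bases n (λ k k<n → s k (ℕ.m≤n⇒m≤1+n k<n)) u l) })
  (spanned-sound n (s n ℕ.≤-refl) w (v , w≡n))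

-- Each letter has s ≥ 1. Hence the depth bounds in the filtration follow from the weight bounds.
depth≤weight : ∀ w → ValidBi w → depth w ≤ weight w
depth≤weight [] [] = z≤n
depth≤weight ((s , r) ∷ w) (p ∷ h) = ℕ.+-mono-≤ (ℕ.≤-trans p (ℕ.m≤m+n s r)) (depth≤weight w h)

lower-below : ∀ {k w} → Lower k w → GenFilBelow k w
lower-below {w = w} (v , l) = v , ℕ.≤-<-trans (depth≤weight w v) l , l

-- Coordinates with respect to a list of brackets

combo-+ : ∀ {d} (c c′ : Fin d → ℚ) b N → combo (λ i → c i + c′ i) b N ≡ combo c b N + combo c′ b N
combo-+ {zero} c c′ b N = refl
combo-+ {suc d} c c′ b N = trans (cong (_+_ ((c zero + c′ zero) * b zero N)) (combo-+ (c ∘ suc) (c′ ∘ suc) (b ∘ suc) N))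
  (solve 5 (λ x y b p q → (x :+ y) :* b :+ (p :+ q) := (x :* b :+ p) :+ (y :* b :+ q)) refl
    (c zero) (c′ zero) (b zero N) (combo (c ∘ suc) (b ∘ suc) N) (combo (c′ ∘ suc) (b ∘ suc) N))

combo-* : ∀ {d} x (c : Fin d → ℚ) b N → combo (λ i → x * c i) b N ≡ x * combo c b N
combo-* {zero} x c b N = sym (ℚ.*-zeroʳ x)
combo-* {suc d} x c b N = trans (cong (_+_ (x * c zero * b zero N)) (combo-* x (c ∘ suc) (b ∘ suc) N))
  (solve 4 (λ x c b p → x :* c :* b :+ x :* p := x :* (c :* b :+ p)) refl x (c zero) (b zero N) (combo (c ∘ suc) (b ∘ suc) N))

combo-0 : ∀ {d} (b : Fin d → Series) N → combo (λ _ → 0ℚ) b N ≡ 0ℚ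
combo-0 {zero} b N = refl
combo-0 {suc d} b N = trans (cong₂ _+_ (ℚ.*-zeroˡ (b zero N)) (combo-0 (b ∘ suc) N)) (ℚ.+-identityʳ 0ℚ)

brackets : (ws : List BiIndex) → Fin (length ws) → Series
brackets ws i = biBracket (lookup ws i)

unit : ∀ {w} {ws : List BiIndex} → w ∈ ws → Fin (length ws) → ℚ
unit (here _) zero = 1ℚ
unit (here _) (suc i) = 0ℚ
unit (there w∈) zero = 0ℚ
unit (there w∈) (suc i) = unit w∈ i

combo-unit : ∀ {w ws} (w∈ : w ∈ ws) N → combo (unit w∈) (brackets ws) N ≡ biBracket w N
combo-unit {w} {_ ∷ ws} (here refl) N = trans (cong₂ _+_ (ℚ.*-identityˡ (biBracket w N)) (combo-0 (brackets ws) N)) (ℚ.+-identityʳ _)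
combo-unit {w} {v ∷ ws} (there w∈) N = trans (cong₂ _+_ (ℚ.*-zeroˡ (biBracket v N)) (combo-unit w∈ N)) (ℚ.+-identityˡ _)

-- Having coordinates modulo the span of `Q` is itself a closed condition, so generators suffice. It
-- is applied with `Q` empty for independence and with lower weight for spanning.
coordinates : ∀ ws {Q : BiIndex → Set} {f} → Span biBracket (λ w → w ∈ ws ⊎ Q w) f →
  Σ (Fin (length ws) → ℚ) λ c → Span biBracket Q (λ N → f N - combo c (brackets ws) N)
coordinates ws {Q} = span-least closed gens
  where
  Coordinates : Series → Set
  Coordinates f = Σ (Fin (length ws) → ℚ) λ c → Span biBracket Q (λ N → f N - combo c (brackets ws) N)
  open Closed (span-closed {gen = biBracket} {Q})
  closed : Closed Coordinates
  closed = record
    { ext = λ e (c , s) → c , ext (λ N → cong (_- combo c (brackets ws) N) (e N)) s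
    ; nil = (λ _ → 0ℚ) , ext (λ N → cong (_-_ (0ℚ)) (combo-0 (brackets ws) N)) nil
    ; plus = λ {f} {g} (c , s) (c′ , s′) → (λ i → c i + c′ i) , ext (λ N → trans (cong (λ z → (f N + g N) - z) (combo-+ c c′ (brackets ws) N))
        (solve 4 (λ f g x y → (f :+ g) :- (x :+ y) := (f :- x) :+ (g :- y)) refl (f N) (g N) (combo c (brackets ws) N) (combo c′ (brackets ws) N))) (plus s s′)
    ; mult = λ x {f} (c , s) → (λ i → x * c i) , ext (λ N → trans (cong (λ z → x * f N - z) (combo-* x c (brackets ws) N))
        (solve 3 (λ x f c → x :* f :- x :* c := x :* (f :- c)) refl x (f N) (combo c (brackets ws) N))) (mult x s)
    }
  gens : ∀ w → w ∈ ws ⊎ Q w → Coordinates (biBracket w)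
  gens w (inj₁ w∈) = unit w∈ , ext (λ N → trans (cong (_-_ (biBracket w N)) (combo-unit w∈ N)) (ℚ.+-inverseʳ (biBracket w N))) nil
  gens w (inj₂ q) = (λ _ → 0ℚ) , ext (λ N → trans (cong (_-_ (biBracket w N)) (combo-0 (brackets ws) N)) (ℚ.+-identityʳ _)) (span-gen w q)

dot-tabulate : ∀ ws (c : Fin (length ws) → ℚ) N → dot (tabulate c) (map biBracket ws) N ≡ combo c (brackets ws) N
dot-tabulate [] c N = refl
dot-tabulate (w ∷ ws) c N = cong (_+_ (c zero * biBracket w N)) (dot-tabulate ws (c ∘ suc) N)

dot-++ : ∀ xs ys fs gs N → length xs ≡ length fs → dot (xs ++ ys) (fs ++ gs) N ≡ dot xs fs N + dot ys gs N
dot-++ [] ys [] gs N e = sym (ℚ.+-identityˡ _)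
dot-++ (x ∷ xs) ys (f ∷ fs) gs N e = trans (cong (_+_ (x * f N)) (dot-++ xs ys fs gs N (ℕ.suc-injective e))) (sym (ℚ.+-assoc (x * f N) (dot xs fs N) (dot ys gs N)))

dot-prefix : ∀ xs fs gs N → length xs ≡ length fs → dot xs (fs ++ gs) N ≡ dot xs fs N
dot-prefix xs fs gs N e = trans (cong (λ zs → dot zs (fs ++ gs) N) (sym (List.++-identityʳ xs))) (trans (dot-++ xs [] fs gs N e) (ℚ.+-identityʳ _))

exponents : BiIndex → List ℕ
exponents = map (λ l → proj₁ l ∸ 1)

Basic : BiIndex → Set
Basic w = ValidBi w × Is123 w

is123-sound : ∀ w → ValidBi w → is123 w ≡ true → Is123 w
is123-sound [] v e = []
is123-sound ((s , r) ∷ w) (p ∷ v) e with s ≤ᵇ 3 in e₁ | r ≡ᵇ 0 in e₂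
... | true | true = (small s p (ℕ.≤ᵇ⇒≤ s 3 (subst T (sym e₁) tt)) , ≡ᵇ-sound r 0 e₂) ∷ is123-sound w v e
  where
  small : ∀ s → 1 ≤ s → s ≤ 3 → s ≡ 1 ⊎ s ≡ 2 ⊎ s ≡ 3
  small 1 _ _ = inj₁ refl
  small 2 _ _ = inj₂ (inj₁ refl)
  small 3 _ _ = inj₂ (inj₂ refl)
  small (suc (suc (suc (suc _)))) _ (s≤s (s≤s (s≤s ())))

basis-basic : ∀ k → All Basic (basis k)
basis-basic k = All.map (λ {w} ((v , _) , e) → v , is123-sound w v e) (basis-homogeneous k)

bracket-exponents : ∀ {w} → Basic w → bracket (exponents w) ≡ w
bracket-exponents {[]} _ = refl
bracket-exponents {(suc a , r) ∷ w} (_ ∷ v , (_ , refl) ∷ i) = cong ((suc a , 0) ∷_) (bracket-exponents (v , i))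

map-bracket-exponents : ∀ {ws} → All Basic ws → map (biBracket ∘ bracket) (map exponents ws) ≡ map biBracket ws
map-bracket-exponents [] = refl
map-bracket-exponents (h ∷ hs) = cong₂ _∷_ (cong biBracket (bracket-exponents h)) (map-bracket-exponents hs)

bases-prefix : ∀ m j → ∃[ rest ] bases (j ℕ.+ m) ≡ bases m ++ rest
bases-prefix m zero = [] , sym (List.++-identityʳ (bases m))
bases-prefix m (suc j) with bases-prefix m j
... | rest , e = rest ++ basis (j ℕ.+ m) , trans (cong (_++ basis (j ℕ.+ m)) e) (List.++-assoc (bases m) rest _)

span-∅ : ∀ {f} → Span biBracket (λ _ → ⊥) f → ∀ N → f N ≡ 0ℚ
span-∅ ([] , _ , e) N = e N
span-∅ (_ ∷ _ , () ∷ _ , _) N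

-- Independence and spanning in the graded pieces

module _ (n : ℕ) (spans : ∀ k → k < n → spanned k ≡ true) (indep : ∃[ M ] ∃[ budget ] independent M budget (map exponents (bases n)) ≡ true) where

  dependence-trivial : ∀ k → suc k ≤ n → ∀ xs → length xs ≡ length (bases (suc k)) → (∀ N → dot xs (map biBracket (bases (suc k))) N ≡ 0ℚ) → All (_≡ 0ℚ) xs
  dependence-trivial k k<n xs l z = independent-sound (proj₁ indep) (proj₁ (proj₂ indep)) (map exponents (bases n)) (proj₂ (proj₂ indep)) xs
    (ℕ.≤-trans (ℕ.≤-reflexive l) (subst (length (bases (suc k)) ≤_) (trans (cong length (sym split)) (sym (List.length-map exponents (bases n))))
      (subst (length (bases (suc k)) ≤_) (sym (List.length-++ (bases (suc k)))) (ℕ.m≤m+n _ _))))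
    (λ N → begin
      dot xs (map (biBracket ∘ bracket) (map exponents (bases n))) N
        ≡⟨ cong (λ fs → dot xs fs N) (trans (map-bracket-exponents (All-bases n (λ k _ → basis-basic k))) (trans (cong (map biBracket) split) (List.map-++ biBracket (bases (suc k)) rest))) ⟩
      dot xs (map biBracket (bases (suc k)) ++ map biBracket rest) N
        ≡⟨ dot-prefix xs (map biBracket (bases (suc k))) (map biBracket rest) N (trans l (sym (List.length-map biBracket (bases (suc k))))) ⟩
      dot xs (map biBracket (bases (suc k))) N
        ≡⟨ z N ⟩
      0ℚ ∎)
    where
    open ≡-Reasoning
    rest = proj₁ (bases-prefix (suc k) (n ∸ suc k))
    split : bases n ≡ bases (suc k) ++ rest
    split = trans (cong bases (sym (ℕ.m∸n+n≡m k<n))) (proj₂ (bases-prefix (suc k) (n ∸ suc k)))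

  -- An element of the lower filtration step is a combination of `bases k`. Moving that combination
  -- to the other side gives a dependence among `bases (suc k)`, which is an initial part of the
  -- family tested.
  basis-independent : ∀ k → k < n → (c : Fin (length (basis k)) → ℚ) → FilBelow k (combo c (brackets (basis k))) → ∀ i → c i ≡ 0ℚ
  basis-independent k k<n c below = All.tabulate⁻ (All.++⁻ʳ (tabulate (λ i → (- 1ℚ) * c′ i)) (dependence-trivial k k<n xs xs-length zero-combination))
    where
    open ≡-Reasoning
    lower : Span biBracket (λ w → w ∈ bases k ⊎ ⊥) (combo c (brackets (basis k)))
    lower = span-mono inj₁ (span-least span-closed (λ w (v , _ , l) → reduce-to-bases k (λ j j<k → spans j (ℕ.<-trans j<k k<n)) w (v , l)) below)
    c′ : Fin (length (bases k)) → ℚ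
    c′ = proj₁ (coordinates (bases k) lower)
    xs = tabulate (λ i → (- 1ℚ) * c′ i) ++ tabulate c
    xs-length : length xs ≡ length (bases (suc k))
    xs-length = trans (List.length-++ (tabulate (λ i → (- 1ℚ) * c′ i))) (trans (cong₂ ℕ._+_ (List.length-tabulate _) (List.length-tabulate c)) (sym (List.length-++ (bases k))))
    zero-combination : ∀ N → dot xs (map biBracket (bases (suc k))) N ≡ 0ℚ
    zero-combination N = begin
      dot xs (map biBracket (bases k ++ basis k)) N
        ≡⟨ cong (λ fs → dot xs fs N) (List.map-++ biBracket (bases k) (basis k)) ⟩
      dot xs (map biBracket (bases k) ++ map biBracket (basis k)) N
        ≡⟨ dot-++ (tabulate (λ i → (- 1ℚ) * c′ i)) (tabulate c) (map biBracket (bases k)) (map biBracket (basis k)) N (trans (List.length-tabulate _) (sym (List.length-map biBracket (bases k)))) ⟩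
      dot (tabulate (λ i → (- 1ℚ) * c′ i)) (map biBracket (bases k)) N + dot (tabulate c) (map biBracket (basis k)) N
        ≡⟨ cong₂ _+_ (trans (dot-tabulate (bases k) _ N) (combo-* (- 1ℚ) c′ (brackets (bases k)) N)) (dot-tabulate (basis k) c N) ⟩
      (- 1ℚ) * combo c′ (brackets (bases k)) N + combo c (brackets (basis k)) N
        ≡⟨ solve 2 (λ x y → (:- con 1ℚ) :* x :+ y := y :- x) refl (combo c′ (brackets (bases k)) N) (combo c (brackets (basis k)) N) ⟩
      combo c (brackets (basis k)) N - combo c′ (brackets (bases k)) N
        ≡⟨ span-∅ (proj₂ (coordinates (bases k) lower)) N ⟩
      0ℚ ∎

  graded-dimension : ∀ k → k < n → GrDim k (length (basis k))
  graded-dimension k k<n = brackets (basis k) , in-filtration , basis-independent k k<n , spanning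
    where
    in-filtration : ∀ i → Fil k (brackets (basis k) i)
    in-filtration i with All.lookup (basis-homogeneous k) (∈-lookup {xs = basis k} i)
    ... | (v , w≡k) , _ = span-gen (lookup (basis k) i)
      (v , ℕ.≤-trans (depth≤weight _ v) (ℕ.≤-reflexive w≡k) , ℕ.≤-reflexive w≡k)
    reduced : ∀ w → GenFil k w → Reduced k (biBracket w)
    reduced w (v , _ , w≤k) with ℕ.m≤n⇒m<n∨m≡n w≤k
    ... | inj₁ w<k = span-gen w (inj₂ (v , w<k))
    ... | inj₂ w≡k = spanned-sound k (spans k k<n) w (v , w≡k)
    spanning : ∀ w → GenFil k w → Σ (Fin (length (basis k)) → ℚ) λ c → FilBelow k (λ N → biBracket w N - combo c (brackets (basis k)) N)
    spanning w g with coordinates (basis k) (reduced w g)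
    ... | c , s = c , span-mono lower-below s

  -- One reduction to 123-brackets serves (b), (c) and (d): `P` is instantiated with `Positive`,
  -- `IsBracket` and `Is123`.
  basic-span : ∀ {P : BiIndex → Set} → (∀ {w} → Basic w → P w) → ∀ k → k < n → ∀ w → ValidBi w → weight w ≡ k → InSpan P (biBracket w)
  basic-span {P} h k k<n w v refl = span-mono (λ w∈ → h (All.lookup (All-bases (suc k) (λ j _ → basis-basic j)) w∈))
    (reduce-to-bases (suc k) (λ j j≤k → spans j (ℕ.≤-trans j≤k k<n)) w (v , ℕ.≤-refl))

-- Conclusion in weights at most 7

basic-positive : ∀ {w} → Basic w → Positive w
basic-positive {[]} _ = []
basic-positive {(s , r) ∷ w} (p ∷ v , (_ , refl) ∷ i) = p ∷ basic-positive (v , i)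

basic-bracket : ∀ {w} → Basic w → IsBracket w
basic-bracket {[]} _ = []
basic-bracket {(s , r) ∷ w} (p ∷ v , (_ , refl) ∷ i) = (p , refl) ∷ basic-bracket (v , i)

-- Decided by evaluation: each `refl` runs the whole elimination in that weight.
spanned≤7 : ∀ k → k < 8 → spanned k ≡ true
spanned≤7 0 _ = refl
spanned≤7 1 _ = refl
spanned≤7 2 _ = refl
spanned≤7 3 _ = refl
spanned≤7 4 _ = refl
spanned≤7 5 _ = refl
spanned≤7 6 _ = refl
spanned≤7 7 _ = refl
spanned≤7 (suc (suc (suc (suc (suc (suc (suc (suc k)))))))) (s≤s (s≤s (s≤s (s≤s (s≤s (s≤s (s≤s (s≤s ()))))))))

-- The constant 91 gives as many coefficients as brackets, hence a square system; 7 bounds the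
-- weights that `walk` explores.
independent≤7 : independent 91 7 (map exponents (bases 8)) ≡ true
independent≤7 = refl

basis-length : ∀ k → k < 8 → + length (basis k) ≡ dimSeq k
basis-length 0 _ = refl
basis-length 1 _ = refl
basis-length 2 _ = refl
basis-length 3 _ = refl
basis-length 4 _ = refl
basis-length 5 _ = refl
basis-length 6 _ = refl
basis-length 7 _ = refl
basis-length (suc (suc (suc (suc (suc (suc (suc (suc k)))))))) (s≤s (s≤s (s≤s (s≤s (s≤s (s≤s (s≤s (s≤s ()))))))))

mainTheorem4 : ∀ (k : ℕ) → k ≤ 7 →
    (∃[ d ] (+ d ≡ dimSeq k × GrDim k d))
    × (∀ ι → ValidBi ι → weight ι ≡ k → InSpan Positive (biBracket ι))
    × (∀ ι → ValidBi ι → weight ι ≡ k → InSpan IsBracket (biBracket ι))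
    × (∀ ι → IsBracket ι → weight ι ≡ k → InSpan Is123 (biBracket ι))
mainTheorem4 k k≤7 =
    (length (basis k) , basis-length k (s≤s k≤7) , graded-dimension 8 spanned≤7 indep k (s≤s k≤7))
  , basic-span 8 spanned≤7 indep basic-positive k (s≤s k≤7)
  , basic-span 8 spanned≤7 indep basic-bracket k (s≤s k≤7)
  , λ ι b → basic-span 8 spanned≤7 indep proj₂ k (s≤s k≤7) ι (All.map proj₁ b)
  where indep = 91 , 7 , independent≤7
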